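{- For integers $r\geq3$ and $\ell\geq r$, there exists $s_0=s_0(\ell,r)$ such that for all integers $s\geq s_0$ and all sufficiently large $n$ (depending on $s,\ell,r$), $$\mathrm{ex}_r\left(n,\{K_{\ell+1}^{(r)+},M^{(r)+}_{s+1}\}\right)=s\cdot t_{r-1}(n-s,\ell-1).$$
   Context: An $r$-graph is an $r$-uniform hypergraph. For a graph $F$, the $r$-expansion $F^{(r)+}$ is the $r$-graph obtained from $F$ by adding, for each edge of $F$, $r-2$ new vertices to that edge, all new vertices being distinct from each other and from $V(F)$. $K_{\ell+1}$ is the complete graph on $\ell+1$ vertices. $M^{(r)+}_{s+1}$ is the $r$-uniform matching consisting of $s+1$ pairwise disjoint hyperedges. $\mathrm{ex}_r(n,\mathcal{F})$ is the maximum number of hyperedges in an $n$-vertex $r$-graph containing no member of the family $\mathcal{F}$ as a subhypergraph. For integers $q\ge 2$, $m\ge 1$, $k\ge 2$, $t_q(m,k)$ denotes the number of hyperedges of the complete balanced $k$-partite $q$-graph on $m$ vertices, i.e. the $q$-graph whose vertex set is partitioned into $k$ parts of sizes $\lfloor m/k\rfloor$ or $\lceil m/k\rceil$ and whose hyperedges are all $q$-sets meeting each part in at most one vertex. -}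

module Defs where

open import Data.Nat using (ℕ; zero; suc; _+_; _*_; _∸_; _≤_; _≡ᵇ_; _<ᵇ_)
open import Data.Nat.DivMod using (_%_)
open import Data.Bool using (Bool; true; false; _∧_; if_then_else_)
open import Data.Fin using (Fin; toℕ)
open import Data.Fin.Subset using (Subset; ⁅_⁆; _∪_; _∩_; ⋃; ∣_∣)
open import Data.List using (List; []; _∷_; length; lookup; map; concatMap; allFin; filterᵇ; _++_)
open import Data.Bool.ListAction using (and)
open import Data.List.Relation.Unary.All using (All)
open import Data.List.Relation.Unary.Unique.Propositional using (Unique)
open import Data.List.Membership.Propositional using (_∈_)
open import Data.Vec using (_∷_; []; tabulate)
open import Data.Product using (_×_; _,_; Σ; ∃; proj₁; proj₂)
open import Data.Sum using (_⊎_; inj₁; inj₂)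
open import Data.Empty using (⊥)
open import Relation.Binary.PropositionalEquality using (_≡_)
open import Function.Definitions using (Injective)
open import Relation.Nullary using (¬_)

IsRGraph : (r n : ℕ) → List (Subset n) → Set
IsRGraph r n H = Unique H × All (λ e → ∣ e ∣ ≡ r) H

record Graph : Set₁ where
  field
    V     : Set
    edges : List (V × V)
open Graph public

-- vertex set of the r-expansion F^{(r)+}: the old vertices, plus r-2 new
-- vertices for each edge of F
ExpV : ℕ → Graph → Set
ExpV r F = V F ⊎ (Fin (length (edges F)) × Fin (r ∸ 2))

-- H contains (a copy of) F^{(r)+}: an injective map φ of the vertices of
-- F^{(r)+} into Fin n mapping every hyperedge of F^{(r)+} to a hyperedge of H.
-- The hyperedge of F^{(r)+} for edge number e = (a , b) of F is
-- {a , b} ∪ {(e , k) : k < r-2}.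
ContainsExp : (r n : ℕ) → Graph → List (Subset n) → Set
ContainsExp r n F H =
  Σ (ExpV r F → Fin n) λ φ →
    Injective _≡_ _≡_ φ ×
    ((e : Fin (length (edges F))) →
      (⁅ φ (inj₁ (proj₁ (lookup (edges F) e))) ⁆
        ∪ ⁅ φ (inj₁ (proj₂ (lookup (edges F) e))) ⁆
        ∪ ⋃ (map (λ k → ⁅ φ (inj₂ (e , k)) ⁆) (allFin (r ∸ 2))))
      ∈ H)

Kgraph : ℕ → Graph
Kgraph m = record
  { V = Fin m
  ; edges = concatMap (λ i → concatMap (λ j → if toℕ i <ᵇ toℕ j then (i , j) ∷ [] else []) (allFin m)) (allFin m)
  }

Mgraph : ℕ → Graph
Mgraph m = record
  { V = Fin m × Bool
  ; edges = map (λ i → ((i , false) , (i , true))) (allFin m)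
  }

IsEx : (r n : ℕ) → (List (Subset n) → Set) → ℕ → Set
IsEx r n Free k =
  (∃ λ H → IsRGraph r n H × Free H × length H ≡ k) ×
  ((H : List (Subset n)) → IsRGraph r n H → Free H → length H ≤ k)

-- t_q(m,k): number of q-subsets of Fin m meeting each part in ≤ 1 vertex,
-- where Fin m is split into k balanced parts (part of i is i mod k).

allSubsets : (m : ℕ) → List (Subset m)
allSubsets zero = [] ∷ []
allSubsets (suc m) = map (true ∷_) (allSubsets m) ++ map (false ∷_) (allSubsets m)

part : (m k : ℕ) → Fin (suc k) → Subset m
part m k p = tabulate (λ i → (toℕ i % suc k) ≡ᵇ toℕ p)

-- k = 0 is never used (the paper requires k ≥ 2); value 0 there is a dummy
t : (q m k : ℕ) → ℕ
t q m zero = 0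
t q m (suc k) = length (filterᵇ
  (λ S → (∣ S ∣ ≡ᵇ q) ∧ and (map (λ p → ∣ S ∩ part m k p ∣ Data.Nat.≤ᵇ 1) (allFin (suc k))))
  (allSubsets m))

{-# OPTIONS --safe #-}
-- Lower bound: take s special vertices, split the others into ℓ-1 balanced parts,
-- and let an edge be one special vertex together with an (r-1)-set that meets
-- each part at most once. Every edge uses a special vertex, so there is no
-- matching of size s+1; the special vertices and the parts are ℓ colour classes
-- that every edge meets at most once, so by pigeonhole no ℓ+1 vertices are
-- pairwise covered by edges.
--
-- Upper bound: let W be the set of vertices w through which edges can be found
-- that avoid any given bounded set. Greedily, |W| ≤ s, and the edges missing W
-- are covered by (s-|W|)r vertices of degree O(n^(r-2)); there are none of them
-- if |W| = s. It remains to show that the edges meeting W number at most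
-- |W| t_{r-1}(n-|W|, ℓ-1) once |W| is large.
--
-- Call two vertices adjacent if edges through both avoid any given bounded set.
-- Adjacency is K_{ℓ+1}-free by greedy embedding, and Zykov's theorem bounds the
-- edges that are cliques with one vertex in W; the other edges are O(n^(r-1))
-- with a constant independent of |W|. After deleting vertices of low degree
-- (progressive induction), almost every vertex outside W has almost the maximal
-- number of neighbours, which yields ℓ-1 nearly balanced parts. A pair inside a
-- part, or a pair in W, that lies in an edge would then complete a K_{ℓ+1}
-- expansion, so every edge is one vertex of W and a transversal of the parts.
module Submission where

open import Defs
open import Data.Nat
open import Data.Nat.Properties
open import Data.Nat.DivMod using (_/_; _%_; m≡m%n+[m/n]*n; m/n*n≤m; m%n<n; m<n⇒m%n≡m; m<n*o⇒m/o<n; m*n/n≡m; /-monoˡ-≤; [m+kn]%n≡m%n)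
open import Data.Nat.Tactic.RingSolver using (solve-∀)
open import Data.Bool using (Bool; true; false; if_then_else_; _∧_; T; T?)
open import Data.Bool.ListAction using (and)
open import Data.Vec using (here; there) renaming (_∷_ to _∷ᵛ_; [] to []ᵛ; _++_ to _++ᵛ_)
import Data.Vec.Properties as Vec
open import Data.Fin using (Fin; zero; suc; toℕ; punchIn; punchOut; fromℕ<; splitAt; _↑ˡ_; _↑ʳ_)
import Data.Fin.Properties as Fin
open import Data.Fin.Subset using (Subset; ⁅_⁆; _∪_; _∩_; ⋃; ∣_∣) renaming (_∈_ to _∈ˢ_; _∉_ to _∉ˢ_)
import Data.Fin.Subset.Properties as Sub
open import Data.List using (List; []; _∷_; length; map; filter; _++_; allFin; concatMap; filterᵇ; take; tabulate; lookup)
import Data.List.Properties as ListP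
open import Data.List.Membership.Propositional using (_∈_; _∉_; find; lose)
import Data.List.Membership.Propositional.Properties as Mem
open import Data.List.Relation.Unary.Any as Any using (Any; here; there; any?)
import Data.List.Relation.Unary.Any.Properties as AnyP
open import Data.List.Relation.Unary.All as All using (All; []; _∷_; all?)
import Data.List.Relation.Unary.All.Properties as AllP
open import Data.List.Relation.Unary.AllPairs as AllPairs using (AllPairs; []; _∷_)
import Data.List.Relation.Unary.AllPairs.Properties as AllPairsP
open import Data.List.Relation.Unary.Unique.Propositional using (Unique)
import Data.List.Relation.Unary.Unique.Propositional.Properties as UniqueP
open import Data.Product using (_×_; _,_; ∃; ∃₂; proj₁; proj₂)
open import Data.Sum using (_⊎_; inj₁; inj₂; [_,_]′)
open import Data.Empty using (⊥; ⊥-elim)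
open import Data.Unit using (⊤; tt)
open import Relation.Nullary using (¬_; Dec; yes; no; contradiction; does)
open import Relation.Nullary.Decidable using (_×-dec_; _⊎-dec_; ¬?; _→-dec_; decidable-stable)
open import Relation.Binary.Definitions using (tri<; tri≈; tri>)
open import Relation.Binary.PropositionalEquality using (_≡_; _≢_; refl; sym; trans; cong; cong₂; subst; module ≡-Reasoning)
open import Function using (_∘_; id; case_of_)

-- The target is of order s N^(r-1), while all edges other than cliques with one vertex in W number
-- at most (L + 1) N^(r-1), where L depends on r and ℓ only. The relative error is O(1/s): hence s
-- must be large, and adjacency uses a threshold that does not grow with s, unlike the threshold
-- that defines W. The Turán number per point does not decrease, so losing a fraction of the
-- neighbours costs at least that fraction of the edges; missing edges thus bound missing
-- neighbours, on average over W and then over the other vertices. An average does not control a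
-- single vertex, yet the exact bound must place every vertex. Hence two families of sets: parts
-- built from typical vertices around a clique of centres, and then classes into which each vertex
-- is put by its own degree, bounded below by the increment of the extremal function. Exactness
-- comes last: an atypical vertex of W loses more edges than those with two vertices in W or a bad
-- pair at W can make up for, and bad pairs outside W no longer matter once the classes are known.

-- Counting with indicators

-- A certificate for linear arithmetic: `l ≤ r` is a nonnegative combination of the hypotheses, `z`
-- is slack, and the equation is a polynomial identity for the ring solver. Most local steps named
-- `cert` have this form.
≤-cert : ∀ {a b} l r z → l ≤ r → a + r + z ≡ b + l → a ≤ b
≤-cert {a} {b} l r z p eq =
  +-cancelʳ-≤ l a b (≤-trans (+-monoʳ-≤ a p) (≤-trans (m≤m+n (a + r) z) (≤-reflexive eq)))

𝟙 : {P : Set} → Dec P → ℕ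
𝟙 d = if does d then 1 else 0

𝟙≤1 : {P : Set} (d : Dec P) → 𝟙 d ≤ 1
𝟙≤1 (yes _) = ≤-refl
𝟙≤1 (no _)  = z≤n

𝟙-yes : {P : Set} (d : Dec P) → P → 𝟙 d ≡ 1
𝟙-yes (yes _) _ = refl
𝟙-yes (no ¬p) p = contradiction p ¬p

𝟙-no : {P : Set} (d : Dec P) → ¬ P → 𝟙 d ≡ 0
𝟙-no (yes p) ¬p = contradiction p ¬p
𝟙-no (no _)  _  = refl

𝟙-mono : {P Q : Set} (d : Dec P) (d′ : Dec Q) → (P → Q) → 𝟙 d ≤ 𝟙 d′
𝟙-mono (no _)  _        _ = z≤n
𝟙-mono (yes _) (yes _)  _ = ≤-refl
𝟙-mono (yes p) (no ¬q)  f = contradiction (f p) ¬q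

𝟙-⊎ : {P Q R : Set} (d : Dec P) (d₁ : Dec Q) (d₂ : Dec R) → (P → Q ⊎ R) → 𝟙 d ≤ 𝟙 d₁ + 𝟙 d₂
𝟙-⊎ (no _)  _       _       _ = z≤n
𝟙-⊎ (yes _) (yes _) _       _ = s≤s z≤n
𝟙-⊎ (yes _) (no _)  (yes _) _ = ≤-refl
𝟙-⊎ (yes p) (no ¬q) (no ¬r) f = ⊥-elim ([ ¬q , ¬r ]′ (f p))

∑ : {A : Set} → List A → (A → ℕ) → ℕ
∑ []       f = 0
∑ (x ∷ xs) f = f x + ∑ xs f

infix 8 #_
#_ : {A : Set} {P : A → Set} → ((x : A) → Dec (P x)) → List A → ℕ
(# P?) xs = ∑ xs (λ x → 𝟙 (P? x))

module _ {A : Set} where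

  ∑-mono : ∀ xs {f g : A → ℕ} → (∀ x → x ∈ xs → f x ≤ g x) → ∑ xs f ≤ ∑ xs g
  ∑-mono []       h = z≤n
  ∑-mono (x ∷ xs) h = +-mono-≤ (h x (here refl)) (∑-mono xs (λ y y∈ → h y (there y∈)))

  ∑-+ : ∀ xs (f g : A → ℕ) → ∑ xs (λ x → f x + g x) ≡ ∑ xs f + ∑ xs g
  ∑-+ []       f g = refl
  ∑-+ (x ∷ xs) f g = trans (cong (f x + g x +_) (∑-+ xs f g)) (swap₄ (f x) (g x) (∑ xs f) (∑ xs g))
    where
    swap₄ : ∀ a b c d → a + b + (c + d) ≡ a + c + (b + d)
    swap₄ = solve-∀

  ∑-*ˡ : ∀ c xs (f : A → ℕ) → ∑ xs (λ x → c * f x) ≡ c * ∑ xs f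
  ∑-*ˡ c []       f = sym (*-zeroʳ c)
  ∑-*ˡ c (x ∷ xs) f = trans (cong (c * f x +_) (∑-*ˡ c xs f)) (sym (*-distribˡ-+ c (f x) _))

  ∑-const : ∀ (xs : List A) c → ∑ xs (λ _ → c) ≡ length xs * c
  ∑-const []       c = refl
  ∑-const (x ∷ xs) c = cong (c +_) (∑-const xs c)

  ∑-bound : ∀ xs {f : A → ℕ} c → (∀ x → x ∈ xs → f x ≤ c) → ∑ xs f ≤ length xs * c
  ∑-bound xs c h = ≤-trans (∑-mono xs h) (≤-reflexive (∑-const xs c))

  ∑-swap : {B : Set} (xs : List A) (ys : List B) (f : A → B → ℕ) →
           ∑ xs (λ x → ∑ ys (f x)) ≡ ∑ ys (λ y → ∑ xs (λ x → f x y))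
  ∑-swap []       ys f = sym (trans (∑-const′ ys) (*-zeroʳ (length ys)))
    where
    ∑-const′ : {B : Set} (ys : List B) → ∑ ys (λ _ → 0) ≡ length ys * 0
    ∑-const′ []       = refl
    ∑-const′ (_ ∷ ys) = ∑-const′ ys
  ∑-swap {B} (x ∷ xs) ys f = trans (cong (∑ ys (f x) +_) (∑-swap xs ys f)) (sym (∑-+′ ys))
    where
    ∑-+′ : (ys : List B) → ∑ ys (λ y → f x y + ∑ xs (λ x → f x y))
                         ≡ ∑ ys (f x) + ∑ ys (λ y → ∑ xs (λ x → f x y))
    ∑-+′ []       = refl
    ∑-+′ (y ∷ ys) = trans (cong (f x y + ∑ xs (λ x → f x y) +_) (∑-+′ ys))
                          (swap₄ (f x y) (∑ xs (λ x → f x y)) (∑ ys (f x)) (∑ ys (λ y → ∑ xs (λ x → f x y))))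
      where
      swap₄ : ∀ a b c d → a + b + (c + d) ≡ a + c + (b + d)
      swap₄ = solve-∀

  ∑-member : ∀ {x} xs (f : A → ℕ) → x ∈ xs → f x ≤ ∑ xs f
  ∑-member (x ∷ xs) f (here refl) = m≤m+n (f x) _
  ∑-member (y ∷ xs) f (there x∈)  = ≤-trans (∑-member xs f x∈) (m≤n+m _ (f y))

  ∑-filter : {P : A → Set} (P? : (x : A) → Dec (P x)) → ∀ xs (f : A → ℕ) →
             ∑ (filter P? xs) f ≡ ∑ xs (λ x → 𝟙 (P? x) * f x)
  ∑-filter P? []       f = refl
  ∑-filter P? (x ∷ xs) f with P? x
  ... | yes _ = cong₂ _+_ (sym (*-identityˡ (f x))) (∑-filter P? xs f)
  ... | no _  = ∑-filter P? xs f

  #≤length : {P : A → Set} (P? : (x : A) → Dec (P x)) → ∀ xs → (# P?) xs ≤ length xs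
  #≤length P? xs = ≤-trans (∑-bound xs 1 (λ x _ → 𝟙≤1 (P? x))) (≤-reflexive (*-identityʳ _))

  length-filter≡# : {P : A → Set} (P? : (x : A) → Dec (P x)) → ∀ xs → length (filter P? xs) ≡ (# P?) xs
  length-filter≡# P? []       = refl
  length-filter≡# P? (x ∷ xs) with P? x
  ... | yes _ = cong suc (length-filter≡# P? xs)
  ... | no _  = length-filter≡# P? xs

  #-mono : {P Q : A → Set} (P? : (x : A) → Dec (P x)) (Q? : (x : A) → Dec (Q x)) → ∀ xs →
           (∀ x → x ∈ xs → P x → Q x) → (# P?) xs ≤ (# Q?) xs
  #-mono P? Q? xs h = ∑-mono xs (λ x x∈ → 𝟙-mono (P? x) (Q? x) (h x x∈))

  #-⊎ : {P Q R : A → Set} (P? : (x : A) → Dec (P x)) (Q? : (x : A) → Dec (Q x)) (R? : (x : A) → Dec (R x)) →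
        ∀ xs → (∀ x → x ∈ xs → P x → Q x ⊎ R x) → (# P?) xs ≤ (# Q?) xs + (# R?) xs
  #-⊎ P? Q? R? xs h = ≤-trans (∑-mono xs (λ x x∈ → 𝟙-⊎ (P? x) (Q? x) (R? x) (h x x∈)))
                              (≤-reflexive (∑-+ xs _ _))

  #-disjoint : {P Q R : A → Set} (P? : (x : A) → Dec (P x)) (Q? : (x : A) → Dec (Q x)) (R? : (x : A) → Dec (R x)) →
        ∀ xs → (∀ x → x ∈ xs → P x → R x) → (∀ x → x ∈ xs → Q x → R x) →
        (∀ x → x ∈ xs → P x → Q x → ⊥) → (# P?) xs + (# Q?) xs ≤ (# R?) xs
  #-disjoint P? Q? R? xs h₁ h₂ h₃ =
    ≤-trans (≤-reflexive (sym (∑-+ xs _ _))) (∑-mono xs λ x x∈ → pt (P? x) (Q? x) (R? x) (h₁ x x∈) (h₂ x x∈) (h₃ x x∈))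
    where
    pt : {P Q R : Set} (d : Dec P) (d₁ : Dec Q) (d₂ : Dec R) → (P → R) → (Q → R) → (P → Q → ⊥) → 𝟙 d + 𝟙 d₁ ≤ 𝟙 d₂
    pt (no _)  d₁       d₂ f g h = 𝟙-mono d₁ d₂ g
    pt (yes p) (yes q)  d₂ f g h = ⊥-elim (h p q)
    pt (yes p) (no _)   d₂ f g h = ≤-reflexive (sym (𝟙-yes d₂ (f p)))

  #-all : {P : A → Set} (P? : (x : A) → Dec (P x)) → ∀ xs → (∀ x → x ∈ xs → P x) → (# P?) xs ≡ length xs
  #-all P? []       h = refl
  #-all P? (x ∷ xs) h = cong₂ _+_ (𝟙-yes (P? x) (h x (here refl))) (#-all P? xs (λ y y∈ → h y (there y∈)))

  #-none : {P : A → Set} (P? : (x : A) → Dec (P x)) → ∀ xs → (∀ x → x ∈ xs → ¬ P x) → (# P?) xs ≡ 0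
  #-none P? []       h = refl
  #-none P? (x ∷ xs) h = cong₂ _+_ (𝟙-no (P? x) (h x (here refl))) (#-none P? xs (λ y y∈ → h y (there y∈)))

  #-complement : {P : A → Set} (P? : (x : A) → Dec (P x)) → ∀ xs →
                 (# P?) xs + (# (λ x → ¬? (P? x))) xs ≡ length xs
  #-complement P? xs = ≤-antisym
    (≤-trans (#-disjoint P? (λ x → ¬? (P? x)) (λ _ → yes tt) xs (λ _ _ _ → tt) (λ _ _ _ → tt) (λ _ _ p ¬p → ¬p p))
             (#≤length (λ _ → yes tt) xs))
    (≤-trans (≤-reflexive (sym (#-all (λ _ → yes tt) xs (λ _ _ → tt))))
             (#-⊎ (λ _ → yes tt) P? (λ x → ¬? (P? x)) xs (λ x _ _ → split (P? x))))
    where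
    split : {P : Set} → Dec P → P ⊎ ¬ P
    split (yes p) = inj₁ p
    split (no ¬p) = inj₂ ¬p

  #-filter : {P Q : A → Set} (P? : (x : A) → Dec (P x)) (Q? : (x : A) → Dec (Q x)) → ∀ xs →
             (# P?) (filter Q? xs) ≡ (# (λ x → Q? x ×-dec P? x)) xs
  #-filter P? Q? []       = refl
  #-filter P? Q? (x ∷ xs) with Q? x
  ... | yes _ = cong (𝟙 (P? x) +_) (#-filter P? Q? xs)
  ... | no _  = #-filter P? Q? xs

module _ {A : Set} where

  #-hit : {B : Set} {P : A → Set} {Q : B → A → Set}
          (P? : (e : A) → Dec (P e)) (Q? : (x : B) (e : A) → Dec (Q x e)) (H : List A) (C : List B) →
          (∀ e → e ∈ H → P e → ∃ λ x → x ∈ C × Q x e) →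
          (# P?) H ≤ ∑ C (λ x → (# (Q? x)) H)
  #-hit P? Q? H C h = ≤-trans (∑-mono H pt) (≤-reflexive (∑-swap H C (λ e x → 𝟙 (Q? x e))))
    where
    pt : ∀ e → e ∈ H → 𝟙 (P? e) ≤ ∑ C (λ x → 𝟙 (Q? x e))
    pt e e∈ with P? e
    ... | no _  = z≤n
    ... | yes p with h e e∈ p
    ...   | x , x∈ , q = ≤-trans (≤-reflexive (sym (𝟙-yes (Q? x e) q))) (∑-member C (λ x → 𝟙 (Q? x e)) x∈)

  #-exists : {P : A → Set} (P? : (x : A) → Dec (P x)) → ∀ xs →
             (# (λ x → ¬? (P? x))) xs < length xs → ∃ λ x → x ∈ xs × P x
  #-exists P? xs lt with any? P? xs
  ... | yes p = find p
  ... | no ¬p = ⊥-elim (<-irrefl (#-all (λ x → ¬? (P? x)) xs (λ x x∈ Px → ¬p (lose x∈ Px))) lt)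

  markov : ∀ xs (f : A → ℕ) g → g * (# (λ x → suc g ≤? f x)) xs ≤ ∑ xs f
  markov xs f g = ≤-trans (≤-reflexive (sym (∑-*ˡ g xs _))) (∑-mono xs (λ x _ → pt (f x) (suc g ≤? f x)))
    where
    pt : ∀ y (d : Dec (suc g ≤ y)) → g * 𝟙 d ≤ y
    pt y (yes p) = ≤-trans (≤-reflexive (*-identityʳ g)) (<⇒≤ p)
    pt y (no _)  = ≤-trans (≤-reflexive (*-zeroʳ g)) z≤n

  argmax : ∀ (xs : List A) (f : A → ℕ) → xs ≡ [] ⊎ (∃ λ u → u ∈ xs × (∀ v → v ∈ xs → f v ≤ f u))
  argmax []       f = inj₁ refl
  argmax (x ∷ xs) f with argmax xs f
  ... | inj₁ refl = inj₂ (x , here refl , λ { v (here refl) → ≤-refl ; v (there ()) })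
  ... | inj₂ (u , u∈ , h) with f x ≤? f u
  ...   | yes p = inj₂ (u , there u∈ , λ { v (here refl) → p ; v (there v∈) → h v v∈ })
  ...   | no ¬p = inj₂ (x , here refl , λ { v (here refl) → ≤-refl
                                          ; v (there v∈) → ≤-trans (h v v∈) (<⇒≤ (≰⇒> ¬p)) })

  Unique-⊆-length : ∀ {xs ys : List A} → Unique xs → (∀ x → x ∈ xs → x ∈ ys) → length xs ≤ length ys
  Unique-⊆-length {[]}     {ys} _        _ = z≤n
  Unique-⊆-length {x ∷ xs} {ys} (x∉ ∷ u) h with Mem.∈-∃++ (h x (here refl))
  ... | as , bs , refl = ≤-trans (s≤s (Unique-⊆-length u h′))
        (≤-reflexive (trans (cong suc (ListP.length-++ as)) (trans (sym (+-suc _ _)) (sym (ListP.length-++ as)))))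
    where
    h′ : ∀ y → y ∈ xs → y ∈ as ++ bs
    h′ y y∈ with Mem.∈-++⁻ as (h y (there y∈))
    ... | inj₁ p          = Mem.∈-++⁺ˡ p
    ... | inj₂ (here refl) = ⊥-elim (All.lookup x∉ y∈ refl)
    ... | inj₂ (there p)  = Mem.∈-++⁺ʳ as p

-- Turán numbers

-- turán q k m is the number of q-sets meeting each part at most once, for m
-- points in k balanced parts. A new point put in a smallest part extends the
-- transversals of the other k - 1 parts, which gives the recursion.
turán : (q k m : ℕ) → ℕ
turán zero    k       m       = 1
turán (suc q) zero    m       = 0
turán (suc q) (suc k) zero    = 0
turán (suc q) (suc k) (suc m) = turán (suc q) (suc k) m + turán q k (m ∸ m / suc k)

-- The elementary symmetric polynomial of degree `q`: for part sizes `f` it counts the `q`-sets that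
-- meet each part at most once.
esym : (q k : ℕ) → (Fin k → ℕ) → ℕ
esym zero    k       f = 1
esym (suc q) zero    f = 0
esym (suc q) (suc k) f = esym (suc q) k (f ∘ suc) + f zero * esym q k (f ∘ suc)

total : (k : ℕ) → (Fin k → ℕ) → ℕ
total zero    f = 0
total (suc k) f = f zero + total k (f ∘ suc)

esym-cong : ∀ q k {f g} → (∀ i → f i ≡ g i) → esym q k f ≡ esym q k g
esym-cong zero    k       h = refl
esym-cong (suc q) zero    h = refl
esym-cong (suc q) (suc k) h =
  cong₂ _+_ (esym-cong (suc q) k (h ∘ suc)) (cong₂ _*_ (h zero) (esym-cong q k (h ∘ suc)))

total-cong : ∀ k {f g} → (∀ i → f i ≡ g i) → total k f ≡ total k g
total-cong zero    h = refl
total-cong (suc k) h = cong₂ _+_ (h zero) (total-cong k (h ∘ suc))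

total-member : ∀ k f i → f i ≤ total k f
total-member (suc k) f zero    = m≤m+n _ _
total-member (suc k) f (suc i) = ≤-trans (total-member k (f ∘ suc) i) (m≤n+m _ _)

total-upper : ∀ k f c → (∀ i → f i ≤ c) → total k f ≤ k * c
total-upper zero    f c h = z≤n
total-upper (suc k) f c h = +-mono-≤ (h zero) (total-upper k (f ∘ suc) c (h ∘ suc))

total-lower : ∀ k f c → (∀ i → c ≤ f i) → k * c ≤ total k f
total-lower zero    f c h = z≤n
total-lower (suc k) f c h = +-mono-≤ (h zero) (total-lower k (f ∘ suc) c (h ∘ suc))

total-punchIn : ∀ k f i → total (suc k) f ≡ f i + total k (f ∘ punchIn i)
total-punchIn k       f zero    = refl
total-punchIn (suc k) f (suc i) = trans (cong (f zero +_) (total-punchIn k (f ∘ suc) i)) (rot (f zero) (f (suc i)) _)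
  where
  rot : ∀ a b c → a + (b + c) ≡ b + (a + c)
  rot = solve-∀

set : ∀ {k} → Fin k → ℕ → (Fin k → ℕ) → Fin k → ℕ
set i a f j = if does (j Fin.≟ i) then a else f j

set-≡ : ∀ {k} (i : Fin k) a f → set i a f i ≡ a
set-≡ i a f with i Fin.≟ i
... | yes _  = refl
... | no i≢i = contradiction refl i≢i

set-≢ : ∀ {k} (i : Fin k) a f j → j ≢ i → set i a f j ≡ f j
set-≢ i a f j j≢i with j Fin.≟ i
... | yes j≡i = contradiction j≡i j≢i
... | no _    = refl

-- Taking one point out of part `i` destroys exactly the transversals through that point, and these
-- are transversals of the other parts.
esym-decrement : ∀ q k f g i {a} → f i ≡ suc a → g i ≡ a → (∀ j → j ≢ i → g j ≡ f j) →
                 esym (suc q) (suc k) f ≡ esym (suc q) (suc k) g + esym q k (f ∘ punchIn i)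
esym-decrement q k f g zero {a} fi gi h = begin
  X + f zero * Y      ≡⟨ cong (λ z → X + z * Y) fi ⟩
  X + (Y + a * Y)     ≡⟨ rot X Y (a * Y) ⟩
  (X + a * Y) + Y     ≡⟨ cong (_+ Y) (cong₂ _+_ (esym-cong (suc q) k eq) (cong₂ _*_ (sym gi) (esym-cong q k eq))) ⟩
  esym (suc q) (suc k) g + Y ∎
  where
  open ≡-Reasoning
  X = esym (suc q) k (f ∘ suc)
  Y = esym q k (f ∘ suc)
  eq : ∀ j → f (suc j) ≡ g (suc j)
  eq j = sym (h (suc j) λ ())
  rot : ∀ a b c → a + (b + c) ≡ a + c + b
  rot = solve-∀
esym-decrement q (suc k) f g (suc i) {a} fi gi h = helper q
  where
  open ≡-Reasoning
  ih : ∀ q → esym (suc q) (suc k) (f ∘ suc) ≡ esym (suc q) (suc k) (g ∘ suc) + esym q k (f ∘ suc ∘ punchIn i)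
  ih q = esym-decrement q k (f ∘ suc) (g ∘ suc) i fi gi (λ j j≢ → h (suc j) (λ e → j≢ (Fin.suc-injective e)))
  g0 : g zero ≡ f zero
  g0 = h zero λ ()
  rot₁ : ∀ A B c → A + B + c * 1 ≡ A + c * 1 + B
  rot₁ = solve-∀
  rot₂ : ∀ A B c C D → A + B + c * (C + D) ≡ A + c * C + (B + c * D)
  rot₂ = solve-∀
  helper : ∀ q → esym (suc q) (suc (suc k)) f ≡
                 esym (suc q) (suc (suc k)) g + esym q (suc k) (f ∘ punchIn (suc i))
  helper zero = trans (cong (_+ f zero * 1) (ih 0))
    (trans (rot₁ (esym 1 (suc k) (g ∘ suc)) 1 (f zero))
           (cong (λ z → esym 1 (suc k) (g ∘ suc) + z * 1 + 1) (sym g0)))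
  helper (suc q) = trans (cong₂ (λ u v → u + f zero * v) (ih (suc q)) (ih q))
    (trans (rot₂ (esym (2 + q) (suc k) (g ∘ suc)) (esym (suc q) k (f ∘ suc ∘ punchIn i)) (f zero)
                 (esym (suc q) (suc k) (g ∘ suc)) (esym q k (f ∘ suc ∘ punchIn i)))
           (cong (λ z → esym (2 + q) (suc k) (g ∘ suc) + z * esym (suc q) (suc k) (g ∘ suc)
                        + esym (suc q) (suc k) (f ∘ punchIn (suc i))) (sym g0)))

total-decrement : ∀ k f g i {a} → f i ≡ suc a → g i ≡ a → (∀ j → j ≢ i → g j ≡ f j) →
                  total (suc k) f ≡ suc (total (suc k) g)
total-decrement k f g i fi gi h = trans (total-punchIn k f i)
  (trans (cong₂ _+_ (trans fi (cong suc (sym gi)))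
                    (total-cong k (λ j → sym (h (punchIn i j) (Fin.punchInᵢ≢i i j)))))
         (cong suc (sym (total-punchIn k g i))))

esym-zero : ∀ q k f → (∀ i → f i ≡ 0) → esym (suc q) k f ≡ 0
esym-zero q zero    f h = refl
esym-zero q (suc k) f h = cong₂ _+_ (esym-zero q k (f ∘ suc) (h ∘ suc)) (cong (_* esym q k (f ∘ suc)) (h zero))

max-position : ∀ k (f : Fin (suc k) → ℕ) → ∃ λ i → ∀ j → f j ≤ f i
max-position k f with argmax (allFin (suc k)) f
... | inj₂ (i , _ , h) = i , λ j → h j (Mem.∈-allFin j)

turán-step : ∀ q k m → turán q k m ≤ turán q k (suc m)
turán-step zero    k       m = ≤-refl
turán-step (suc q) zero    m = ≤-refl
turán-step (suc q) (suc k) m = m≤m+n _ _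

turán-mono : ∀ q k {m m′} → m ≤ m′ → turán q k m ≤ turán q k m′
turán-mono q k {m} le = go (≤⇒≤′ le)
  where
  go : ∀ {m′} → m ≤′ m′ → turán q k m ≤ turán q k m′
  go (≤′-reflexive refl) = ≤-refl
  go (≤′-step p)         = ≤-trans (go p) (turán-step q k _)

suc-/ : ∀ x k → suc x / suc k ≤ suc (x / suc k)
suc-/ x k = s≤s⁻¹ (m<n*o⇒m/o<n {suc x} {2 + x / suc k} {suc k} (begin-strict
  suc x                                          ≡⟨ cong suc (m≡m%n+[m/n]*n x (suc k)) ⟩
  suc (x % suc k) + x / suc k * suc k            ≤⟨ +-monoˡ-≤ _ (m%n<n x (suc k)) ⟩
  suc k + x / suc k * suc k                      <⟨ m<n+m _ {suc k} (s≤s z≤n) ⟩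
  suc k + (suc k + x / suc k * suc k)            ∎))
  where open ≤-Reasoning

∸-/-mono : ∀ k {x y} → x ≤ y → x ∸ x / suc k ≤ y ∸ y / suc k
∸-/-mono k {x} le = go (≤⇒≤′ le)
  where
  go : ∀ {y} → x ≤′ y → x ∸ x / suc k ≤ y ∸ y / suc k
  go (≤′-reflexive refl)  = ≤-refl
  go (≤′-step {n = y} p)  = ≤-trans (go p) (∸-monoʳ-≤ (suc y) (suc-/ y k))

-- A point is removed from a largest part. Such a part has more than `m / suc k` points, so the
-- other parts have at most `m ∸ m / suc k` in all, which is the argument in the recursion of
-- `turán`.
esym≤turán : ∀ q k f → esym q k f ≤ turán q k (total k f)
esym≤turán zero    k       f = ≤-refl
esym≤turán (suc q) zero    f = z≤n
esym≤turán (suc q) (suc k) f = go (total (suc k) f) f refl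
  where
  go : ∀ m f → total (suc k) f ≡ m → esym (suc q) (suc k) f ≤ turán (suc q) (suc k) m
  go zero    f eq = ≤-reflexive (esym-zero q (suc k) f λ i → n≤0⇒n≡0 (≤-trans (total-member (suc k) f i) (≤-reflexive eq)))
  go (suc m) f eq with max-position k f
  ... | i , h = pos (f i) refl
    where
    pos : ∀ y → f i ≡ y → esym (suc q) (suc k) f ≤ turán (suc q) (suc k) (suc m)
    pos zero fi = contradiction
      (trans (sym eq) (n≤0⇒n≡0 (≤-trans (total-upper (suc k) f 0 (λ j → subst (f j ≤_) fi (h j)))
                                        (≤-reflexive (*-zeroʳ (suc k)))))) λ ()
    pos (suc a) fi = ≤-trans (≤-reflexive (esym-decrement q k f g i fi (set-≡ i a f) (set-≢ i a f)))
      (+-mono-≤ (go m g (suc-injective (trans (sym (total-decrement k f g i fi (set-≡ i a f) (set-≢ i a f))) eq)))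
                (≤-trans (esym≤turán q k (f ∘ punchIn i)) (turán-mono q k rest)))
      where
      g = set i a f
      m/k≤a : m / suc k ≤ a
      m/k≤a = s≤s⁻¹ (m<n*o⇒m/o<n {m} {suc a} {suc k} (≤-trans (≤-reflexive (sym eq))
        (≤-trans (total-upper (suc k) f (suc a) (λ j → subst (f j ≤_) fi (h j))) (≤-reflexive (*-comm (suc k) (suc a))))))
      rest : total k (f ∘ punchIn i) ≤ m ∸ m / suc k
      rest = ≤-trans (≤-reflexive (sym (m+n∸m≡n a _)))
        (≤-trans (≤-reflexive (cong (_∸ a) (suc-injective
          (trans (cong (_+ total k (f ∘ punchIn i)) (sym fi)) (trans (sym (total-punchIn k f i)) eq)))))
        (∸-monoʳ-≤ m m/k≤a))

Balanced : ∀ {k} → (Fin k → ℕ) → Set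
Balanced f = ∀ i j → f i ≤ suc (f j)

-- Removing a point from a largest part keeps the sizes balanced, and all parts then have at least
-- `a` points; so `a ≤ m / suc k`, and the comparison of `esym≤turán` is reversed.
turán≤esym : ∀ q k f → Balanced f → turán q k (total k f) ≤ esym q k f
turán≤esym zero    k       f bal = ≤-refl
turán≤esym (suc q) zero    f bal = z≤n
turán≤esym (suc q) (suc k) f bal = go (total (suc k) f) f bal refl
  where
  go : ∀ m f → Balanced f → total (suc k) f ≡ m → turán (suc q) (suc k) m ≤ esym (suc q) (suc k) f
  go zero    f bal eq = z≤n
  go (suc m) f bal eq with max-position k f
  ... | i , h = pos (f i) refl
    where
    pos : ∀ y → f i ≡ y → turán (suc q) (suc k) (suc m) ≤ esym (suc q) (suc k) f
    pos zero fi = contradiction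
      (trans (sym eq) (n≤0⇒n≡0 (≤-trans (total-upper (suc k) f 0 (λ j → subst (f j ≤_) fi (h j)))
                                        (≤-reflexive (*-zeroʳ (suc k)))))) λ ()
    pos (suc a) fi = ≤-trans
      (+-mono-≤ (go m g bal-g total-g)
                (≤-trans (turán-mono q k rest) (turán≤esym q k (f ∘ punchIn i) (λ x y → bal (punchIn i x) (punchIn i y)))))
      (≤-reflexive (sym (esym-decrement q k f g i fi (set-≡ i a f) (set-≢ i a f))))
      where
      g = set i a f
      total-g : total (suc k) g ≡ m
      total-g = suc-injective (trans (sym (total-decrement k f g i fi (set-≡ i a f) (set-≢ i a f))) eq)
      a≤f : ∀ j → a ≤ f j
      a≤f j = s≤s⁻¹ (≤-trans (≤-reflexive (sym fi)) (bal i j))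
      f≤a : ∀ j → f j ≤ suc a
      f≤a j = subst (f j ≤_) fi (h j)
      a≤g : ∀ j → a ≤ g j
      a≤g j with j Fin.≟ i
      ... | yes _ = ≤-refl
      ... | no _  = a≤f j
      bal-g : Balanced g
      bal-g x y = ≤-trans (up x) (s≤s (a≤g y))
        where
        up : ∀ x → g x ≤ suc a
        up x with x Fin.≟ i
        ... | yes _ = n≤1+n a
        ... | no _  = f≤a x
      a≤m/k : a ≤ m / suc k
      a≤m/k = ≤-trans (≤-reflexive (sym (m*n/n≡m a (suc k)))) (/-monoˡ-≤ (suc k)
        (≤-trans (≤-reflexive (*-comm a (suc k))) (≤-trans (total-lower (suc k) g a a≤g) (≤-reflexive total-g))))
      rest : m ∸ m / suc k ≤ total k (f ∘ punchIn i)
      rest = ≤-trans (∸-monoʳ-≤ m a≤m/k) (≤-reflexive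
        (trans (cong (_∸ a) (sym (suc-injective
          (trans (cong (_+ total k (f ∘ punchIn i)) (sym fi)) (trans (sym (total-punchIn k f i)) eq)))))
        (m+n∸m≡n a _)))

ramp : (a b : ℕ) → ∀ {k} → Fin k → ℕ
ramp a b p = if toℕ p <ᵇ b then suc a else a

ramp-balanced : ∀ a b {k} → Balanced (ramp a b {k})
ramp-balanced a b i j with toℕ i <ᵇ b | toℕ j <ᵇ b
... | true  | true  = n≤1+n _
... | true  | false = ≤-refl
... | false | true  = m≤n+m a 2
... | false | false = n≤1+n _

total-ramp : ∀ a b k → b ≤ k → total k (ramp a b) ≡ b + k * a
total-ramp a zero    zero    _       = refl
total-ramp a zero    (suc k) _       = cong (a +_) (total-ramp a zero k z≤n)
total-ramp a (suc b) (suc k) (s≤s p) = trans (cong (suc a +_) (total-ramp a b k p)) (rot a b (k * a))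
  where
  rot : ∀ a b c → suc a + (b + c) ≡ suc b + (a + c)
  rot = solve-∀

balanced-exists : ∀ k d → ∃ λ (f : Fin (suc k) → ℕ) → Balanced f × total (suc k) f ≡ d
balanced-exists k d = ramp (d / suc k) (d % suc k) , ramp-balanced (d / suc k) (d % suc k) ,
  trans (total-ramp (d / suc k) (d % suc k) (suc k) (<⇒≤ (m%n<n d (suc k))))
        (trans (cong (d % suc k +_) (*-comm (suc k) (d / suc k))) (sym (m≡m%n+[m/n]*n d (suc k))))

-- The transversals of `suc k` parts are split by whether they use the part of size `b`. Balance
-- turns the left side into symmetric polynomials, and `esym≤turán` accepts the resulting sizes as
-- they are.
turán-add-part : ∀ q k (f : Fin k → ℕ) → Balanced f → ∀ b →
  turán (suc q) k (total k f) + b * turán q k (total k f) ≤ turán (suc q) (suc k) (b + total k f)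
turán-add-part q k f bal b = ≤-trans
  (+-mono-≤ (turán≤esym (suc q) k f bal) (*-monoʳ-≤ b (turán≤esym q k f bal)))
  (esym≤turán (suc q) (suc k) λ { zero → b ; (suc i) → f i })

-- With `k` parts of size `μ` the symmetric polynomial contains the product of the first `q` sizes.
-- This fixes the order of magnitude against which all errors are measured.
turán-lower : ∀ q k μ m → q ≤ k → k * μ ≤ m → μ ^ q ≤ turán q k m
turán-lower q k μ m q≤k kμ≤m = ≤-trans (const q k q≤k)
  (≤-trans (esym≤turán q k (λ _ → μ)) (turán-mono q k (≤-trans (total-upper k _ μ (λ _ → ≤-refl)) kμ≤m)))
  where
  const : ∀ q k → q ≤ k → μ ^ q ≤ esym q k (λ _ → μ)
  const zero    k       _       = ≤-refl
  const (suc q) (suc k) (s≤s p) = ≤-trans (*-monoʳ-≤ μ (const q k p)) (m≤n+m _ _)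

turán-upper : ∀ q k m → turán q k m ≤ m ^ q
turán-upper zero    k       m       = ≤-refl
turán-upper (suc q) zero    m       = z≤n
turán-upper (suc q) (suc k) zero    = z≤n
turán-upper (suc q) (suc k) (suc m) = begin
  turán (suc q) (suc k) m + turán q k (m ∸ m / suc k)  ≤⟨ +-mono-≤ (turán-upper (suc q) (suc k) m) (turán-upper q k _) ⟩
  m ^ suc q + (m ∸ m / suc k) ^ q                       ≤⟨ +-mono-≤ (*-monoʳ-≤ m (^-monoˡ-≤ q (n≤1+n m)))
                                                              (^-monoˡ-≤ q (≤-trans (m∸n≤m m (m / suc k)) (n≤1+n m))) ⟩
  m * suc m ^ q + suc m ^ q                             ≡⟨ +-comm (m * suc m ^ q) _ ⟩
  suc m ^ suc q                                         ∎
  where open ≤-Reasoning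

turán-lipschitz : ∀ q k x d → turán (suc q) k (d + x) ≤ turán (suc q) k x + d * (d + x) ^ q
turán-lipschitz q zero    x d       = z≤n
turán-lipschitz q (suc k) x zero    = m≤m+n _ _
turán-lipschitz q (suc k) x (suc d) = begin
  turán (suc q) (suc k) (d + x) + turán q k (d + x ∸ (d + x) / suc k)
    ≤⟨ +-mono-≤ (turán-lipschitz q (suc k) x d) (≤-trans (turán-upper q k _)
         (^-monoˡ-≤ q (≤-trans (m∸n≤m (d + x) ((d + x) / suc k)) (n≤1+n (d + x))))) ⟩
  turán (suc q) (suc k) x + d * (d + x) ^ q + (suc d + x) ^ q
    ≤⟨ +-monoˡ-≤ _ (+-monoʳ-≤ (turán (suc q) (suc k) x) (*-monoʳ-≤ d (^-monoˡ-≤ q (n≤1+n (d + x))))) ⟩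
  turán (suc q) (suc k) x + d * (suc d + x) ^ q + (suc d + x) ^ q
    ≡⟨ rot (turán (suc q) (suc k) x) (d * (suc d + x) ^ q) ((suc d + x) ^ q) ⟩
  turán (suc q) (suc k) x + ((suc d + x) ^ q + d * (suc d + x) ^ q) ∎
  where
  open ≤-Reasoning
  rot : ∀ a b c → a + b + c ≡ a + (c + b)
  rot = solve-∀

-- The increments do not decrease and the value at 0 is 0, so the value per point does not decrease.
turán-superlinear : ∀ q k {x D} → x ≤ D → D * turán (suc q) k x ≤ x * turán (suc q) k D
turán-superlinear q zero    {x} {D} _  = ≤-trans (≤-reflexive (*-zeroʳ D)) z≤n
turán-superlinear q (suc k) {x} le = go (≤⇒≤′ le)
  where
  F : ℕ → ℕ
  F = turán (suc q) (suc k)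
  inc : ℕ → ℕ
  inc x = turán q k (x ∸ x / suc k)
  inc-mono : ∀ {x y} → x ≤ y → inc x ≤ inc y
  inc-mono p = turán-mono q k (∸-/-mono k p)
  F≤ : ∀ x → F x ≤ x * inc x
  F≤ zero    = z≤n
  F≤ (suc x) = ≤-trans (+-monoˡ-≤ _ (F≤ x)) (≤-trans (≤-reflexive (+-comm (x * inc x) (inc x)))
                 (*-monoʳ-≤ (suc x) (inc-mono (n≤1+n x))))
  go : ∀ {D} → x ≤′ D → D * F x ≤ x * F D
  go (≤′-reflexive refl) = ≤-refl
  go (≤′-step {n = D} p) = begin
    F x + D * F x         ≤⟨ +-mono-≤ (≤-trans (F≤ x) (*-monoʳ-≤ x (inc-mono (≤′⇒≤ p)))) (go p) ⟩
    x * inc D + x * F D   ≡⟨ sym (*-distribˡ-+ x (inc D) (F D)) ⟩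
    x * (inc D + F D)     ≡⟨ cong (x *_) (+-comm (inc D) (F D)) ⟩
    x * F (suc D)         ∎
    where open ≤-Reasoning

-- The form used for stability: losing `D ∸ x` of `D` points loses at least the fraction
-- `(D ∸ x) / D` of the transversals, so a shortage of edges bounds a shortage of neighbours
-- linearly.
turán-deficit : ∀ q k {x D} → x ≤ D →
  D * turán (suc q) k x + (D ∸ x) * turán (suc q) k D ≤ D * turán (suc q) k D
turán-deficit q k {x} {D} le = begin
  D * turán (suc q) k x + (D ∸ x) * F   ≤⟨ +-monoˡ-≤ _ (turán-superlinear q k le) ⟩
  x * F + (D ∸ x) * F                    ≡⟨ sym (*-distribʳ-+ F x (D ∸ x)) ⟩
  (x + (D ∸ x)) * F                      ≡⟨ cong (_* F) (m+[n∸m]≡n le) ⟩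
  D * F                                  ∎
  where
  open ≤-Reasoning
  F = turán (suc q) k D

-- Cliques in K_{k+1}-free graphs (Zykov's theorem)

-- A clique is counted at the first of its vertices in the list.
cliques : {A : Set} {R : A → A → Set} → (∀ x y → Dec (R x y)) → ℕ → List A → ℕ
cliques R? zero    xs       = 1
cliques R? (suc q) []       = 0
cliques R? (suc q) (x ∷ xs) = cliques R? (suc q) xs + cliques R? q (filter (R? x) xs)

filter-swap : {A : Set} {P Q : A → Set} (P? : ∀ x → Dec (P x)) (Q? : ∀ x → Dec (Q x)) → ∀ xs →
              filter P? (filter Q? xs) ≡ filter Q? (filter P? xs)
filter-swap P? Q? [] = refl
filter-swap P? Q? (x ∷ xs) with Q? x in eqQ | P? x in eqP
... | yes q | yes p rewrite eqQ | eqP = cong (x ∷_) (filter-swap P? Q? xs)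
... | yes q | no _  rewrite eqP = filter-swap P? Q? xs
... | no _  | yes p rewrite eqQ = filter-swap P? Q? xs
... | no _  | no _  = filter-swap P? Q? xs

CliqueFree : {A : Set} → (A → A → Set) → ℕ → List A → Set
CliqueFree R k xs = ∀ zs → length zs ≡ suc k → (∀ z → z ∈ zs → z ∈ xs) → AllPairs R zs → ⊥

module _ {A : Set} {R : A → A → Set} (R? : ∀ x y → Dec (R x y)) where

  cliques-∷ : ∀ q x xs → cliques R? q xs ≤ cliques R? q (x ∷ xs)
  cliques-∷ zero    x xs = ≤-refl
  cliques-∷ (suc q) x xs = m≤m+n _ _

  cliques-filter-∷ : {P : A → Set} (P? : ∀ x → Dec (P x)) → ∀ q x xs →
                     cliques R? q (filter P? xs) ≤ cliques R? q (filter P? (x ∷ xs))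
  cliques-filter-∷ P? q x xs with P? x
  ... | yes _ = cliques-∷ q x (filter P? xs)
  ... | no _  = ≤-refl

  cliques-upper : ∀ q xs → cliques R? q xs ≤ length xs ^ q
  cliques-upper zero    xs       = ≤-refl
  cliques-upper (suc q) []       = z≤n
  cliques-upper (suc q) (x ∷ xs) = begin
    cliques R? (suc q) xs + cliques R? q (filter (R? x) xs)
      ≤⟨ +-mono-≤ (cliques-upper (suc q) xs) (cliques-upper q _) ⟩
    length xs * length xs ^ q + length (filter (R? x) xs) ^ q
      ≤⟨ +-mono-≤ (*-monoʳ-≤ (length xs) (^-monoˡ-≤ q (n≤1+n _)))
                  (^-monoˡ-≤ q (≤-trans (ListP.length-filter (R? x) xs) (n≤1+n _))) ⟩
    length xs * suc (length xs) ^ q + suc (length xs) ^ q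
      ≡⟨ +-comm (length xs * suc (length xs) ^ q) _ ⟩
    suc (length xs) ^ suc q ∎
    where open ≤-Reasoning

  module _ (R-sym : ∀ {x y} → R x y → R y x) where

    -- A clique that leaves `S` is charged to a vertex `u` outside `S`, where it shows as a smaller
    -- clique among the neighbours of `u`. In the induction, the cliques through a new vertex `x` of
    -- `S` are handled by the same statement among the neighbours of `x`; symmetry of `R` then puts
    -- `x` among the neighbours of `u`.
    cliques-cover : {S : A → Set} (S? : ∀ x → Dec (S x)) → ∀ q xs →
      cliques R? (suc q) xs ≤ cliques R? (suc q) (filter S? xs)
                              + ∑ (filter (λ x → ¬? (S? x)) xs) (λ u → cliques R? q (filter (R? u) xs))
    cliques-cover S? q [] = z≤n
    cliques-cover {S} S? q (x ∷ xs) with S? x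
    ... | no _ = begin
      cliques R? (suc q) xs + cliques R? q (filter (R? x) xs)
        ≤⟨ +-mono-≤ (cliques-cover S? q xs) (cliques-filter-∷ (R? x) q x xs) ⟩
      a + ∑ us (λ u → cliques R? q (filter (R? u) xs)) + b
        ≤⟨ +-monoˡ-≤ b (+-monoʳ-≤ a (∑-mono us (λ u _ → cliques-filter-∷ (R? u) q x xs))) ⟩
      a + ∑ us (λ u → cliques R? q (filter (R? u) (x ∷ xs))) + b
        ≡⟨ rot a _ b ⟩
      a + (b + ∑ us (λ u → cliques R? q (filter (R? u) (x ∷ xs)))) ∎
      where
      open ≤-Reasoning
      us = filter (λ x → ¬? (S? x)) xs
      a  = cliques R? (suc q) (filter S? xs)
      b  = cliques R? q (filter (R? x) (x ∷ xs))
      rot : ∀ a b c → a + b + c ≡ a + (c + b)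
      rot = solve-∀
    ... | yes _ = step q
      where
      open ≤-Reasoning
      us = filter (λ x → ¬? (S? x)) xs
      rot : ∀ a b c d → a + b + (c + d) ≡ a + c + (b + d)
      rot = solve-∀
      rot₁ : ∀ a b → a + b + 1 ≡ a + 1 + b
      rot₁ = solve-∀
      step : ∀ q → cliques R? (suc q) xs + cliques R? q (filter (R? x) xs) ≤
                   cliques R? (suc q) (filter S? xs) + cliques R? q (filter (R? x) (filter S? xs))
                   + ∑ us (λ u → cliques R? q (filter (R? u) (x ∷ xs)))
      step zero = ≤-trans (+-monoˡ-≤ 1 (cliques-cover S? 0 xs))
                          (≤-reflexive (rot₁ (cliques R? 1 (filter S? xs)) (∑ us (λ _ → 1))))
      step (suc q) = begin
        cliques R? (2 + q) xs + cliques R? (suc q) xs′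
          ≤⟨ +-mono-≤ (cliques-cover S? (suc q) xs) (cliques-cover S? q xs′) ⟩
        a + ∑ us g + (cliques R? (suc q) (filter S? xs′) + ∑ (filter (λ x → ¬? (S? x)) xs′) h)
          ≡⟨ cong₂ (λ y z → a + ∑ us g + (cliques R? (suc q) y + z)) (filter-swap S? (R? x) xs)
               (trans (cong (λ y → ∑ y h) (filter-swap (λ x → ¬? (S? x)) (R? x) xs)) (∑-filter (R? x) us h)) ⟩
        a + ∑ us g + (b + ∑ us (λ u → 𝟙 (R? x u) * h u))
          ≡⟨ rot a (∑ us g) b _ ⟩
        a + b + (∑ us g + ∑ us (λ u → 𝟙 (R? x u) * h u))
          ≡⟨ cong (a + b +_) (sym (∑-+ us g _)) ⟩
        a + b + ∑ us (λ u → g u + 𝟙 (R? x u) * h u)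
          ≤⟨ +-monoʳ-≤ (a + b) (∑-mono us (λ u _ → pt u)) ⟩
        a + b + ∑ us (λ u → cliques R? (suc q) (filter (R? u) (x ∷ xs))) ∎
        where
        xs′ = filter (R? x) xs
        a   = cliques R? (2 + q) (filter S? xs)
        b   = cliques R? (suc q) (filter (R? x) (filter S? xs))
        g : A → ℕ
        g u = cliques R? (suc q) (filter (R? u) xs)
        h : A → ℕ
        h u = cliques R? q (filter (R? u) xs′)
        pt : ∀ u → g u + 𝟙 (R? x u) * h u ≤ cliques R? (suc q) (filter (R? u) (x ∷ xs))
        pt u with R? x u | R? u x
        ... | yes _ | yes _ = +-monoʳ-≤ (g u) (≤-reflexive (trans (*-identityˡ (h u))
                                (cong (cliques R? q) (filter-swap (R? u) (R? x) xs))))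
        ... | yes r | no ¬r = contradiction (R-sym r) ¬r
        ... | no _  | yes _ = +-monoʳ-≤ (g u) z≤n
        ... | no _  | no _  = ≤-reflexive (+-identityʳ (g u))

    -- Erdős' degree-majorization argument: u lies in the most (q+1)-cliques,
    -- and every (q+1)-clique not inside N(u) has a vertex outside N(u).
    cliques≤turán : ∀ q k xs → CliqueFree R k xs → cliques R? q xs ≤ turán q k (length xs)
    cliques≤turán zero    k       xs       _    = ≤-refl
    cliques≤turán (suc q) zero    []       _    = z≤n
    cliques≤turán (suc q) zero    (x ∷ xs) free =
      ⊥-elim (free (x ∷ []) refl (λ { z (here refl) → here refl }) ([] ∷ []))
    cliques≤turán (suc q) (suc k) xs       free with argmax xs (λ u → cliques R? q (filter (R? u) xs))
    ... | inj₁ refl = z≤n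
    ... | inj₂ (u , u∈ , max) = begin
      cliques R? (suc q) xs
        ≤⟨ cliques-cover (R? u) q xs ⟩
      cliques R? (suc q) S + ∑ S̅ (λ v → cliques R? q (filter (R? v) xs))
        ≤⟨ +-monoʳ-≤ _ (∑-bound S̅ _ (λ v v∈ → max v (proj₁ (Mem.∈-filter⁻ (λ x → ¬? (R? u x)) {xs = xs} v∈)))) ⟩
      cliques R? (suc q) S + length S̅ * cliques R? q S
        ≤⟨ +-mono-≤ (cliques≤turán (suc q) k S freeS) (*-monoʳ-≤ (length S̅) (cliques≤turán q k S freeS)) ⟩
      turán (suc q) k (length S) + length S̅ * turán q k (length S)
        ≤⟨ add-part k freeS ⟩
      turán (suc q) (suc k) (length S̅ + length S)
        ≡⟨ cong (turán (suc q) (suc k)) (trans (+-comm (length S̅) _)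
             (trans (cong₂ _+_ (length-filter≡# (R? u) xs) (length-filter≡# (λ x → ¬? (R? u x)) xs))
                    (#-complement (R? u) xs))) ⟩
      turán (suc q) (suc k) (length xs) ∎
      where
      open ≤-Reasoning
      S = filter (R? u) xs
      S̅ = filter (λ x → ¬? (R? u x)) xs
      freeS : CliqueFree R k S
      freeS zs len sub ap = free (u ∷ zs) (cong suc len)
        (λ { z (here refl) → u∈ ; z (there z∈) → proj₁ (Mem.∈-filter⁻ (R? u) {xs = xs} (sub z z∈)) })
        (All.tabulate (λ z∈ → proj₂ (Mem.∈-filter⁻ (R? u) {xs = xs} (sub _ z∈))) ∷ ap)
      empty : ∀ {ys} → CliqueFree R 0 ys → length ys ≡ 0
      empty {[]}     _ = refl
      empty {y ∷ ys} h = ⊥-elim (h (y ∷ []) refl (λ { z (here refl) → here refl }) ([] ∷ []))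
      add-part : ∀ k → CliqueFree R k S →
        turán (suc q) k (length S) + length S̅ * turán q k (length S) ≤ turán (suc q) (suc k) (length S̅ + length S)
      add-part zero fr = subst
        (λ d → turán (suc q) 0 d + length S̅ * turán q 0 d ≤ turán (suc q) 1 (length S̅ + d))
        (sym (empty fr)) (turán-add-part q 0 (λ ()) (λ ()) (length S̅))
      add-part (suc k) fr with balanced-exists k (length S)
      ... | f , bal , tot = subst
        (λ d → turán (suc q) (suc k) d + length S̅ * turán q (suc k) d ≤ turán (suc q) (2 + k) (length S̅ + d))
        tot (turán-add-part q (suc k) f bal (length S̅))

-- Transversals of the residue classes

esym-punchIn-≤ : ∀ q k g i → esym q k (g ∘ punchIn i) ≤ esym q (suc k) g
esym-punchIn-≤ zero    k       g i       = ≤-refl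
esym-punchIn-≤ (suc q) k       g zero    = m≤m+n _ _
esym-punchIn-≤ (suc q) (suc k) g (suc i) =
  +-mono-≤ (esym-punchIn-≤ (suc q) k (g ∘ suc) i) (*-monoʳ-≤ (g zero) (esym-punchIn-≤ q k (g ∘ suc) i))

∑-++ : {A : Set} (xs ys : List A) (f : A → ℕ) → ∑ (xs ++ ys) f ≡ ∑ xs f + ∑ ys f
∑-++ []       ys f = refl
∑-++ (x ∷ xs) ys f = trans (cong (f x +_) (∑-++ xs ys f)) (sym (+-assoc (f x) _ _))

∑-map : {A B : Set} (g : A → B) (xs : List A) (f : B → ℕ) → ∑ (map g xs) f ≡ ∑ xs (f ∘ g)
∑-map g []       f = refl
∑-map g (x ∷ xs) f = cong (f (g x) +_) (∑-map g xs f)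

#-allSubsets : ∀ {m} {P : Subset (suc m) → Set} (P? : ∀ S → Dec (P S)) →
  (# P?) (allSubsets (suc m)) ≡ (# (P? ∘ (true ∷ᵛ_))) (allSubsets m) + (# (P? ∘ (false ∷ᵛ_))) (allSubsets m)
#-allSubsets {m} P? = trans (∑-++ (map (true ∷ᵛ_) (allSubsets m)) _ _)
  (cong₂ _+_ (∑-map (true ∷ᵛ_) (allSubsets m) _) (∑-map (false ∷ᵛ_) (allSubsets m) _))

module _ {K : ℕ} where

  -- A colour p is forbidden by setting f p = 0, so that choosing an element and
  -- forbidding its colour is again an instance of the same count.
  record Transversal (q : ℕ) {m : ℕ} (c : Fin m → Fin K) (f : Fin K → ℕ) (S : Subset m) : Set where
    constructor transversal
    field
      size      : ∣ S ∣ ≡ q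
      injective : ∀ i j → i ∈ˢ S → j ∈ˢ S → c i ≡ c j → i ≡ j
      support   : ∀ i → i ∈ˢ S → f (c i) ≢ 0

  transversal? : ∀ q {m} (c : Fin m → Fin K) f S → Dec (Transversal q c f S)
  transversal? q c f S with ∣ S ∣ ≟ q
    | Fin.all? (λ i → Fin.all? (λ j → Sub._∈?_ i S →-dec (Sub._∈?_ j S →-dec (c i Fin.≟ c j →-dec i Fin.≟ j))))
    | Fin.all? (λ i → Sub._∈?_ i S →-dec ¬? (f (c i) ≟ 0))
  ... | yes a | yes b | yes d = yes (transversal a b d)
  ... | no ¬a | _     | _     = no (λ t → ¬a (Transversal.size t))
  ... | _     | no ¬b | _     = no (λ t → ¬b (Transversal.injective t))
  ... | _     | _     | no ¬d = no (λ t → ¬d (Transversal.support t))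

  colour-count : ∀ {m} → (Fin m → Fin K) → Fin K → ℕ
  colour-count {m} c p = total m (λ i → 𝟙 (c i Fin.≟ p))

  transversal-false : ∀ {q m c f f′} {S : Subset m} → (∀ p → f′ p ≢ 0 → f p ≢ 0) →
                      Transversal q (c ∘ suc) f′ S → Transversal q c f (false ∷ᵛ S)
  transversal-false h (transversal sz inj sup) = transversal sz
    (λ { _ _ (there i∈) (there j∈) eq → cong suc (inj _ _ i∈ j∈ eq) })
    (λ { _ (there i∈) → h _ (sup _ i∈) })

  transversal-true : ∀ {q m c f} {S : Subset m} → f (c zero) ≢ 0 →
                     Transversal q (c ∘ suc) (set (c zero) 0 f) S → Transversal (suc q) c f (true ∷ᵛ S)
  transversal-true {q} {m} {c} {f} {S} h (transversal sz inj sup) = transversal (cong suc sz) inj′ sup′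
    where
    avoid : ∀ j → j ∈ˢ S → c (suc j) ≢ c zero
    avoid j j∈ eq = sup j j∈ (trans (cong (set (c zero) 0 f) eq) (set-≡ (c zero) 0 f))
    inj′ : ∀ i j → i ∈ˢ (true ∷ᵛ S) → j ∈ˢ (true ∷ᵛ S) → c i ≡ c j → i ≡ j
    inj′ zero    zero    _          _          _  = refl
    inj′ zero    (suc j) _          (there j∈) eq = contradiction (sym eq) (avoid j j∈)
    inj′ (suc i) zero    (there i∈) _          eq = contradiction eq (avoid i i∈)
    inj′ (suc i) (suc j) (there i∈) (there j∈) eq = cong suc (inj i j i∈ j∈ eq)
    sup′ : ∀ i → i ∈ˢ (true ∷ᵛ S) → f (c i) ≢ 0
    sup′ zero    _          = h
    sup′ (suc i) (there i∈) = λ eq → sup i i∈ (trans (set-≢ (c zero) 0 f (c (suc i)) (avoid i i∈)) eq)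

  #-empty-transversal : ∀ m (c : Fin m → Fin K) f → 1 ≤ (# (transversal? 0 c f)) (allSubsets m)
  #-empty-transversal zero c f = ≤-trans
    (≤-reflexive (sym (𝟙-yes (transversal? 0 c f []ᵛ) (transversal refl (λ ()) (λ ())))))
    (m≤m+n _ 0)
  #-empty-transversal (suc m) c f = ≤-trans (#-empty-transversal m (c ∘ suc) f)
    (≤-trans (#-mono (transversal? 0 (c ∘ suc) f) (transversal? 0 c f ∘ (false ∷ᵛ_)) (allSubsets m)
               (λ S _ → transversal-false (λ _ → id)))
             (≤-trans (m≤n+m _ _) (≤-reflexive (sym (#-allSubsets (transversal? 0 c f))))))

-- Points are decided one at a time. If the later points of its colour already reach the bound `f`,
-- the first point is discarded. Otherwise `esym-decrement` splits the polynomial into transversals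
-- without it and with it, the latter with its colour forbidden.
esym≤#transversals : ∀ {K} q m (c : Fin m → Fin K) f → (∀ p → f p ≤ colour-count c p) →
                     esym q K f ≤ (# (transversal? q c f)) (allSubsets m)
esym≤#transversals         zero    m       c f h = #-empty-transversal m c f
esym≤#transversals {K}     (suc q) zero    c f h = ≤-trans (≤-reflexive (esym-zero q K f (λ p → n≤0⇒n≡0 (h p)))) z≤n
esym≤#transversals {zero}  (suc q) (suc m) c f h = z≤n
esym≤#transversals {suc K} (suc q) (suc m) c f h with f (c zero) ≤? colour-count (c ∘ suc) (c zero)
... | yes le = ≤-trans (esym≤#transversals (suc q) m (c ∘ suc) f h′)
    (≤-trans (#-mono (transversal? (suc q) (c ∘ suc) f) (transversal? (suc q) c f ∘ (false ∷ᵛ_)) (allSubsets m)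
               (λ S _ → transversal-false (λ _ → id)))
             (≤-trans (m≤n+m _ _) (≤-reflexive (sym (#-allSubsets (transversal? (suc q) c f))))))
  where
  h′ : ∀ p → f p ≤ colour-count (c ∘ suc) p
  h′ p with p Fin.≟ c zero
  ... | yes refl = le
  ... | no p≢    = ≤-trans (h p) (≤-reflexive (cong (_+ colour-count (c ∘ suc) p) (𝟙-no (c zero Fin.≟ p) (p≢ ∘ sym))))
... | no ¬le = pos (f (c zero)) refl
  where
  i = c zero
  c′ = c ∘ suc
  pos : ∀ y → f i ≡ y → esym (suc q) (suc K) f ≤ (# (transversal? (suc q) c f)) (allSubsets (suc m))
  pos zero    fi = contradiction (≤-trans (≤-reflexive fi) z≤n) ¬le
  pos (suc a) fi = begin
    esym (suc q) (suc K) f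
      ≡⟨ esym-decrement q K f (set i a f) i fi (set-≡ i a f) (set-≢ i a f) ⟩
    esym (suc q) (suc K) (set i a f) + esym q K (f ∘ punchIn i)
      ≡⟨ cong (esym (suc q) (suc K) (set i a f) +_)
           (esym-cong q K (λ j → sym (set-≢ i 0 f (punchIn i j) (Fin.punchInᵢ≢i i j)))) ⟩
    esym (suc q) (suc K) (set i a f) + esym q K (set i 0 f ∘ punchIn i)
      ≤⟨ +-monoʳ-≤ _ (esym-punchIn-≤ q K (set i 0 f) i) ⟩
    esym (suc q) (suc K) (set i a f) + esym q (suc K) (set i 0 f)
      ≤⟨ +-mono-≤ (esym≤#transversals (suc q) m c′ (set i a f) (below a a≤))
                  (esym≤#transversals q m c′ (set i 0 f) (below 0 z≤n)) ⟩
    (# (transversal? (suc q) c′ (set i a f))) (allSubsets m) + (# (transversal? q c′ (set i 0 f))) (allSubsets m)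
      ≤⟨ +-mono-≤ (#-mono (transversal? (suc q) c′ (set i a f)) (transversal? (suc q) c f ∘ (false ∷ᵛ_)) (allSubsets m)
                    (λ S _ → transversal-false supp))
                  (#-mono (transversal? q c′ (set i 0 f)) (transversal? (suc q) c f ∘ (true ∷ᵛ_)) (allSubsets m)
                    (λ S _ → transversal-true (λ eq → contradiction (trans (sym fi) eq) λ ()))) ⟩
    (# (transversal? (suc q) c f ∘ (false ∷ᵛ_))) (allSubsets m) + (# (transversal? (suc q) c f ∘ (true ∷ᵛ_))) (allSubsets m)
      ≡⟨ trans (+-comm ((# (transversal? (suc q) c f ∘ (false ∷ᵛ_))) (allSubsets m)) _)
               (sym (#-allSubsets (transversal? (suc q) c f))) ⟩
    (# (transversal? (suc q) c f)) (allSubsets (suc m)) ∎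
    where
    open ≤-Reasoning
    count-i : colour-count c i ≡ suc (colour-count c′ i)
    count-i = cong (_+ colour-count c′ i) (𝟙-yes (i Fin.≟ i) refl)
    a≤ : a ≤ colour-count c′ i
    a≤ = s≤s⁻¹ (≤-trans (≤-reflexive (sym fi)) (≤-trans (h i) (≤-reflexive count-i)))
    below : ∀ b → b ≤ colour-count c′ i → ∀ p → set i b f p ≤ colour-count c′ p
    below b b≤ p with p Fin.≟ i
    ... | yes refl = b≤
    ... | no p≢    = ≤-trans (h p) (≤-reflexive (cong (_+ colour-count c′ p) (𝟙-no (i Fin.≟ p) (p≢ ∘ sym))))
    supp : ∀ p → set i a f p ≢ 0 → f p ≢ 0
    supp p with p Fin.≟ i
    ... | yes refl = λ _ eq → contradiction (trans (sym fi) eq) λ ()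
    ... | no _     = id

-- Residue classes modulo the number of parts

T⇒≡ : ∀ {b} → T b → b ≡ true
T⇒≡ {true} _ = refl

≡⇒T : ∀ {b} → b ≡ true → T b
≡⇒T refl = tt

<ᵇ-true : ∀ {m n} → m < n → (m <ᵇ n) ≡ true
<ᵇ-true p = T⇒≡ (<⇒<ᵇ p)

<ᵇ-false : ∀ {m n} → ¬ m < n → (m <ᵇ n) ≡ false
<ᵇ-false {m} {n} ¬p with m <ᵇ n in eq
... | true  = contradiction (<ᵇ⇒< m n (≡⇒T eq)) ¬p
... | false = refl

sumTo : ℕ → (ℕ → ℕ) → ℕ
sumTo zero    g = 0
sumTo (suc m) g = sumTo m g + g m

sumTo-front : ∀ m g → sumTo (suc m) g ≡ g 0 + sumTo m (g ∘ suc)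
sumTo-front zero    g = +-comm 0 (g 0)
sumTo-front (suc m) g = trans (cong (_+ g (suc m)) (sumTo-front m g)) (+-assoc (g 0) _ _)

total-toℕ : ∀ m g → total m (g ∘ toℕ) ≡ sumTo m g
total-toℕ zero    g = refl
total-toℕ (suc m) g = trans (cong (g 0 +_) (total-toℕ m (g ∘ suc))) (sym (sumTo-front m g))

residue : ∀ k {m} → Fin m → Fin (suc k)
residue k i = fromℕ< (m%n<n (toℕ i) (suc k))

-- The quotient and remainder are carried along the induction: one more point either advances `b` or
-- completes a round. The class sizes are thus the balanced sizes `ramp a b`.
residue-count : ∀ k m → ∃₂ λ a b → b < suc k × m ≡ b + a * suc k ×
  (∀ p → p < suc k → sumTo m (λ x → 𝟙 (x % suc k ≟ p)) ≡ (if p <ᵇ b then suc a else a))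
residue-count k zero    = 0 , 0 , s≤s z≤n , refl , λ p _ → refl
residue-count k (suc m) with residue-count k m
... | a , b , b<K , refl , h with suc b ≤? k
...   | yes sb≤k = a , suc b , s≤s sb≤k , refl , step
  where
  mod : (b + a * suc k) % suc k ≡ b
  mod = trans ([m+kn]%n≡m%n b a (suc k)) (m<n⇒m%n≡m b<K)
  pt : ∀ p → (if p <ᵇ b then suc a else a) + 𝟙 (b ≟ p) ≡ (if p <ᵇ suc b then suc a else a)
  pt p with <-cmp p b
  ... | tri< p<b p≢b _ rewrite <ᵇ-true p<b | <ᵇ-true (m≤n⇒m≤1+n p<b) | 𝟙-no (b ≟ p) (p≢b ∘ sym) = +-identityʳ _
  ... | tri≈ _ refl _  rewrite <ᵇ-false (<-irrefl {p} refl) | <ᵇ-true (n<1+n p) | 𝟙-yes (p ≟ p) refl = +-comm a 1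
  ... | tri> p≮b p≢b b<p rewrite <ᵇ-false p≮b | <ᵇ-false (<⇒≱ (s≤s b<p)) | 𝟙-no (b ≟ p) (p≢b ∘ sym) = +-identityʳ _
  step : ∀ p → p < suc k → sumTo (suc (b + a * suc k)) (λ x → 𝟙 (x % suc k ≟ p)) ≡ (if p <ᵇ suc b then suc a else a)
  step p p<K = trans (cong₂ (λ u v → u + 𝟙 (v ≟ p)) (h p p<K) mod) (pt p)
...   | no ¬sb≤k = suc a , 0 , s≤s z≤n , cong (λ z → suc z + a * suc k) b≡k , step
  where
  b≡k : b ≡ k
  b≡k = ≤-antisym (s≤s⁻¹ b<K) (s≤s⁻¹ (≰⇒> ¬sb≤k))
  mod : (b + a * suc k) % suc k ≡ b
  mod = trans ([m+kn]%n≡m%n b a (suc k)) (m<n⇒m%n≡m b<K)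
  pt : ∀ p → p ≤ b → (if p <ᵇ b then suc a else a) + 𝟙 (b ≟ p) ≡ suc a
  pt p p≤b with <-cmp p b
  ... | tri< p<b p≢b _ rewrite <ᵇ-true p<b | 𝟙-no (b ≟ p) (p≢b ∘ sym) = +-identityʳ _
  ... | tri≈ _ refl _  rewrite <ᵇ-false (<-irrefl {p} refl) | 𝟙-yes (p ≟ p) refl = +-comm a 1
  ... | tri> _ _ b<p = contradiction p≤b (<⇒≱ b<p)
  step : ∀ p → p < suc k → sumTo (suc (b + a * suc k)) (λ x → 𝟙 (x % suc k ≟ p)) ≡ suc a
  step p p<K = trans (cong₂ (λ u v → u + 𝟙 (v ≟ p)) (h p p<K) mod) (pt p (≤-trans (s≤s⁻¹ p<K) (≤-reflexive (sym b≡k))))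

no-elements : ∀ {m} (X : Subset m) → (∀ i → i ∉ˢ X) → ∣ X ∣ ≡ 0
no-elements []ᵛ          h = refl
no-elements (true ∷ᵛ X)  h = contradiction here (h zero)
no-elements (false ∷ᵛ X) h = no-elements X (λ i i∈ → h (suc i) (there i∈))

subsingleton : ∀ {m} (X : Subset m) → (∀ i j → i ∈ˢ X → j ∈ˢ X → i ≡ j) → ∣ X ∣ ≤ 1
subsingleton []ᵛ          h = z≤n
subsingleton (true ∷ᵛ X)  h = s≤s (≤-reflexive (no-elements X λ i i∈ → case h zero (suc i) here (there i∈) of λ ()))
subsingleton (false ∷ᵛ X) h = subsingleton X (λ i j i∈ j∈ → Fin.suc-injective (h (suc i) (suc j) (there i∈) (there j∈)))

and-map : {A : Set} (h : A → Bool) → ∀ xs → (∀ x → h x ≡ true) → and (map h xs) ≡ true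
and-map h []       all = refl
and-map h (x ∷ xs) all = cong₂ _∧_ (all x) (and-map h xs all)

-- The residue classes are balanced, so they carry at least `turán` many transversals. This
-- direction suffices, because the construction has exactly `s * t` edges and the upper bound is
-- proved in terms of `turán`.
turán≤t : ∀ q m k → turán q (suc k) m ≤ t q m (suc k)
turán≤t q m k with residue-count k m
... | a , b , b<K , m≡ , counts = begin
  turán q (suc k) m
    ≡⟨ cong (turán q (suc k)) (trans m≡ (trans (cong (b +_) (*-comm a (suc k))) (sym (total-ramp a b (suc k) (<⇒≤ b<K))))) ⟩
  turán q (suc k) (total (suc k) (ramp a b))
    ≤⟨ turán≤esym q (suc k) (ramp a b) (ramp-balanced a b) ⟩
  esym q (suc k) (ramp a b)
    ≤⟨ esym≤#transversals q m (residue k) (ramp a b) (λ p → ≤-reflexive (sym (count p))) ⟩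
  (# (transversal? q (residue k) (ramp a b))) (allSubsets m)
    ≤⟨ #-mono (transversal? q (residue k) (ramp a b)) (λ S → T? (test S)) (allSubsets m) (λ S _ → sound S) ⟩
  (# (λ S → T? (test S))) (allSubsets m)
    ≡⟨ sym (length-filter≡# (λ S → T? (test S)) (allSubsets m)) ⟩
  t q m (suc k) ∎
  where
  open ≤-Reasoning
  test : Subset m → Bool
  test S = (∣ S ∣ ≡ᵇ q) ∧ and (map (λ p → ∣ S ∩ part m k p ∣ ≤ᵇ 1) (allFin (suc k)))
  toℕ-residue : ∀ {m} (i : Fin m) → toℕ (residue k i) ≡ toℕ i % suc k
  toℕ-residue i = Fin.toℕ-fromℕ< (m%n<n (toℕ i) (suc k))
  count : ∀ p → colour-count {m = m} (residue k) p ≡ ramp a b p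
  count p = trans (total-cong m (λ i → ≤-antisym
                (𝟙-mono (residue k i Fin.≟ p) (toℕ i % suc k ≟ toℕ p) (λ { refl → sym (toℕ-residue i) }))
                (𝟙-mono (toℕ i % suc k ≟ toℕ p) (residue k i Fin.≟ p) (λ e → Fin.toℕ-injective (trans (toℕ-residue i) e)))))
              (trans (total-toℕ m (λ x → 𝟙 (x % suc k ≟ toℕ p))) (counts (toℕ p) (Fin.toℕ<n p)))
  in-part : ∀ p i → i ∈ˢ part m k p → residue k i ≡ p
  in-part p i i∈ = Fin.toℕ-injective (trans (toℕ-residue i)
    (≡ᵇ⇒≡ _ _ (≡⇒T (trans (sym (Vec.lookup∘tabulate (λ i → (toℕ i % suc k) ≡ᵇ toℕ p) i)) (Vec.[]=⇒lookup i∈)))))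
  sound : ∀ S → Transversal q (residue k) (ramp a b) S → T (test S)
  sound S (transversal sz inj _) = ≡⇒T (cong₂ _∧_ (T⇒≡ (≡⇒≡ᵇ ∣ S ∣ q sz))
    (and-map _ (allFin (suc k)) λ p → T⇒≡ (≤⇒≤ᵇ (subsingleton (S ∩ part m k p) λ i j i∈ j∈ →
      inj i j (proj₁ (Sub.x∈p∩q⁻ S _ i∈)) (proj₁ (Sub.x∈p∩q⁻ S _ j∈))
        (trans (in-part p i (proj₂ (Sub.x∈p∩q⁻ S _ i∈))) (sym (in-part p j (proj₂ (Sub.x∈p∩q⁻ S _ j∈)))))))))

-- Edges with prescribed vertices

_∈ᵉ?_ : ∀ {n} (x : Fin n) (e : Subset n) → Dec (x ∈ˢ e)
x ∈ᵉ? e = Sub._∈?_ x e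

_∈ˡ?_ : ∀ {n} (x : Fin n) (xs : List (Fin n)) → Dec (x ∈ xs)
x ∈ˡ? xs = any? (x Fin.≟_) xs

elems : ∀ {n} → Subset n → List (Fin n)
elems []ᵛ          = []
elems (true ∷ᵛ p)  = zero ∷ map suc (elems p)
elems (false ∷ᵛ p) = map suc (elems p)

length-elems : ∀ {n} (e : Subset n) → length (elems e) ≡ ∣ e ∣
length-elems []ᵛ          = refl
length-elems (true ∷ᵛ p)  = cong suc (trans (ListP.length-map suc (elems p)) (length-elems p))
length-elems (false ∷ᵛ p) = trans (ListP.length-map suc (elems p)) (length-elems p)

elems-unique : ∀ {n} (e : Subset n) → Unique (elems e)
elems-unique []ᵛ          = []
elems-unique (true ∷ᵛ p)  = AllP.map⁺ (All.tabulate (λ _ ())) ∷ UniqueP.map⁺ Fin.suc-injective (elems-unique p)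
elems-unique (false ∷ᵛ p) = UniqueP.map⁺ Fin.suc-injective (elems-unique p)

∈-elems⁺ : ∀ {n} {x : Fin n} e → x ∈ˢ e → x ∈ elems e
∈-elems⁺ (true ∷ᵛ p)  here       = here refl
∈-elems⁺ (true ∷ᵛ p)  (there x∈) = there (Mem.∈-map⁺ suc (∈-elems⁺ p x∈))
∈-elems⁺ (false ∷ᵛ p) (there x∈) = Mem.∈-map⁺ suc (∈-elems⁺ p x∈)

∈-elems⁻ : ∀ {n} {x : Fin n} e → x ∈ elems e → x ∈ˢ e
∈-elems⁻ (true ∷ᵛ p) (here refl) = here
∈-elems⁻ (true ∷ᵛ p) (there x∈) with Mem.∈-map⁻ suc x∈
... | y , y∈ , refl = there (∈-elems⁻ p y∈)
∈-elems⁻ (false ∷ᵛ p) x∈ with Mem.∈-map⁻ suc x∈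
... | y , y∈ , refl = there (∈-elems⁻ p y∈)

subset-ext : ∀ {n} {e e′ : Subset n} → (∀ x → x ∈ˢ e → x ∈ˢ e′) → (∀ x → x ∈ˢ e′ → x ∈ˢ e) → e ≡ e′
subset-ext h h′ = Sub.⊆-antisym (λ {x} → h x) (λ {x} → h′ x)

same-length : {A : Set} {xs ys : List A} → Unique xs → Unique ys →
              (∀ x → x ∈ xs → x ∈ ys) → (∀ x → x ∈ ys → x ∈ xs) → length xs ≡ length ys
same-length ux uy h h′ = ≤-antisym (Unique-⊆-length ux h) (Unique-⊆-length uy h′)

#-edge : ∀ {n} (e : Subset n) xs → Unique xs → (∀ x → x ∈ˢ e → x ∈ xs) → (# (_∈ᵉ? e)) xs ≡ ∣ e ∣
#-edge e xs u h = trans (sym (length-filter≡# (_∈ᵉ? e) xs)) (trans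
  (same-length (UniqueP.filter⁺ (_∈ᵉ? e) u) (elems-unique e)
    (λ x x∈ → ∈-elems⁺ e (proj₂ (Mem.∈-filter⁻ (_∈ᵉ? e) {xs = xs} x∈)))
    (λ x x∈ → Mem.∈-filter⁺ (_∈ᵉ? e) (h x (∈-elems⁻ e x∈)) (∈-elems⁻ e x∈)))
  (length-elems e))

#-edge-≤ : ∀ {n} (e : Subset n) xs → Unique xs → (# (_∈ᵉ? e)) xs ≤ ∣ e ∣
#-edge-≤ e xs u = ≤-trans (≤-reflexive (sym (length-filter≡# (_∈ᵉ? e) xs))) (≤-trans
  (Unique-⊆-length (UniqueP.filter⁺ (_∈ᵉ? e) u)
    (λ x x∈ → ∈-elems⁺ e (proj₂ (Mem.∈-filter⁻ (_∈ᵉ? e) {xs = xs} x∈))))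
  (≤-reflexive (length-elems e)))

#≤1 : {A : Set} {P : A → Set} (P? : ∀ x → Dec (P x)) → ∀ xs → Unique xs →
      (∀ x y → x ∈ xs → y ∈ xs → P x → P y → x ≡ y) → (# P?) xs ≤ 1
#≤1 P? []       _        h = z≤n
#≤1 P? (x ∷ xs) (x∉ ∷ u) h with P? x
... | no _  = #≤1 P? xs u (λ y z y∈ z∈ → h y z (there y∈) (there z∈))
... | yes p = s≤s (≤-reflexive (#-none P? xs λ y y∈ py → All.lookup x∉ y∈ (h x y (here refl) (there y∈) p py)))

module _ {n : ℕ} {R : Fin n → Fin n → Set} (R? : ∀ x y → Dec (R x y))
         {H : List (Subset n)} (uniqH : Unique H) where

  -- An edge is determined by its trace on `xs`, and the trace is a `p`-clique. Splitting by whether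
  -- the first vertex `x` lies in the edge follows the recursion of `cliques`: if it does, the rest
  -- of the trace consists of neighbours of `x`.
  #≤cliques : ∀ p {P : Subset n → Set} (P? : ∀ e → Dec (P e)) xs → Unique xs →
    (∀ e e′ → e ∈ H → e′ ∈ H → P e → P e′ → (∀ x → x ∈ xs → x ∈ˢ e → x ∈ˢ e′) →
       (∀ x → x ∈ xs → x ∈ˢ e′ → x ∈ˢ e) → e ≡ e′) →
    (∀ e → e ∈ H → P e → (# (_∈ᵉ? e)) xs ≡ p) →
    (∀ e → e ∈ H → P e → ∀ x y → x ∈ xs → y ∈ xs → x ≢ y → x ∈ˢ e → y ∈ˢ e → R x y) →
    (# P?) H ≤ cliques R? p xs
  #≤cliques zero P? xs u eq sz cl = #≤1 P? H uniqH λ e e′ e∈ e′∈ p p′ →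
    eq e e′ e∈ e′∈ p p′ (λ x x∈ x∈e → ⊥-elim (none e (sz e e∈ p) x x∈ x∈e))
                         (λ x x∈ x∈e′ → ⊥-elim (none e′ (sz e′ e′∈ p′) x x∈ x∈e′))
    where
    none : ∀ e → (# (_∈ᵉ? e)) xs ≡ 0 → ∀ x → x ∈ xs → x ∉ˢ e
    none e s x x∈ x∈e = contradiction (≤-trans (≤-reflexive (sym (𝟙-yes (x ∈ᵉ? e) x∈e)))
      (≤-trans (∑-member xs (λ y → 𝟙 (y ∈ᵉ? e)) x∈) (≤-reflexive s))) λ ()
  #≤cliques (suc p) P? [] u eq sz cl = ≤-reflexive (#-none P? H λ e e∈ pe → contradiction (sz e e∈ pe) λ ())
  #≤cliques (suc p) {P} P? (x ∷ xs) (x∉ ∷ u) eq sz cl = ≤-trans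
    (#-⊎ P? P₀? P₁? H (λ e _ pe → split e pe (x ∈ᵉ? e)))
    (+-mono-≤
      (#≤cliques (suc p) P₀? xs u
        (λ { e e′ e∈ e′∈ (pe , x∉e) (pe′ , x∉e′) h h′ → eq e e′ e∈ e′∈ pe pe′
             (λ { y (here refl) y∈e → contradiction y∈e x∉e ; y (there y∈) y∈e → h y y∈ y∈e })
             (λ { y (here refl) y∈e′ → contradiction y∈e′ x∉e′ ; y (there y∈) y∈e′ → h′ y y∈ y∈e′ }) })
        (λ { e e∈ (pe , x∉e) → trans (cong (_+ (# (_∈ᵉ? e)) xs) (sym (𝟙-no (x ∈ᵉ? e) x∉e))) (sz e e∈ pe) })
        (λ { e e∈ (pe , _) y z y∈ z∈ → cl e e∈ pe y z (there y∈) (there z∈) }))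
      (#≤cliques p P₁? (filter (R? x) xs) (UniqueP.filter⁺ (R? x) u)
        (λ { e e′ e∈ e′∈ (pe , x∈e) (pe′ , x∈e′) h h′ → eq e e′ e∈ e′∈ pe pe′
             (λ { y (here refl) y∈e → x∈e′
                ; y (there y∈) y∈e → h y (Mem.∈-filter⁺ (R? x) y∈ (adj e e∈ pe x∈e y y∈ y∈e)) y∈e })
             (λ { y (here refl) y∈e′ → x∈e
                ; y (there y∈) y∈e′ → h′ y (Mem.∈-filter⁺ (R? x) y∈ (adj e′ e′∈ pe′ x∈e′ y y∈ y∈e′)) y∈e′ }) })
        (λ { e e∈ (pe , x∈e) → trans (#-filter (_∈ᵉ? e) (R? x) xs) (trans
             (≤-antisym (#-mono (λ y → R? x y ×-dec (y ∈ᵉ? e)) (_∈ᵉ? e) xs (λ _ _ → proj₂))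
                        (#-mono (_∈ᵉ? e) (λ y → R? x y ×-dec (y ∈ᵉ? e)) xs
                                (λ y y∈ y∈e → adj e e∈ pe x∈e y y∈ y∈e , y∈e)))
             (suc-injective (trans (cong (_+ (# (_∈ᵉ? e)) xs) (sym (𝟙-yes (x ∈ᵉ? e) x∈e))) (sz e e∈ pe)))) })
        (λ { e e∈ (pe , _) y z y∈ z∈ → cl e e∈ pe y z
               (there (proj₁ (Mem.∈-filter⁻ (R? x) {xs = xs} y∈))) (there (proj₁ (Mem.∈-filter⁻ (R? x) {xs = xs} z∈))) })))
    where
    P₀? : ∀ e → Dec (P e × x ∉ˢ e)
    P₀? e = P? e ×-dec ¬? (x ∈ᵉ? e)
    P₁? : ∀ e → Dec (P e × x ∈ˢ e)
    P₁? e = P? e ×-dec (x ∈ᵉ? e)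
    split : ∀ e → P e → Dec (x ∈ˢ e) → (P e × x ∉ˢ e) ⊎ (P e × x ∈ˢ e)
    split e pe (yes q) = inj₂ (pe , q)
    split e pe (no q)  = inj₁ (pe , q)
    adj : ∀ e → e ∈ H → P e → x ∈ˢ e → ∀ y → y ∈ xs → y ∈ˢ e → R x y
    adj e e∈ pe x∈e y y∈ y∈e = cl e e∈ pe x y (here refl) (there y∈) (All.lookup x∉ y∈) x∈e y∈e

  -- Edges that contain `J` and otherwise lie in `xs` differ only in their trace on `xs`. All links
  -- below are counted in this form, for adjacency as well as for relations that come from colour
  -- classes.
  #link≤cliques : ∀ p {P : Subset n → Set} (P? : ∀ e → Dec (P e)) J xs → Unique (J ++ xs) →
    (∀ e → e ∈ H → P e → (∀ x → x ∈ J → x ∈ˢ e) × (∀ x → x ∈ˢ e → x ∈ J ++ xs) × ∣ e ∣ ≡ length J + p) →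
    (∀ e → e ∈ H → P e → ∀ x y → x ∈ xs → y ∈ xs → x ≢ y → x ∈ˢ e → y ∈ˢ e → R x y) →
    (# P?) H ≤ cliques R? p xs
  #link≤cliques p {P} P? J xs u h cl = #≤cliques p P? xs (++-unique-right J u) eq sz cl
    where
    ++-unique-right : ∀ (as : List (Fin n)) {bs} → Unique (as ++ bs) → Unique bs
    ++-unique-right []       u       = u
    ++-unique-right (a ∷ as) (_ ∷ u) = ++-unique-right as u
    eq : ∀ e e′ → e ∈ H → e′ ∈ H → P e → P e′ → (∀ x → x ∈ xs → x ∈ˢ e → x ∈ˢ e′) →
         (∀ x → x ∈ xs → x ∈ˢ e′ → x ∈ˢ e) → e ≡ e′
    eq e e′ e∈ e′∈ pe pe′ k k′ with h e e∈ pe | h e′ e′∈ pe′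
    ... | J⊆e , e⊆ , _ | J⊆e′ , e′⊆ , _ = subset-ext
      (λ x x∈e → [ J⊆e′ x , (λ x∈ → k x x∈ x∈e) ]′ (Mem.∈-++⁻ J (e⊆ x x∈e)))
      (λ x x∈e′ → [ J⊆e x , (λ x∈ → k′ x x∈ x∈e′) ]′ (Mem.∈-++⁻ J (e′⊆ x x∈e′)))
    sz : ∀ e → e ∈ H → P e → (# (_∈ᵉ? e)) xs ≡ p
    sz e e∈ pe with h e e∈ pe
    ... | J⊆e , e⊆ , size = +-cancelˡ-≡ (length J) _ _ (trans
      (cong (_+ (# (_∈ᵉ? e)) xs) (sym (#-all (_∈ᵉ? e) J J⊆e)))
      (trans (sym (#-++ J)) (trans (#-edge e (J ++ xs) u e⊆) size)))
      where
      #-++ : ∀ J → (# (_∈ᵉ? e)) (J ++ xs) ≡ (# (_∈ᵉ? e)) J + (# (_∈ᵉ? e)) xs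
      #-++ J = ∑-++ J xs (λ y → 𝟙 (y ∈ᵉ? e))

-- With the complete relation the clique bound becomes the trivial codegree bound.
#link≤power : ∀ {n} {H : List (Subset n)} → Unique H → ∀ act → Unique act →
  ∀ J p → Unique J → (∀ x → x ∈ J → x ∈ act) → (∀ e → e ∈ H → ∀ x → x ∈ˢ e → x ∈ act) →
  (∀ e → e ∈ H → ∣ e ∣ ≡ length J + p) →
  (# (λ e → all? (_∈ᵉ? e) J)) H ≤ length act ^ p
#link≤power {n} {H} uniqH act uact J p uJ J⊆ H⊆ sz = ≤-trans
  (#link≤cliques {R = λ _ _ → ⊤} (λ _ _ → yes tt) uniqH p (λ e → all? (_∈ᵉ? e) J) J xs
    (UniqueP.++⁺ uJ (UniqueP.filter⁺ (λ x → ¬? (x ∈ˡ? J)) uact)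
      (λ { (x∈J , x∈xs) → proj₂ (Mem.∈-filter⁻ (λ x → ¬? (x ∈ˡ? J)) {xs = act} x∈xs) x∈J }))
    (λ e e∈ a → (λ x x∈ → All.lookup a x∈) , (λ x x∈e → cover e e∈ x x∈e) , sz e e∈)
    (λ _ _ _ _ _ _ _ _ _ _ → tt))
  (≤-trans (cliques-upper (λ _ _ → yes tt) p xs) (^-monoˡ-≤ p (ListP.length-filter (λ x → ¬? (x ∈ˡ? J)) act)))
  where
  xs = filter (λ x → ¬? (x ∈ˡ? J)) act
  cover : ∀ e → e ∈ H → ∀ x → x ∈ˢ e → x ∈ J ++ xs
  cover e e∈ x x∈e with x ∈ˡ? J
  ... | yes x∈J = Mem.∈-++⁺ˡ x∈J
  ... | no x∉J  = Mem.∈-++⁺ʳ J (Mem.∈-filter⁺ (λ x → ¬? (x ∈ˡ? J)) (H⊆ e e∈ x x∈e) x∉J)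

-- Pairs of vertices whose edges cannot be blocked by few vertices

anyList? : ∀ {n} L {P : List (Fin n) → Set} → (∀ F → Dec (P F)) → Dec (∃ λ F → length F ≤ L × P F)
anyList? L P? with P? []
anyList? L P? | yes p = yes ([] , z≤n , p)
anyList? zero P? | no ¬p = no (λ { ([] , _ , p) → ¬p p })
anyList? (suc L) P? | no ¬p with Fin.any? (λ x → anyList? L (λ F → P? (x ∷ F)))
... | yes (x , F , le , p) = yes (x ∷ F , s≤s le , p)
... | no ¬q = no (λ { ([] , _ , p) → ¬p p ; (x ∷ F , s≤s le , p) → ¬q (x , F , le , p) })

module Pairs {n : ℕ} (H : List (Subset n)) (L : ℕ) where

  -- Only vertices other than `x` and `y` block, so that a forbidden list may contain `x` and `y`
  -- themselves. The case `x ≡ y` is meaningful: it concerns the edges through a single vertex and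
  -- is used to define the set W.
  Blocks : Fin n → Fin n → List (Fin n) → Set
  Blocks x y F = All (λ e → x ∈ˢ e → y ∈ˢ e → Any (λ f → f ∈ˢ e × f ≢ x × f ≢ y) F) H

  -- The negation of Bad x y says that even after any L other vertices are
  -- forbidden, some edge through x and y remains.
  Bad : Fin n → Fin n → Set
  Bad x y = ∃ λ F → length F ≤ L × Blocks x y F

  blocks-edge? : ∀ (x y : Fin n) F (e : Subset n) → Dec (x ∈ˢ e → y ∈ˢ e → Any (λ f → f ∈ˢ e × f ≢ x × f ≢ y) F)
  blocks-edge? x y F e = (x ∈ᵉ? e) →-dec ((y ∈ᵉ? e) →-dec
    any? (λ f → (f ∈ᵉ? e) ×-dec (¬? (f Fin.≟ x) ×-dec ¬? (f Fin.≟ y))) F)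

  bad? : ∀ (x y : Fin n) → Dec (Bad x y)
  bad? x y = anyList? L (λ F → all? (blocks-edge? x y F) H)

  bad-sym : ∀ {x y} → Bad x y → Bad y x
  bad-sym (F , le , b) = F , le , All.map (λ h y∈ x∈ → Any.map (λ { (a , b , c) → a , c , b }) (h x∈ y∈)) b

  avoiding-edge : ∀ {x y : Fin n} → ¬ Bad x y → ∀ F → length F ≤ L →
    ∃ λ (e : Subset n) → e ∈ H × x ∈ˢ e × y ∈ˢ e × (∀ f → f ∈ F → f ∈ˢ e → f ≡ x ⊎ f ≡ y)
  avoiding-edge {x} {y} ¬bad F le with find {P = λ (e : Subset n) → ¬ (x ∈ˢ e → y ∈ˢ e → Any (λ f → f ∈ˢ e × f ≢ x × f ≢ y) F)}
                (AllP.¬All⇒Any¬ (blocks-edge? x y F) H (λ b → ¬bad (F , le , b)))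
  ... | e , e∈ , ¬h = e , e∈ , decidable-stable (x ∈ᵉ? e) (λ x∉ → ¬h (λ x∈ → contradiction x∈ x∉))
                             , decidable-stable (y ∈ᵉ? e) (λ y∉ → ¬h (λ _ y∈ → contradiction y∈ y∉))
                             , av
    where
    av : ∀ f → f ∈ F → f ∈ˢ e → f ≡ x ⊎ f ≡ y
    av f f∈ f∈e with f Fin.≟ x | f Fin.≟ y
    ... | yes p | _     = inj₁ p
    ... | _     | yes q = inj₂ q
    ... | no p  | no q  = ⊥-elim (¬h (λ _ _ → lose f∈ (f∈e , p , q)))

  #-bad : ∀ {x y} → Bad x y → ∀ c →
    (∀ f → f ≢ x → f ≢ y → (# (λ e → all? (_∈ᵉ? e) (x ∷ y ∷ f ∷ []))) H ≤ c) →
    (# (λ e → (x ∈ᵉ? e) ×-dec (y ∈ᵉ? e))) H ≤ L * c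
  #-bad {x} {y} (F , le , b) c h = ≤-trans
    (#-hit (λ e → (x ∈ᵉ? e) ×-dec (y ∈ᵉ? e)) Q? H F (λ { e e∈ (x∈ , y∈) → hit e e∈ x∈ y∈ }))
    (≤-trans (∑-bound F c (λ f _ → bound f)) (*-monoˡ-≤ c le))
    where
    Q? : ∀ f e → Dec ((f ≢ x × f ≢ y) × All (_∈ˢ e) (x ∷ y ∷ f ∷ []))
    Q? f e = (¬? (f Fin.≟ x) ×-dec ¬? (f Fin.≟ y)) ×-dec all? (_∈ᵉ? e) (x ∷ y ∷ f ∷ [])
    hit : ∀ e → e ∈ H → x ∈ˢ e → y ∈ˢ e → ∃ λ f → f ∈ F × ((f ≢ x × f ≢ y) × All (_∈ˢ e) (x ∷ y ∷ f ∷ []))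
    hit e e∈ x∈ y∈ with find (All.lookup b e∈ x∈ y∈)
    ... | f , f∈ , f∈e , f≢x , f≢y = f , f∈ , (f≢x , f≢y) , x∈ ∷ y∈ ∷ f∈e ∷ []
    bound : ∀ f → (# (Q? f)) H ≤ c
    bound f = cases (f Fin.≟ x) (f Fin.≟ y)
      where
      cases : Dec (f ≡ x) → Dec (f ≡ y) → (# (Q? f)) H ≤ c
      cases (yes p) _       = ≤-trans (≤-reflexive (#-none (Q? f) H (λ { _ _ ((f≢x , _) , _) → f≢x p }))) z≤n
      cases (no _)  (yes q) = ≤-trans (≤-reflexive (#-none (Q? f) H (λ { _ _ ((_ , f≢y) , _) → f≢y q }))) z≤n
      cases (no p)  (no q)  =
        ≤-trans (#-mono (Q? f) (λ e → all? (_∈ᵉ? e) (x ∷ y ∷ f ∷ [])) H (λ _ _ → proj₂)) (h f p q)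

-- Expansions

lookup-injective : {A : Set} {xs : List A} → Unique xs → ∀ i j → lookup xs i ≡ lookup xs j → i ≡ j
lookup-injective {xs = x ∷ xs} (_ ∷ _)  zero    zero    _  = refl
lookup-injective {xs = x ∷ xs} (x∉ ∷ _) zero    (suc j) eq = contradiction eq (All.lookup x∉ (Mem.∈-lookup j))
lookup-injective {xs = x ∷ xs} (x∉ ∷ _) (suc i) zero    eq = contradiction (sym eq) (All.lookup x∉ (Mem.∈-lookup i))
lookup-injective {xs = x ∷ xs} (_ ∷ u)  (suc i) (suc j) eq = cong suc (lookup-injective u i j eq)

enumerate : {A : Set} (xs : List A) → Unique xs → ∀ {m} → length xs ≡ m →
  ∃ λ (g : Fin m → A) → (∀ i j → g i ≡ g j → i ≡ j) × (∀ i → g i ∈ xs) × (∀ x → x ∈ xs → ∃ λ i → g i ≡ x)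
enumerate xs u refl = lookup xs , lookup-injective u , (λ i → Mem.∈-lookup i)
                    , (λ x x∈ → Any.index x∈ , sym (AnyP.lookup-index x∈))

∈-⋃⁻ : ∀ {n} {x : Fin n} (Ss : List (Subset n)) → x ∈ˢ ⋃ Ss → ∃ λ S → S ∈ Ss × x ∈ˢ S
∈-⋃⁻ []       x∈ = ⊥-elim (Sub.∉⊥ x∈)
∈-⋃⁻ (S ∷ Ss) x∈ with Sub.x∈p∪q⁻ S (⋃ Ss) x∈
... | inj₁ p = S , here refl , p
... | inj₂ p with ∈-⋃⁻ Ss p
...   | S′ , S′∈ , q = S′ , there S′∈ , q

∈-⋃⁺ : ∀ {n} {x : Fin n} (Ss : List (Subset n)) {S} → S ∈ Ss → x ∈ˢ S → x ∈ˢ ⋃ Ss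
∈-⋃⁺ (S ∷ Ss) (here refl) x∈ = Sub.x∈p∪q⁺ (inj₁ x∈)
∈-⋃⁺ (S ∷ Ss) (there S∈)  x∈ = Sub.x∈p∪q⁺ (inj₂ (∈-⋃⁺ Ss S∈ x∈))

edge-split : ∀ {n ρ} (e : Subset n) {a b} → a ∈ˢ e → b ∈ˢ e → a ≢ b → ∣ e ∣ ≡ 2 + ρ →
  ∃ λ (g : Fin ρ → Fin n) → (∀ i j → g i ≡ g j → i ≡ j) × (∀ i → g i ∈ˢ e × g i ≢ a × g i ≢ b) ×
    ⁅ a ⁆ ∪ ⁅ b ⁆ ∪ ⋃ (map (λ k → ⁅ g k ⁆) (allFin ρ)) ≡ e
edge-split {n} {ρ} e {a} {b} a∈ b∈ a≢b size with enumerate rest (UniqueP.filter⁺ other? (elems-unique e)) len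
  where
  other? : ∀ x → Dec (x ≢ a × x ≢ b)
  other? x = ¬? (x Fin.≟ a) ×-dec ¬? (x Fin.≟ b)
  rest = filter other? (elems e)
  rest⁻ : ∀ x → x ∈ rest → x ∈ elems e × x ≢ a × x ≢ b
  rest⁻ x x∈ = Mem.∈-filter⁻ other? {xs = elems e} x∈
  len : length rest ≡ ρ
  len = suc-injective (suc-injective (trans (same-length
    ((a≢b ∷ All.tabulate (λ {x} x∈ eq → proj₁ (proj₂ (rest⁻ x x∈)) (sym eq)))
      ∷ All.tabulate (λ {x} x∈ eq → proj₂ (proj₂ (rest⁻ x x∈)) (sym eq))
      ∷ UniqueP.filter⁺ other? (elems-unique e))
    (elems-unique e)
    (λ { x (here refl) → ∈-elems⁺ e a∈ ; x (there (here refl)) → ∈-elems⁺ e b∈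
       ; x (there (there x∈)) → proj₁ (rest⁻ x x∈) })
    back) (trans (length-elems e) size)))
    where
    back : ∀ x → x ∈ elems e → x ∈ a ∷ b ∷ rest
    back x x∈ with x Fin.≟ a | x Fin.≟ b
    ... | yes refl | _        = here refl
    ... | no _     | yes refl = there (here refl)
    ... | no p     | no q     = there (there (Mem.∈-filter⁺ other? x∈ (p , q)))
... | g , inj , g∈ , onto = g , inj , (λ i → mem i) , subset-ext to from
  where
  other? : ∀ x → Dec (x ≢ a × x ≢ b)
  other? x = ¬? (x Fin.≟ a) ×-dec ¬? (x Fin.≟ b)
  mem : ∀ i → g i ∈ˢ e × g i ≢ a × g i ≢ b
  mem i with Mem.∈-filter⁻ other? {xs = elems e} (g∈ i)
  ... | p , q = ∈-elems⁻ e p , q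
  to : ∀ x → x ∈ˢ ⁅ a ⁆ ∪ ⁅ b ⁆ ∪ ⋃ (map (λ k → ⁅ g k ⁆) (allFin ρ)) → x ∈ˢ e
  to x x∈ with Sub.x∈p∪q⁻ ⁅ a ⁆ _ x∈
  ... | inj₁ p = subst (_∈ˢ e) (sym (Sub.x∈⁅y⁆⇒x≡y a p)) a∈
  ... | inj₂ p with Sub.x∈p∪q⁻ ⁅ b ⁆ _ p
  ...   | inj₁ q = subst (_∈ˢ e) (sym (Sub.x∈⁅y⁆⇒x≡y b q)) b∈
  ...   | inj₂ q with ∈-⋃⁻ (map (λ k → ⁅ g k ⁆) (allFin ρ)) q
  ...     | S , S∈ , x∈S with Mem.∈-map⁻ (λ k → ⁅ g k ⁆) S∈
  ...       | k , _ , refl = subst (_∈ˢ e) (sym (Sub.x∈⁅y⁆⇒x≡y (g k) x∈S)) (proj₁ (mem k))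
  from : ∀ x → x ∈ˢ e → x ∈ˢ ⁅ a ⁆ ∪ ⁅ b ⁆ ∪ ⋃ (map (λ k → ⁅ g k ⁆) (allFin ρ))
  from x x∈ with x Fin.≟ a | x Fin.≟ b
  ... | yes refl | _        = Sub.x∈p∪q⁺ (inj₁ (Sub.x∈⁅x⁆ a))
  ... | no _     | yes refl = Sub.x∈p∪q⁺ (inj₂ (Sub.x∈p∪q⁺ (inj₁ (Sub.x∈⁅x⁆ b))))
  ... | no p     | no q with onto x (Mem.∈-filter⁺ other? (∈-elems⁺ e x∈) (p , q))
  ...   | k , refl = Sub.x∈p∪q⁺ (inj₂ (Sub.x∈p∪q⁺ (inj₂
                       (∈-⋃⁺ (map (λ k → ⁅ g k ⁆) (allFin ρ)) (Mem.∈-map⁺ (λ k → ⁅ g k ⁆) (Mem.∈-allFin k)) (Sub.x∈⁅x⁆ (g k))))))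

module _ {n ρ : ℕ} {F : Graph} {H : List (Subset n)} where

  private
    left right : Fin (length (edges F)) → V F
    left i  = proj₁ (lookup (edges F) i)
    right i = proj₂ (lookup (edges F) i)

  -- The new vertices of edge `i` are whatever `E i` contains besides its two ends. They avoid the
  -- core by `core`, and those of different edges are distinct because `shared` puts common vertices
  -- into the core.
  containsExp : (c : V F → Fin n) → (∀ u v → c u ≡ c v → u ≡ v) →
    (E : Fin (length (edges F)) → Subset n) → (∀ i → E i ∈ H) → (∀ i → ∣ E i ∣ ≡ 2 + ρ) →
    (∀ i → left i ≢ right i) → (∀ i → c (left i) ∈ˢ E i) → (∀ i → c (right i) ∈ˢ E i) →
    (∀ i v → c v ∈ˢ E i → v ≡ left i ⊎ v ≡ right i) →
    (∀ i j x → i ≢ j → x ∈ˢ E i → x ∈ˢ E j → ∃ λ v → x ≡ c v) →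
    ContainsExp (2 + ρ) n F H
  containsExp c c-inj E E∈ sizes l≢r l∈ r∈ core shared = φ , inj , λ i → subst (_∈ H) (sym (covers i)) (E∈ i)
    where
    split = λ i → edge-split (E i) (l∈ i) (r∈ i) (λ eq → l≢r i (c-inj _ _ eq)) (sizes i)
    new : ∀ i → Fin ρ → Fin n
    new i = proj₁ (split i)
    new-inj : ∀ i k k′ → new i k ≡ new i k′ → k ≡ k′
    new-inj i = proj₁ (proj₂ (split i))
    new∈ : ∀ i k → new i k ∈ˢ E i × new i k ≢ c (left i) × new i k ≢ c (right i)
    new∈ i = proj₁ (proj₂ (proj₂ (split i)))
    covers : ∀ i → ⁅ c (left i) ⁆ ∪ ⁅ c (right i) ⁆ ∪ ⋃ (map (λ k → ⁅ new i k ⁆) (allFin ρ)) ≡ E i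
    covers i = proj₂ (proj₂ (proj₂ (split i)))
    φ : ExpV (2 + ρ) F → Fin n
    φ (inj₁ v)       = c v
    φ (inj₂ (i , k)) = new i k
    not-core : ∀ i k v → new i k ≢ c v
    not-core i k v eq with core i v (subst (_∈ˢ E i) eq (proj₁ (new∈ i k)))
    ... | inj₁ refl = proj₁ (proj₂ (new∈ i k)) eq
    ... | inj₂ refl = proj₂ (proj₂ (new∈ i k)) eq
    inj : ∀ {x y} → φ x ≡ φ y → x ≡ y
    inj {inj₁ u}       {inj₁ v}       eq = cong inj₁ (c-inj u v eq)
    inj {inj₁ u}       {inj₂ (j , k)} eq = contradiction (sym eq) (not-core j k u)
    inj {inj₂ (i , k)} {inj₁ v}       eq = contradiction eq (not-core i k v)
    inj {inj₂ (i , k)} {inj₂ (j , l)} eq with i Fin.≟ j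
    ... | yes refl = cong (λ z → inj₂ (i , z)) (new-inj i k l eq)
    ... | no i≢j with shared i j (new i k) i≢j (proj₁ (new∈ i k)) (subst (_∈ˢ E j) (sym eq) (proj₁ (new∈ j l)))
    ...   | v , eq′ = contradiction eq′ (not-core i k v)

concatMap-unique : {A B : Set} (f : A → List B) {xs : List A} → Unique xs → (∀ x → Unique (f x)) →
  (∀ x y → x ≢ y → ∀ z → z ∈ f x → z ∈ f y → ⊥) → Unique (concatMap f xs)
concatMap-unique f u uf disj = UniqueP.concat⁺ (AllP.map⁺ (All.tabulate (λ {x} _ → uf x)))
  (AllPairsP.map⁺ (AllPairs.map (λ {x} {y} x≢y {_} (p , q) → disj x y x≢y _ p q) u))

module _ (m : ℕ) where

  private
    cell : Fin m → Fin m → List (Fin m × Fin m)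
    cell i j = if toℕ i <ᵇ toℕ j then (i , j) ∷ [] else []

    row : Fin m → List (Fin m × Fin m)
    row i = concatMap (cell i) (allFin m)

    cell⁻ : ∀ i j p → p ∈ cell i j → p ≡ (i , j) × toℕ i < toℕ j
    cell⁻ i j p p∈ with toℕ i <ᵇ toℕ j in eq
    cell⁻ i j p (here refl) | true = refl , <ᵇ⇒< (toℕ i) (toℕ j) (≡⇒T eq)

    row⁻ : ∀ i p → p ∈ row i → proj₁ p ≡ i × toℕ (proj₁ p) < toℕ (proj₂ p)
    row⁻ i p p∈ with find (Mem.∈-concatMap⁻ (cell i) {xs = allFin m} p∈)
    ... | j , _ , q with cell⁻ i j p q
    ...   | refl , lt = refl , lt

  Kgraph-edge⁻ : ∀ p → p ∈ edges (Kgraph m) → toℕ (proj₁ p) < toℕ (proj₂ p)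
  Kgraph-edge⁻ p p∈ with find (Mem.∈-concatMap⁻ row {xs = allFin m} p∈)
  ... | i , _ , q = proj₂ (row⁻ i p q)

  Kgraph-edge⁺ : ∀ i j → toℕ i < toℕ j → (i , j) ∈ edges (Kgraph m)
  Kgraph-edge⁺ i j lt = Mem.∈-concatMap⁺ row {xs = allFin m}
    (lose (Mem.∈-allFin i) (Mem.∈-concatMap⁺ (cell i) {xs = allFin m} (lose (Mem.∈-allFin j) in-cell)))
    where
    in-cell : (i , j) ∈ cell i j
    in-cell rewrite <ᵇ-true lt = here refl

  Kgraph-unique : Unique (edges (Kgraph m))
  Kgraph-unique = concatMap-unique row (UniqueP.allFin⁺ m)
    (λ i → concatMap-unique (cell i) (UniqueP.allFin⁺ m) (cell-unique i)
             (λ { j j′ j≢j′ z p q → j≢j′ (cong proj₂ (trans (sym (proj₁ (cell⁻ i j z p))) (proj₁ (cell⁻ i j′ z q)))) }))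
    (λ i i′ i≢i′ z p q → i≢i′ (trans (sym (proj₁ (row⁻ i z p))) (proj₁ (row⁻ i′ z q))))
    where
    cell-unique : ∀ i j → Unique (cell i j)
    cell-unique i j with toℕ i <ᵇ toℕ j
    ... | true  = [] ∷ []
    ... | false = []

-- Bounds the vertices to be avoided when K_{k+2}^{(r)+} is embedded greedily:
-- the core, one given edge, and the edges chosen for the other pairs.
embedBound : (r k : ℕ) → ℕ
embedBound r k = 2 + k + r + length (edges (Kgraph (2 + k))) * r

-- Greedy embedding of an expanded clique around one given edge

module CliqueEmbedding {n ρ : ℕ} (H : List (Subset n)) (sizes : ∀ e → e ∈ H → ∣ e ∣ ≡ 2 + ρ) (L : ℕ) where

  open Pairs H L

  module Core {k} (c : Fin (2 + k) → Fin n) (c-inj : ∀ i j → c i ≡ c j → i ≡ j)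
              (e₀ : Subset n) (e₀∈ : e₀ ∈ H) (c0∈ : c zero ∈ˢ e₀) (c1∈ : c (suc zero) ∈ˢ e₀)
              (others∉ : ∀ i → c (suc (suc i)) ∉ˢ e₀) where

    Pair : Set
    Pair = Fin (2 + k) × Fin (2 + k)

    Special : Pair → Set
    Special p = proj₁ p ≡ zero × proj₂ p ≡ suc zero

    special? : ∀ p → Dec (Special p)
    special? p = (proj₁ p Fin.≟ zero) ×-dec (proj₂ p Fin.≟ suc zero)

    -- `F` holds the vertices already in use. The first alternative in `avoid` exempts the given
    -- edge `e₀`, which lies inside `F` from the start.
    record Chosen (ps : List Pair) (F : List (Fin n)) : Set where
      field
        E     : Fin (length ps) → Subset n
        E∈    : ∀ i → E i ∈ H
        l∈    : ∀ i → c (proj₁ (lookup ps i)) ∈ˢ E i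
        r∈    : ∀ i → c (proj₂ (lookup ps i)) ∈ˢ E i
        avoid : ∀ i x → x ∈ˢ E i → x ∈ F →
                (E i ≡ e₀ × Special (lookup ps i)) ⊎ (x ≡ c (proj₁ (lookup ps i)) ⊎ x ≡ c (proj₂ (lookup ps i)))
        meet  : ∀ i j x → i ≢ j → x ∈ˢ E i → x ∈ˢ E j → ∃ λ v → x ≡ c v

    -- Each pair that is not special receives an edge avoiding `F` outside its ends, and the
    -- vertices of that edge join `F`. The length bound reserves `2 + ρ` vertices for every pair
    -- still to come.
    choose : ∀ ps F → Unique ps →
      (∀ p → p ∈ ps → Special p ⊎ ¬ Bad (c (proj₁ p)) (c (proj₂ p))) →
      (∀ x → x ∈ˢ e₀ → x ∈ F) → length F + length ps * (2 + ρ) ≤ L → Chosen ps F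
    choose [] F _ _ _ _ = record { E = λ () ; E∈ = λ () ; l∈ = λ () ; r∈ = λ () ; avoid = λ () ; meet = λ () }
    choose (p ∷ ps) F (p∉ ∷ u) good e₀⊆F bound with special? p
    ... | yes (refl , refl) = record
        { E = E′ ; E∈ = λ { zero → e₀∈ ; (suc i) → E∈ i }
        ; l∈ = λ { zero → c0∈ ; (suc i) → l∈ i } ; r∈ = λ { zero → c1∈ ; (suc i) → r∈ i }
        ; avoid = λ { zero x _ _ → inj₁ (refl , refl , refl) ; (suc i) → avoid i }
        ; meet = λ { zero zero x i≢ → contradiction refl i≢
                   ; zero (suc j) x _ x∈ x∈′ → first j x x∈′ x∈
                   ; (suc i) zero x _ x∈ x∈′ → first i x x∈ x∈′
                   ; (suc i) (suc j) x i≢j → meet i j x (λ eq → i≢j (cong suc eq)) } }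
      where
      rest = choose ps F u (λ q q∈ → good q (there q∈)) e₀⊆F
               (≤-trans (+-monoʳ-≤ (length F) (m≤n+m _ (2 + ρ))) bound)
      open Chosen rest
      E′ : Fin (suc (length ps)) → Subset n
      E′ zero    = e₀
      E′ (suc i) = E i
      first : ∀ i x → x ∈ˢ E i → x ∈ˢ e₀ → ∃ λ v → x ≡ c v
      first i x x∈ x∈e₀ with avoid i x x∈ (e₀⊆F x x∈e₀)
      ... | inj₂ (inj₁ eq) = _ , eq
      ... | inj₂ (inj₂ eq) = _ , eq
      -- The pairs are distinct, so no later pair is special as well.
      ... | inj₁ (_ , (sp₁ , sp₂)) =
        contradiction (sym (cong₂ _,_ sp₁ sp₂)) (All.lookup p∉ (Mem.∈-lookup i))
    ... | no ¬sp with good p (here refl)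
    ...   | inj₁ sp = contradiction sp ¬sp
    ...   | inj₂ ¬bad with avoiding-edge ¬bad F (≤-trans (m≤m+n _ _) bound)
    ...     | e , e∈ , l , r , av = record
        { E = E′ ; E∈ = λ { zero → e∈ ; (suc i) → E∈ i }
        ; l∈ = λ { zero → l ; (suc i) → l∈ i } ; r∈ = λ { zero → r ; (suc i) → r∈ i }
        ; avoid = λ { zero x x∈ x∈F → inj₂ (av x x∈F x∈) ; (suc i) x x∈ x∈F → avoid i x x∈ (Mem.∈-++⁺ˡ x∈F) }
        ; meet = λ { zero zero x i≢ → contradiction refl i≢
                   ; zero (suc j) x _ x∈ x∈′ → first j x x∈′ x∈
                   ; (suc i) zero x _ x∈ x∈′ → first i x x∈ x∈′
                   ; (suc i) (suc j) x i≢j → meet i j x (λ eq → i≢j (cong suc eq)) } }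
      where
      bound′ : length (F ++ elems e) + length ps * (2 + ρ) ≤ L
      bound′ = ≤-trans (≤-reflexive (trans
        (cong (_+ length ps * (2 + ρ)) (trans (ListP.length-++ F) (cong (length F +_) (trans (length-elems e) (sizes e e∈)))))
        (+-assoc (length F) (2 + ρ) _))) bound
      rest = choose ps (F ++ elems e) u (λ q q∈ → good q (there q∈)) (λ x x∈ → Mem.∈-++⁺ˡ (e₀⊆F x x∈)) bound′
      open Chosen rest
      E′ : Fin (suc (length ps)) → Subset n
      E′ zero    = e
      E′ (suc i) = E i
      first : ∀ i x → x ∈ˢ E i → x ∈ˢ e → ∃ λ v → x ≡ c v
      first i x x∈ x∈e with avoid i x x∈ (Mem.∈-++⁺ʳ F (∈-elems⁺ e x∈e))
      ... | inj₂ (inj₁ eq) = _ , eq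
      ... | inj₂ (inj₂ eq) = _ , eq
      -- A later edge may be `e₀` itself; its vertices belong to `F`, which `e` meets only in its
      -- ends.
      ... | inj₁ (Ei≡e₀ , _) with av x (e₀⊆F x (subst (x ∈ˢ_) Ei≡e₀ x∈)) x∈e
      ...   | inj₁ eq = _ , eq
      ...   | inj₂ eq = _ , eq

    embed : embedBound (2 + ρ) k ≤ L →
      (∀ i j → toℕ i < toℕ j → (i ≡ zero × j ≡ suc zero) ⊎ ¬ Bad (c i) (c j)) →
      ContainsExp (2 + ρ) n (Kgraph (2 + k)) H
    embed bound good = containsExp c c-inj E E∈ (λ i → sizes (E i) (E∈ i))
      (λ i eq → <-irrefl (cong toℕ eq) (Kgraph-edge⁻ (2 + k) _ (Mem.∈-lookup i))) l∈ r∈ core meet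
      where
      core-list = map c (allFin (2 + k))
      F = core-list ++ elems e₀
      ps = edges (Kgraph (2 + k))
      len-F : length F ≡ 2 + k + (2 + ρ)
      len-F = trans (ListP.length-++ core-list) (cong₂ _+_
        (trans (ListP.length-map c (allFin (2 + k))) (ListP.length-tabulate {n = 2 + k} id))
        (trans (length-elems e₀) (sizes e₀ e₀∈)))
      open Chosen (choose ps F (Kgraph-unique (2 + k)) (λ p p∈ → good (proj₁ p) (proj₂ p) (Kgraph-edge⁻ (2 + k) p p∈))
        (λ x x∈ → Mem.∈-++⁺ʳ core-list (∈-elems⁺ e₀ x∈))
        (≤-trans (≤-reflexive (cong (_+ length ps * (2 + ρ)) len-F)) bound))
      in-e₀ : ∀ v → c v ∈ˢ e₀ → v ≡ zero ⊎ v ≡ suc zero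
      in-e₀ zero          _  = inj₁ refl
      in-e₀ (suc zero)    _  = inj₂ refl
      in-e₀ (suc (suc i)) v∈ = contradiction v∈ (others∉ i)
      core : ∀ i v → c v ∈ˢ E i → v ≡ proj₁ (lookup ps i) ⊎ v ≡ proj₂ (lookup ps i)
      core i v v∈ with avoid i (c v) v∈ (Mem.∈-++⁺ˡ (Mem.∈-map⁺ c (Mem.∈-allFin v)))
      ... | inj₂ (inj₁ eq) = inj₁ (c-inj _ _ eq)
      ... | inj₂ (inj₂ eq) = inj₂ (c-inj _ _ eq)
      ... | inj₁ (Ei≡e₀ , s₁ , s₂) with in-e₀ v (subst (c v ∈ˢ_) Ei≡e₀ v∈)
      ...   | inj₁ eq = inj₁ (trans eq (sym s₁))
      ...   | inj₂ eq = inj₂ (trans eq (sym s₂))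

  -- x and y are adjacent when they can serve as two core vertices whatever the
  -- rest of the greedy embedding uses.
  Adj : Fin n → Fin n → Set
  Adj x y = x ≢ y × ¬ Bad x y

  adj? : ∀ x y → Dec (Adj x y)
  adj? x y = ¬? (x Fin.≟ y) ×-dec ¬? (bad? x y)

  adj-sym : ∀ {x y} → Adj x y → Adj y x
  adj-sym (x≢y , ¬bad) = (λ eq → x≢y (sym eq)) , λ b → ¬bad (bad-sym b)

  -- The edge `e` itself serves for the pair `a`, `b`, and only the other pairs rely on adjacency.
  -- This turns a single misplaced edge into a forbidden expansion.
  embed-clique : ∀ a b ys e → e ∈ H → a ∈ˢ e → b ∈ˢ e → a ≢ b → (∀ y → y ∈ ys → y ∉ˢ e) →
    AllPairs Adj ys → (∀ y → y ∈ ys → Adj a y) → (∀ y → y ∈ ys → Adj b y) →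
    embedBound (2 + ρ) (length ys) ≤ L → ContainsExp (2 + ρ) n (Kgraph (2 + length ys)) H
  embed-clique a b ys e e∈ a∈ b∈ a≢b ys∉ ap aa ab bound =
    Core.embed (lookup (a ∷ b ∷ ys)) (lookup-injective uniq) e e∈ a∈ b∈ (λ i → ys∉ _ (Mem.∈-lookup i)) bound good
    where
    uniq : Unique (a ∷ b ∷ ys)
    uniq = (a≢b ∷ All.tabulate (λ y∈ → proj₁ (aa _ y∈))) ∷ All.tabulate (λ y∈ → proj₁ (ab _ y∈)) ∷ AllPairs.map proj₁ ap
    pairs : ∀ {ys} → AllPairs Adj ys → ∀ i j → toℕ i < toℕ j → Adj (lookup ys i) (lookup ys j)
    pairs (h ∷ _)  zero    (suc j) _       = All.lookup h (Mem.∈-lookup j)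
    pairs (_ ∷ ap) (suc i) (suc j) (s≤s p) = pairs ap i j p
    good : ∀ i j → toℕ i < toℕ j →
           (i ≡ zero × j ≡ suc zero) ⊎ ¬ Bad (lookup (a ∷ b ∷ ys) i) (lookup (a ∷ b ∷ ys) j)
    good zero          (suc zero)    _             = inj₁ (refl , refl)
    good zero          (suc (suc j)) _             = inj₂ (proj₂ (aa _ (Mem.∈-lookup j)))
    good (suc zero)    (suc (suc j)) _             = inj₂ (proj₂ (ab _ (Mem.∈-lookup j)))
    good (suc zero)    (suc zero)    (s≤s ())
    good (suc (suc i)) (suc zero)    (s≤s ())
    good (suc (suc i)) (suc (suc j)) (s≤s (s≤s p)) = inj₂ (proj₂ (pairs ap i j p))

module _ {n ρ : ℕ} {H : List (Subset n)} where

  -- Two vertices of each edge serve as the ends of a matching edge; disjointness makes every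
  -- condition of `containsExp` hold.
  containsMatching : ∀ m (E : Fin m → Subset n) → (∀ i → E i ∈ H) → (∀ i → ∣ E i ∣ ≡ 2 + ρ) →
    (∀ i j x → x ∈ˢ E i → x ∈ˢ E j → i ≡ j) → ContainsExp (2 + ρ) n (Mgraph m) H
  containsMatching m E E∈ sizes disj = containsExp {F = Mgraph m} c c-inj (λ i → E (ix i)) (λ i → E∈ (ix i)) (λ i → sizes (ix i))
    (λ i eq → contradiction (trans (sym (cong proj₂ (left≡ i))) (trans (cong proj₂ eq) (cong proj₂ (right≡ i)))) λ ())
    (λ i → subst (λ v → c v ∈ˢ E (ix i)) (sym (left≡ i)) (c∈ (ix i , false)))
    (λ i → subst (λ v → c v ∈ˢ E (ix i)) (sym (right≡ i)) (c∈ (ix i , true)))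
    core (λ i j x i≢j x∈ x∈′ → contradiction (ix-inj i j (disj _ _ x x∈ x∈′)) i≢j)
    where
    pair = λ i → enumerate (elems (E i)) (elems-unique (E i)) (trans (length-elems (E i)) (sizes i))
    c : Fin m × Bool → Fin n
    c (i , false) = proj₁ (pair i) zero
    c (i , true)  = proj₁ (pair i) (suc zero)
    c∈ : ∀ v → c v ∈ˢ E (proj₁ v)
    c∈ (i , false) = ∈-elems⁻ (E i) (proj₁ (proj₂ (proj₂ (pair i))) zero)
    c∈ (i , true)  = ∈-elems⁻ (E i) (proj₁ (proj₂ (proj₂ (pair i))) (suc zero))
    c-inj : ∀ u v → c u ≡ c v → u ≡ v
    c-inj u v eq with disj (proj₁ u) (proj₁ v) (c u) (c∈ u) (subst (_∈ˢ E (proj₁ v)) (sym eq) (c∈ v))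
    c-inj (i , false) (_ , false) eq | refl = refl
    c-inj (i , true)  (_ , true)  eq | refl = refl
    c-inj (i , false) (_ , true)  eq | refl = contradiction (proj₁ (proj₂ (pair i)) zero (suc zero) eq) λ ()
    c-inj (i , true)  (_ , false) eq | refl = contradiction (proj₁ (proj₂ (pair i)) (suc zero) zero eq) λ ()
    g : Fin m → (Fin m × Bool) × (Fin m × Bool)
    g i = (i , false) , (i , true)
    es = map g (allFin m)
    ix : Fin (length es) → Fin m
    ix i = proj₁ (proj₁ (lookup es i))
    entry : ∀ i → lookup es i ≡ g (ix i)
    entry i with Mem.∈-map⁻ g (Mem.∈-lookup {xs = es} i)
    ... | j , _ , eq = trans eq (cong g (sym (cong (λ p → proj₁ (proj₁ p)) eq)))
    left≡ : ∀ i → proj₁ (lookup es i) ≡ (ix i , false)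
    left≡ i = cong proj₁ (entry i)
    right≡ : ∀ i → proj₂ (lookup es i) ≡ (ix i , true)
    right≡ i = cong proj₂ (entry i)
    ix-inj : ∀ i j → ix i ≡ ix j → i ≡ j
    ix-inj i j eq = lookup-injective (UniqueP.map⁺ (cong (λ p → proj₁ (proj₁ p))) (UniqueP.allFin⁺ m)) i j
      (trans (entry i) (trans (cong g eq) (sym (entry j))))
    core : ∀ i v → c v ∈ˢ E (ix i) → v ≡ proj₁ (lookup es i) ⊎ v ≡ proj₂ (lookup es i)
    core i v v∈ with disj (ix i) (proj₁ v) (c v) v∈ (c∈ v)
    core i (_ , false) v∈ | refl = inj₁ (sym (left≡ i))
    core i (_ , true)  v∈ | refl = inj₂ (sym (right≡ i))

-- Stability

Unique-++⁻ : {A : Set} (xs : List A) {ys : List A} → Unique (xs ++ ys) →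
  Unique xs × Unique ys × (∀ x y → x ∈ xs → y ∈ ys → x ≢ y)
Unique-++⁻ []       u        = [] , u , (λ _ _ ())
Unique-++⁻ (x ∷ xs) (x∉ ∷ u) with Unique-++⁻ xs u
... | uxs , uys , d = AllP.++⁻ˡ xs x∉ ∷ uxs , uys ,
  λ { _ y (here refl) y∈ → All.lookup (AllP.++⁻ʳ xs x∉) y∈ ; z y (there z∈) y∈ → d z y z∈ y∈ }

PairIn : ∀ {n} → (Fin n → Fin n → Set) → (xs ys : List (Fin n)) → Subset n → Set
PairIn R xs ys e = Any (λ x → Any (λ y → R x y × x ∈ˢ e × y ∈ˢ e) ys) xs

pairIn? : ∀ {n} {R : Fin n → Fin n → Set} → (∀ x y → Dec (R x y)) → ∀ xs ys (e : Subset n) → Dec (PairIn R xs ys e)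
pairIn? R? xs ys e = any? (λ x → any? (λ y → R? x y ×-dec ((x ∈ᵉ? e) ×-dec (y ∈ᵉ? e))) ys) xs

pairIn : ∀ {n} {R : Fin n → Fin n → Set} {xs ys} {e : Subset n} {x y} → x ∈ xs → y ∈ ys → R x y →
         x ∈ˢ e → y ∈ˢ e → PairIn R xs ys e
pairIn x∈ y∈ r x∈e y∈e = lose x∈ (lose y∈ (r , x∈e , y∈e))

#-pairIn : ∀ {n} {R : Fin n → Fin n → Set} (R? : ∀ x y → Dec (R x y)) {Q : Subset n → Set} (Q? : ∀ e → Dec (Q e))
  (H : List (Subset n)) xs ys c →
  (∀ x y → x ∈ xs → y ∈ ys → R x y → (# (λ e → Q? e ×-dec ((x ∈ᵉ? e) ×-dec (y ∈ᵉ? e)))) H ≤ c) →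
  (# (λ e → Q? e ×-dec pairIn? R? xs ys e)) H ≤ length xs * (length ys * c)
#-pairIn {n} {R} R? {Q} Q? H xs ys c h = ≤-trans
  (#-hit (λ e → Q? e ×-dec pairIn? R? xs ys e) row? H xs (λ { e _ (q , a) → let (x , x∈ , b) = find a in x , x∈ , q , b }))
  (∑-bound xs _ λ x x∈ → ≤-trans
    (#-hit (row? x) (cell? x) H ys (λ { e _ (q , b) → let (y , y∈ , r , p) = find b in y , y∈ , r , q , p }))
    (∑-bound ys _ λ y y∈ → bound x y x∈ y∈ (R? x y)))
  where
  row? : ∀ x e → Dec (Q e × Any (λ y → R x y × x ∈ˢ e × y ∈ˢ e) ys)
  row? x e = Q? e ×-dec any? (λ y → R? x y ×-dec ((x ∈ᵉ? e) ×-dec (y ∈ᵉ? e))) ys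
  cell? : ∀ x y e → Dec (R x y × Q e × x ∈ˢ e × y ∈ˢ e)
  cell? x y e = R? x y ×-dec (Q? e ×-dec ((x ∈ᵉ? e) ×-dec (y ∈ᵉ? e)))
  bound : ∀ x y → x ∈ xs → y ∈ ys → Dec (R x y) → (# (cell? x y)) H ≤ c
  bound x y x∈ y∈ (yes r) = ≤-trans (#-mono (cell? x y) (λ e → Q? e ×-dec ((x ∈ᵉ? e) ×-dec (y ∈ᵉ? e))) H (λ _ _ → proj₂))
                                    (h x y x∈ y∈ r)
  bound x y x∈ y∈ (no ¬r) = ≤-trans (≤-reflexive (#-none (cell? x y) H (λ _ _ p → ¬r (proj₁ p)))) z≤n

-- Edge counts in terms of the adjacency graph

-- The present vertices are two lists inside `Fin n`, because the progressive induction deletes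
-- vertices one by one. `ws` is the set W, and edges that miss it have been removed. The threshold
-- `L` is a field so that it keeps its value under deletion.
record Setup (n ρ k′ : ℕ) : Set where
  field
    H      : List (Subset n)
    ws vs  : List (Fin n)
    L      : ℕ
    uniqH  : Unique H
    uact   : Unique (ws ++ vs)
    sizes  : ∀ e → e ∈ H → ∣ e ∣ ≡ 3 + ρ
    H⊆     : ∀ e → e ∈ H → ∀ x → x ∈ˢ e → x ∈ ws ++ vs
    meets  : ∀ e → e ∈ H → ∃ λ w → w ∈ ws × w ∈ˢ e
    L≥     : embedBound (3 + ρ) (suc k′) ≤ L
    free   : ¬ ContainsExp (3 + ρ) n (Kgraph (3 + k′)) H

module Setting {n ρ k′ : ℕ} (S : Setup n ρ k′) where

  open Setup S public
  open Pairs H L public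
  open CliqueEmbedding {ρ = suc ρ} H sizes L public using (Adj; adj?; adj-sym; embed-clique)

  k s m N : ℕ
  k = suc k′
  s = length ws
  m = length vs
  N = length (ws ++ vs)

  N≡s+m : N ≡ s + m
  N≡s+m = ListP.length-++ ws

  m≤N : m ≤ N
  m≤N = ≤-trans (m≤n+m m s) (≤-reflexive (sym N≡s+m))

  ws-unique : Unique ws
  ws-unique = proj₁ (Unique-++⁻ ws uact)

  vs-unique : Unique vs
  vs-unique = proj₁ (proj₂ (Unique-++⁻ ws uact))

  w≢v : ∀ w v → w ∈ ws → v ∈ vs → w ≢ v
  w≢v = proj₂ (proj₂ (Unique-++⁻ ws uact))

  no-clique : ∀ a b ys e → e ∈ H → a ∈ˢ e → b ∈ˢ e → a ≢ b → (∀ y → y ∈ ys → y ∉ˢ e) →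
    AllPairs Adj ys → (∀ y → y ∈ ys → Adj a y) → (∀ y → y ∈ ys → Adj b y) → length ys ≡ k → ⊥
  no-clique a b ys e e∈ a∈ b∈ a≢b ys∉ ap aa ab len = free
    (subst (λ l → ContainsExp (3 + ρ) n (Kgraph (2 + l)) H) len
      (embed-clique a b ys e e∈ a∈ b∈ a≢b ys∉ ap aa ab (subst (λ l → embedBound (3 + ρ) l ≤ L) (sym len) L≥)))

  -- For an adjacent pair there is an edge through both ends that avoids the rest of the core, as
  -- `no-clique` demands.
  no-adj-clique : ∀ a b ys → Adj a b → AllPairs Adj ys → (∀ y → y ∈ ys → Adj a y) → (∀ y → y ∈ ys → Adj b y) →
    length ys ≡ k → ⊥
  no-adj-clique a b ys (a≢b , ¬bad) ap aa ab len with avoiding-edge ¬bad ys k≤L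
    where
    k≤L : length ys ≤ L
    k≤L = ≤-trans (≤-reflexive len) (≤-trans (m≤n+m k 2) (≤-trans (m≤m+n (2 + k) (3 + ρ)) (≤-trans (m≤m+n (2 + k + (3 + ρ)) _) L≥)))
  ... | e , e∈ , a∈ , b∈ , av = no-clique a b ys e e∈ a∈ b∈ a≢b
    (λ y y∈ y∈e → [ (λ eq → proj₁ (aa y y∈) (sym eq)) , (λ eq → proj₁ (ab y y∈) (sym eq)) ]′ (av y y∈ y∈e))
    ap aa ab len

  codegree : ∀ J p → Unique J → length J + p ≡ 3 + ρ → (# (λ e → all? (_∈ᵉ? e) J)) H ≤ N ^ p
  codegree J p uJ eq with all? (_∈ˡ? (ws ++ vs)) J
  ... | yes J⊆ = #link≤power uniqH (ws ++ vs) uact J p uJ (λ x x∈ → All.lookup J⊆ x∈) H⊆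
                   (λ e e∈ → trans (sizes e e∈) (sym eq))
  ... | no ¬J⊆ = ≤-trans (≤-reflexive (#-none (λ e → all? (_∈ᵉ? e) J) H
                   (λ e e∈ a → ¬J⊆ (All.map (λ {x} → H⊆ e e∈ x) a)))) z≤n

  codegree₂ : ∀ x y → x ≢ y → (# (λ e → (x ∈ᵉ? e) ×-dec (y ∈ᵉ? e))) H ≤ N ^ (1 + ρ)
  codegree₂ x y x≢y = ≤-trans
    (#-mono (λ e → (x ∈ᵉ? e) ×-dec (y ∈ᵉ? e)) (λ e → all? (_∈ᵉ? e) (x ∷ y ∷ [])) H (λ { _ _ (a , b) → a ∷ b ∷ [] }))
    (codegree (x ∷ y ∷ []) (1 + ρ) ((x≢y ∷ []) ∷ [] ∷ []) refl)

  codegree₃ : ∀ x y z → x ≢ y → x ≢ z → y ≢ z → (# (λ e → all? (_∈ᵉ? e) (x ∷ y ∷ z ∷ []))) H ≤ N ^ ρ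
  codegree₃ x y z x≢y x≢z y≢z = codegree (x ∷ y ∷ z ∷ []) ρ ((x≢y ∷ x≢z ∷ []) ∷ (y≢z ∷ []) ∷ [] ∷ []) refl

  -- Each edge through a bad pair contains one of at most `L` further vertices, so the trivial bound
  -- improves by a factor `N / L`.
  codegree-bad : ∀ x y → x ≢ y → Bad x y → (# (λ e → (x ∈ᵉ? e) ×-dec (y ∈ᵉ? e))) H ≤ L * N ^ ρ
  codegree-bad x y x≢y bad = #-bad bad (N ^ ρ)
    (λ f f≢x f≢y → codegree₃ x y f x≢y (λ eq → f≢x (sym eq)) (λ eq → f≢y (sym eq)))

  ≢? : ∀ (x y : Fin n) → Dec (x ≢ y)
  ≢? x y = ¬? (x Fin.≟ y)

  TwoW BadWV BadVV NonClique : Subset n → Set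
  TwoW = PairIn _≢_ ws ws
  BadWV = PairIn Bad ws vs
  BadVV = PairIn (λ x y → x ≢ y × Bad x y) vs vs
  NonClique e = TwoW e ⊎ BadWV e ⊎ BadVV e

  twoW? : ∀ e → Dec (TwoW e)
  twoW? = pairIn? ≢? ws ws
  badWV? : ∀ e → Dec (BadWV e)
  badWV? = pairIn? bad? ws vs
  badVV? : ∀ e → Dec (BadVV e)
  badVV? = pairIn? (λ x y → ≢? x y ×-dec bad? x y) vs vs
  nonClique? : ∀ e → Dec (NonClique e)
  nonClique? e = twoW? e ⊎-dec (badWV? e ⊎-dec badVV? e)

  #-pairs : ∀ {R : Fin n → Fin n → Set} (R? : ∀ x y → Dec (R x y)) xs ys c →
    (∀ x y → x ∈ xs → y ∈ ys → R x y → (# (λ e → (x ∈ᵉ? e) ×-dec (y ∈ᵉ? e))) H ≤ c) →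
    (# (pairIn? R? xs ys)) H ≤ length xs * (length ys * c)
  #-pairs R? xs ys c h = ≤-trans
    (#-mono (pairIn? R? xs ys) (λ e → yes tt ×-dec pairIn? R? xs ys e) H (λ _ _ p → tt , p))
    (#-pairIn R? (λ _ → yes tt) H xs ys c (λ x y x∈ y∈ r → ≤-trans
      (#-mono (λ e → yes tt ×-dec ((x ∈ᵉ? e) ×-dec (y ∈ᵉ? e))) (λ e → (x ∈ᵉ? e) ×-dec (y ∈ᵉ? e)) H (λ _ _ → proj₂))
      (h x y x∈ y∈ r)))

  #twoW : (# twoW?) H ≤ s * (s * N ^ (1 + ρ))
  #twoW = #-pairs ≢? ws ws _ (λ x y _ _ → codegree₂ x y)

  #badWV : (# badWV?) H ≤ s * (m * (L * N ^ ρ))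
  #badWV = #-pairs bad? ws vs _ (λ x y x∈ y∈ → codegree-bad x y (w≢v x y x∈ y∈))

  #badVV : (# badVV?) H ≤ m * (m * (L * N ^ ρ))
  #badVV = #-pairs (λ x y → ≢? x y ×-dec bad? x y) vs vs _ (λ { x y _ _ (x≢y , b) → codegree-bad x y x≢y b })

  -- Pairs that meet `ws` contribute a lower order once `N` exceeds `s * s + s * L`; the bad pairs
  -- outside `ws` give the main term. The factor `suc L` is free of `s`, whereas the extremal number
  -- is proportional to `s`.
  #nonClique : s * s + s * L ≤ N → (# nonClique?) H ≤ suc L * N ^ (2 + ρ)
  #nonClique small = begin
    (# nonClique?) H
      ≤⟨ ≤-trans (#-⊎ nonClique? twoW? (λ e → badWV? e ⊎-dec badVV? e) H (λ _ _ → id))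
                 (+-monoʳ-≤ _ (#-⊎ (λ e → badWV? e ⊎-dec badVV? e) badWV? badVV? H (λ _ _ → id))) ⟩
    (# twoW?) H + ((# badWV?) H + (# badVV?) H)
      ≤⟨ +-mono-≤ #twoW (+-mono-≤ (≤-trans #badWV (*-monoʳ-≤ s (*-monoˡ-≤ _ m≤N)))
                                  (≤-trans #badVV (*-mono-≤ m≤N (*-monoˡ-≤ _ m≤N)))) ⟩
    s * (s * (N * P)) + (s * (N * (L * P)) + N * (N * (L * P)))
      ≡⟨ eq₁ s N L P ⟩
    (s * s + s * L) * (N * P) + L * (N * (N * P))
      ≤⟨ +-monoˡ-≤ (L * (N * (N * P))) (*-monoˡ-≤ (N * P) small) ⟩
    N * (N * P) + L * (N * (N * P)) ∎
    where
    open ≤-Reasoning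
    P = N ^ ρ
    eq₁ : ∀ s N L P → s * (s * (N * P)) + (s * (N * (L * P)) + N * (N * (L * P)))
                    ≡ (s * s + s * L) * (N * P) + L * (N * (N * P))
    eq₁ = solve-∀

  clique-link : ∀ {e w x} → e ∈ H → ¬ TwoW e → w ∈ ws → w ∈ˢ e → x ∈ˢ e → x ≡ w ⊎ x ∈ vs
  clique-link {e} {w} {x} e∈ ¬two w∈ w∈e x∈e with Mem.∈-++⁻ ws (H⊆ e e∈ x x∈e)
  ... | inj₂ x∈vs = inj₂ x∈vs
  ... | inj₁ x∈ws with x Fin.≟ w
  ...   | yes eq = inj₁ eq
  ...   | no x≢w = ⊥-elim (¬two (pairIn x∈ws w∈ x≢w x∈e w∈e))

  adj-WV : ∀ {e w v} → ¬ BadWV e → w ∈ ws → v ∈ vs → w ∈ˢ e → v ∈ˢ e → Adj w v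
  adj-WV ¬b w∈ v∈ w∈e v∈e = w≢v _ _ w∈ v∈ , λ bad → ¬b (pairIn w∈ v∈ bad w∈e v∈e)

  adj-VV : ∀ {e x y} → ¬ BadVV e → x ∈ vs → y ∈ vs → x ≢ y → x ∈ˢ e → y ∈ˢ e → Adj x y
  adj-VV ¬b x∈ y∈ x≢y x∈e y∈e = x≢y , λ bad → ¬b (pairIn x∈ y∈ (x≢y , bad) x∈e y∈e)

  neighbours : Fin n → List (Fin n)
  neighbours x = filter (adj? x) vs

  nonAdj : Fin n → ℕ
  nonAdj x = (# (λ y → ¬? (adj? x y))) vs

  neighbours+nonAdj : ∀ x → length (neighbours x) + nonAdj x ≡ m
  neighbours+nonAdj x = trans (cong (_+ nonAdj x) (length-filter≡# (adj? x) vs)) (#-complement (adj? x) vs)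

  neighbours-unique : ∀ x → Unique (neighbours x)
  neighbours-unique x = UniqueP.filter⁺ (adj? x) vs-unique

  ∈-neighbours⁻ : ∀ {x y} → y ∈ neighbours x → y ∈ vs × Adj x y
  ∈-neighbours⁻ {x} = Mem.∈-filter⁻ (adj? x) {xs = vs}

  -- A clique of `suc k` vertices among the neighbours of `w` would together with `w` be `k + 2`
  -- pairwise adjacent vertices, so Zykov's bound applies with `k` parts.
  cliques-at-w : ∀ w → w ∈ ws → (# (λ e → (w ∈ᵉ? e) ×-dec ¬? (nonClique? e))) H ≤ turán (2 + ρ) k (length (neighbours w))
  cliques-at-w w w∈ = ≤-trans
    (#link≤cliques adj? uniqH (2 + ρ) (λ e → (w ∈ᵉ? e) ×-dec ¬? (nonClique? e)) (w ∷ []) (neighbours w)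
      (All.tabulate (λ x∈ → w≢v _ _ w∈ (proj₁ (∈-neighbours⁻ x∈))) ∷ neighbours-unique w)
      (λ { e e∈ (w∈e , ¬nc) → (λ { x (here refl) → w∈e })
         , (λ x x∈e → [ (λ { refl → here refl })
                      , (λ x∈vs → there (Mem.∈-filter⁺ (adj? w) x∈vs (adj-WV (λ b → ¬nc (inj₂ (inj₁ b))) w∈ x∈vs w∈e x∈e))) ]′
                      (clique-link e∈ (λ t → ¬nc (inj₁ t)) w∈ w∈e x∈e))
         , sizes e e∈ })
      (λ { e e∈ (w∈e , ¬nc) x y x∈ y∈ x≢y → adj-VV (λ b → ¬nc (inj₂ (inj₂ b)))
             (proj₁ (∈-neighbours⁻ x∈)) (proj₁ (∈-neighbours⁻ y∈)) x≢y }))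
    (cliques≤turán adj? adj-sym (2 + ρ) k (neighbours w) free-w)
    where
    free-w : CliqueFree Adj k (neighbours w)
    free-w (z ∷ zs) len sub (az ∷ ap) = no-adj-clique w z zs (proj₂ (∈-neighbours⁻ (sub z (here refl)))) ap
      (λ y y∈ → proj₂ (∈-neighbours⁻ (sub y (there y∈)))) (λ y y∈ → All.lookup az y∈) (suc-injective len)

  -- The common neighbourhood of `w` and `v` has no `k`-clique, which leaves `k′` parts. It is
  -- bounded by the neighbourhood of `v` alone, so that the sum over `w` becomes a factor `s`.
  cliques-at-wv : ∀ w v → w ∈ ws → v ∈ vs →
    (# (λ e → (w ∈ᵉ? e) ×-dec ((v ∈ᵉ? e) ×-dec ¬? (nonClique? e)))) H ≤ turán (1 + ρ) k′ (length (neighbours v))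
  cliques-at-wv w v w∈ v∈ with adj? w v
  ... | no ¬adj = ≤-trans (≤-reflexive (#-none (λ e → (w ∈ᵉ? e) ×-dec ((v ∈ᵉ? e) ×-dec ¬? (nonClique? e))) H
          (λ { e e∈ (w∈e , v∈e , ¬nc) → ¬adj (adj-WV (λ b → ¬nc (inj₂ (inj₁ b))) w∈ v∈ w∈e v∈e) }))) z≤n
  ... | yes adj = ≤-trans
    (#link≤cliques adj? uniqH (1 + ρ) (λ e → (w ∈ᵉ? e) ×-dec ((v ∈ᵉ? e) ×-dec ¬? (nonClique? e))) (w ∷ v ∷ []) xs
      ((w≢v w v w∈ v∈ ∷ All.tabulate (λ x∈ → w≢v _ _ w∈ (proj₁ (xs⁻ x∈))))
        ∷ All.tabulate (λ x∈ → proj₁ (proj₂ (proj₂ (xs⁻ x∈)))) ∷ UniqueP.filter⁺ (adj? v) (neighbours-unique w))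
      (λ { e e∈ (w∈e , v∈e , ¬nc) → (λ { x (here refl) → w∈e ; x (there (here refl)) → v∈e })
         , (λ x x∈e → [ (λ { refl → here refl }) , in-xs e e∈ w∈e v∈e ¬nc x x∈e ]′
                      (clique-link e∈ (λ t → ¬nc (inj₁ t)) w∈ w∈e x∈e))
         , sizes e e∈ })
      (λ { e e∈ (w∈e , v∈e , ¬nc) x y x∈ y∈ x≢y → adj-VV (λ b → ¬nc (inj₂ (inj₂ b)))
             (proj₁ (xs⁻ x∈)) (proj₁ (xs⁻ y∈)) x≢y }))
    (≤-trans (cliques≤turán adj? adj-sym (1 + ρ) k′ xs free-wv)
      (turán-mono (1 + ρ) k′ (≤-trans (≤-reflexive (cong length (filter-swap (adj? v) (adj? w) vs)))
                                      (ListP.length-filter (adj? w) (neighbours v)))))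
    where
    xs = filter (adj? v) (neighbours w)
    xs⁻ : ∀ {x} → x ∈ xs → x ∈ vs × Adj w x × Adj v x
    xs⁻ x∈ with Mem.∈-filter⁻ (adj? v) {xs = neighbours w} x∈
    ... | x∈′ , av = proj₁ (∈-neighbours⁻ x∈′) , proj₂ (∈-neighbours⁻ x∈′) , av
    in-xs : ∀ e → e ∈ H → w ∈ˢ e → v ∈ˢ e → ¬ NonClique e → ∀ x → x ∈ˢ e → x ∈ vs → x ∈ w ∷ v ∷ xs
    in-xs e e∈ w∈e v∈e ¬nc x x∈e x∈vs with x Fin.≟ v
    ... | yes refl = there (here refl)
    ... | no x≢v   = there (there (Mem.∈-filter⁺ (adj? v)
      (Mem.∈-filter⁺ (adj? w) x∈vs (adj-WV (λ b → ¬nc (inj₂ (inj₁ b))) w∈ x∈vs w∈e x∈e))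
      (adj-VV (λ b → ¬nc (inj₂ (inj₂ b))) v∈ x∈vs (λ eq → x≢v (sym eq)) v∈e x∈e)))
    free-wv : CliqueFree Adj k′ xs
    free-wv zs len sub ap = no-adj-clique w v zs adj ap
      (λ y y∈ → proj₁ (proj₂ (xs⁻ (sub y y∈)))) (λ y y∈ → proj₂ (proj₂ (xs⁻ (sub y y∈)))) len

  edges≤ : length H ≤ (# nonClique?) H + ∑ ws (λ w → turán (2 + ρ) k (length (neighbours w)))
  edges≤ = begin
    length H ≡⟨ sym (#-all (λ _ → yes tt) H (λ _ _ → tt)) ⟩
    (# (λ _ → yes tt)) H ≤⟨ #-⊎ (λ _ → yes tt) nonClique? (λ e → ¬? (nonClique? e)) H (λ e _ _ → em (nonClique? e)) ⟩
    (# nonClique?) H + (# (λ e → ¬? (nonClique? e))) H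
      ≤⟨ +-monoʳ-≤ _ (≤-trans
           (#-hit (λ e → ¬? (nonClique? e)) (λ w e → (w ∈ᵉ? e) ×-dec ¬? (nonClique? e)) H ws
             (λ e e∈ ¬nc → let (w , w∈ , w∈e) = meets e e∈ in w , w∈ , w∈e , ¬nc))
           (∑-mono ws cliques-at-w)) ⟩
    (# nonClique?) H + ∑ ws (λ w → turán (2 + ρ) k (length (neighbours w))) ∎
    where
    open ≤-Reasoning
    em : {P : Set} → Dec P → P ⊎ ¬ P
    em (yes p) = inj₁ p
    em (no ¬p) = inj₂ ¬p

  degree≤ : ∀ v → v ∈ vs → (# (v ∈ᵉ?_)) H ≤ (# (λ e → (v ∈ᵉ? e) ×-dec nonClique? e)) H
                                              + s * turán (1 + ρ) k′ (length (neighbours v))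
  degree≤ v v∈ = ≤-trans
    (#-⊎ (v ∈ᵉ?_) (λ e → (v ∈ᵉ? e) ×-dec nonClique? e) (λ e → (v ∈ᵉ? e) ×-dec ¬? (nonClique? e)) H
      (λ e _ v∈e → em v∈e (nonClique? e)))
    (+-monoʳ-≤ _ (≤-trans
      (#-hit (λ e → (v ∈ᵉ? e) ×-dec ¬? (nonClique? e)) (λ w e → (w ∈ᵉ? e) ×-dec ((v ∈ᵉ? e) ×-dec ¬? (nonClique? e))) H ws
        (λ { e e∈ (v∈e , ¬nc) → let (w , w∈ , w∈e) = meets e e∈ in w , w∈ , w∈e , v∈e , ¬nc }))
      (∑-bound ws _ (λ w w∈ → cliques-at-wv w v w∈ v∈))))
    where
    em : ∀ {e} → v ∈ˢ e → Dec (NonClique e) → (v ∈ˢ e × NonClique e) ⊎ (v ∈ˢ e × ¬ NonClique e)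
    em v∈e (yes p) = inj₁ (v∈e , p)
    em v∈e (no ¬p) = inj₂ (v∈e , ¬p)

  ∑-nonClique-degree : ∑ vs (λ v → (# (λ e → (v ∈ᵉ? e) ×-dec nonClique? e)) H) ≤ (3 + ρ) * (# nonClique?) H
  ∑-nonClique-degree = begin
    ∑ vs (λ v → ∑ H (λ e → 𝟙 ((v ∈ᵉ? e) ×-dec nonClique? e)))
      ≡⟨ ∑-swap vs H _ ⟩
    ∑ H (λ e → ∑ vs (λ v → 𝟙 ((v ∈ᵉ? e) ×-dec nonClique? e)))
      ≤⟨ ∑-mono H (λ e e∈ → pt e e∈ (nonClique? e)) ⟩
    ∑ H (λ e → (3 + ρ) * 𝟙 (nonClique? e))
      ≡⟨ ∑-*ˡ (3 + ρ) H _ ⟩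
    (3 + ρ) * (# nonClique?) H ∎
    where
    open ≤-Reasoning
    pt : ∀ e → e ∈ H → (d : Dec (NonClique e)) → ∑ vs (λ v → 𝟙 ((v ∈ᵉ? e) ×-dec d)) ≤ (3 + ρ) * 𝟙 d
    pt e e∈ (yes p) = ≤-trans (#-mono (λ v → (v ∈ᵉ? e) ×-dec yes p) (_∈ᵉ? e) vs (λ _ _ → proj₁))
      (≤-trans (#-edge-≤ e vs vs-unique) (≤-reflexive (trans (sizes e e∈) (sym (*-identityʳ (3 + ρ))))))
    pt e e∈ (no ¬p) = ≤-trans (≤-reflexive (#-none (λ v → (v ∈ᵉ? e) ×-dec no ¬p) vs (λ _ _ q → ¬p (proj₂ q)))) z≤n

#-¬× : {A : Set} {P Q : A → Set} (P? : ∀ x → Dec (P x)) (Q? : ∀ x → Dec (Q x)) → ∀ xs →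
  (# (λ x → ¬? (P? x ×-dec Q? x))) xs ≤ (# (λ x → ¬? (P? x))) xs + (# (λ x → ¬? (Q? x))) xs
#-¬× P? Q? xs = #-⊎ (λ x → ¬? (P? x ×-dec Q? x)) (λ x → ¬? (P? x)) (λ x → ¬? (Q? x)) xs (λ x _ → split (P? x))
  where
  split : ∀ {P Q : Set} → Dec P → ¬ (P × Q) → ¬ P ⊎ ¬ Q
  split (yes p) h = inj₂ (λ q → h (p , q))
  split (no ¬p) _ = inj₁ ¬p

#-¬all : {A B : Set} {R : B → A → Set} (R? : ∀ z x → Dec (R z x)) → ∀ zs xs →
  (# (λ x → ¬? (all? (λ z → R? z x) zs))) xs ≤ ∑ zs (λ z → (# (λ x → ¬? (R? z x))) xs)
#-¬all R? zs xs = #-hit (λ x → ¬? (all? (λ z → R? z x) zs)) (λ z x → ¬? (R? z x)) xs zs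
  (λ x _ ¬a → let (z , z∈ , ¬r) = find (AllP.¬All⇒Any¬ (λ z → R? z x) zs ¬a) in z , z∈ , ¬r)

#-exists-within : {A : Set} {P Q : A → Set} (P? : ∀ x → Dec (P x)) (Q? : ∀ x → Dec (Q x)) → ∀ xs →
  (# (λ x → P? x ×-dec ¬? (Q? x))) xs < (# P?) xs → ∃ λ x → x ∈ xs × P x × Q x
#-exists-within P? Q? xs lt with any? (λ x → P? x ×-dec Q? x) xs
... | yes a = let (x , x∈ , p , q) = find a in x , x∈ , p , q
... | no ¬a = ⊥-elim (<⇒≱ lt (#-mono P? (λ x → P? x ×-dec ¬? (Q? x)) xs (λ x x∈ p → p , λ q → ¬a (lose x∈ (p , q)))))

#-two : {A : Set} {P : A → Set} (P? : ∀ x → Dec (P x)) → ∀ {xs x y} → x ∈ xs → y ∈ xs → x ≢ y → P x → P y →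
        2 ≤ (# P?) xs
#-two P? {xs} x∈ y∈ x≢y px py = ≤-trans (Unique-⊆-length {ys = filter P? xs} ((x≢y ∷ []) ∷ [] ∷ [])
    (λ { _ (here refl) → Mem.∈-filter⁺ P? x∈ px ; _ (there (here refl)) → Mem.∈-filter⁺ P? y∈ py }))
  (≤-reflexive (length-filter≡# P? xs))

AllPairs-lookup : {A : Set} {R : A → A → Set} → (∀ {x y} → R x y → R y x) → ∀ {xs x y} → AllPairs R xs →
  x ∈ xs → y ∈ xs → x ≢ y → R x y
AllPairs-lookup sy (h ∷ _)  (here refl) (here refl) x≢y = contradiction refl x≢y
AllPairs-lookup sy (h ∷ _)  (here refl) (there y∈)  _   = All.lookup h y∈
AllPairs-lookup sy (h ∷ _)  (there x∈)  (here refl) _   = sy (All.lookup h x∈)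
AllPairs-lookup sy (_ ∷ ap) (there x∈)  (there y∈)  x≢y = AllPairs-lookup sy ap x∈ y∈ x≢y

nonempty : {A : Set} (xs : List A) {l : ℕ} → length xs ≡ suc l → ∃ λ x → x ∈ xs
nonempty (x ∷ _) _ = x , here refl

∑-allFin : ∀ k (f : Fin k → ℕ) → ∑ (allFin k) f ≡ total k f
∑-allFin k f = go k id
  where
  go : ∀ j (g : Fin j → Fin k) → ∑ (tabulate g) f ≡ total j (f ∘ g)
  go zero    g = refl
  go (suc j) g = cong (f (g zero) +_) (go j (g ∘ suc))

others : ∀ {k} → Fin (suc k) → List (Fin (suc k))
others {k} i = map (punchIn i) (allFin k)

length-others : ∀ {k} (i : Fin (suc k)) → length (others i) ≡ k
length-others {k} i = trans (ListP.length-map (punchIn i) (allFin k)) (ListP.length-tabulate {n = k} id)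

others-unique : ∀ {k} (i : Fin (suc k)) → Unique (others i)
others-unique {k} i = UniqueP.map⁺ (Fin.punchIn-injective i _ _) (UniqueP.allFin⁺ k)

∈-others⁻ : ∀ {k} (i : Fin (suc k)) {j} → j ∈ others i → j ≢ i
∈-others⁻ i j∈ with Mem.∈-map⁻ (punchIn i) j∈
... | x , _ , refl = Fin.punchInᵢ≢i i x

-- Scale: a part has about μ vertices, g is a small fraction of μ, and an error
-- is negligible when it is a fixed multiple of g.
record Regime {n ρ k′ : ℕ} (S : Setup n ρ k′) : Set where
  open Setting S using (k; s; m; N; H; vs; L)
  field
    m₁ μ g cw B        : ℕ
    b b₂ h h₂ h₃ Λ κ   : ℕ
    b≡   : b ≡ 2 * k + 2 * (3 + ρ) + 2
    b₂≡  : b₂ ≡ b + 2 * k + 2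
    h≡   : h ≡ k * b₂ + 1
    κ≡   : κ ≡ 2 * k + h + b + 1
    h₂≡  : h₂ ≡ (h + b + 1) * B
    h₃≡  : h₃ ≡ 2 * k + h₂
    Λ≡   : Λ ≡ 3 + ρ + 2 * b₂ + 2 * h₃ + 4 + k * b₂ + b + 2 * k
    m≡   : m ≡ suc m₁
    kμ≤m₁ : k * μ ≤ m₁
    1≤g  : 1 ≤ g
    Λg≤μ : Λ * g ≤ μ
    1≤T₁ : 1 ≤ turán (1 + ρ) k′ (m₁ ∸ μ)
    1≤T₂ : 1 ≤ turán (2 + ρ) k m
    N₁   : N ^ (1 + ρ) ≤ B * turán (1 + ρ) k′ (m₁ ∸ μ)
    N₂   : N ^ (2 + ρ) ≤ B * turán (2 + ρ) k m
    N₀   : 8 * κ * (g * N ^ ρ) ≤ turán (1 + ρ) k′ (m₁ ∸ μ)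
    small : s * s + s * L ≤ N
    h-w  : m * (suc L * B) ≤ g * cw
    h-v  : (3 + ρ) * (suc L * B) * (N * N) ≤ s * (g * g)
    h-s  : 2 * B * cw + 2 * (cw + (3 + ρ)) + 1 ≤ s
    h-deg : s * s + m * L + s * L ≤ s * g
    h-end : m * ((s * s + s * L) * N ^ (1 + ρ)) ≤ g * turán (2 + ρ) k m
    min-degree : ∀ v → v ∈ vs → s * turán (1 + ρ) k′ (m₁ ∸ μ) ≤ (# (v ∈ᵉ?_)) H
    dense : s * turán (2 + ρ) k m ≤ length H

-- Typical vertices and a clique of centres

module Stability {n ρ k′ : ℕ} (S : Setup n ρ k′) (R : Regime S) where

  open Setting S public
  open Regime R public

  r : ℕ
  r = 3 + ρ

  -- `D` is the number of neighbours outside W that a vertex has when it misses only its own part.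
  -- With `μ` equal to `m₁ / k`, the value `T₁` is the increment of the Turán number from `m₁` to
  -- `m`, so `s * T₁` is the degree expected in the extremal configuration.
  D T₁ T₂ : ℕ
  D  = m₁ ∸ μ
  T₁ = turán (1 + ρ) k′ D
  T₂ = turán (2 + ρ) k m

  instance
    nonZero-T₁ : NonZero T₁
    nonZero-T₁ = >-nonZero 1≤T₁
    nonZero-T₂ : NonZero T₂
    nonZero-T₂ = >-nonZero 1≤T₂
    nonZero-g : NonZero g
    nonZero-g = >-nonZero 1≤g

  1≤s : 1 ≤ s
  1≤s = ≤-trans (m≤n+m 1 _) h-s

  instance
    nonZero-s : NonZero s
    nonZero-s = >-nonZero 1≤s

  μ≤m₁ : μ ≤ m₁
  μ≤m₁ = ≤-trans (m≤m+n μ (k′ * μ)) kμ≤m₁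

  D+μ : D + μ ≡ m₁
  D+μ = m∸n+n≡m μ≤m₁

  m∸neighbours : ∀ x → m ∸ length (neighbours x) ≡ nonAdj x
  m∸neighbours x = trans (cong (_∸ length (neighbours x)) (sym (neighbours+nonAdj x))) (m+n∸m≡n (length (neighbours x)) _)

  turán-neighbours : ∀ x → m * turán (2 + ρ) k (length (neighbours x)) + T₂ * nonAdj x ≤ m * T₂
  turán-neighbours x = ≤-trans
    (+-monoʳ-≤ _ (≤-reflexive (trans (*-comm T₂ (nonAdj x)) (cong (_* T₂) (sym (m∸neighbours x))))))
    (turán-deficit (1 + ρ) k (ListP.length-filter (adj? x) vs))

  ∑-turán-neighbours : m * ∑ ws (λ w → turán (2 + ρ) k (length (neighbours w))) + T₂ * ∑ ws nonAdj ≤ s * (m * T₂)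
  ∑-turán-neighbours = ≤-trans
    (≤-reflexive (trans (cong₂ _+_ (sym (∑-*ˡ m ws _)) (sym (∑-*ˡ T₂ ws _))) (sym (∑-+ ws _ _))))
    (∑-bound ws (m * T₂) (λ w _ → turán-neighbours w))

  #nonClique′ : (# nonClique?) H ≤ suc L * N ^ (2 + ρ)
  #nonClique′ = #nonClique small

  -- By `dense`, whatever is lost through missing neighbours must be made up for by edges that are
  -- not cliques, and `turán-deficit` prices each missing pair at `T₂ / m` edges.
  ∑-nonAdj : ∑ ws nonAdj ≤ m * (suc L * B)
  ∑-nonAdj = *-cancelˡ-≤ T₂ (≤-trans
    (cert m X (T₂ * ∑ ws nonAdj) s T₂ ((# nonClique?) H) (≤-trans dense edges≤) ∑-turán-neighbours)
    (≤-trans (*-monoʳ-≤ m (≤-trans #nonClique′ (*-monoʳ-≤ (suc L) N₂)))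
             (≤-reflexive (rot m (suc L) B T₂))))
    where
    X = ∑ ws (λ w → turán (2 + ρ) k (length (neighbours w)))
    cert : ∀ m X Y s T c → s * T ≤ c + X → m * X + Y ≤ s * (m * T) → Y ≤ m * c
    cert m X Y s T c p q = +-cancelˡ-≤ (m * X) Y (m * c) (≤-trans q (≤-trans (≤-reflexive (e₁ s m T))
      (≤-trans (*-monoʳ-≤ m p) (≤-reflexive (e₂ m c X)))))
      where
      e₁ : ∀ s m T → s * (m * T) ≡ m * (s * T)
      e₁ = solve-∀
      e₂ : ∀ m c X → m * (c + X) ≡ m * X + m * c
      e₂ = solve-∀
    rot : ∀ m l B T → m * (l * (B * T)) ≡ T * (m * (l * B))
    rot = solve-∀

  deficit : Fin n → ℕ
  deficit v = D ∸ length (neighbours v)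

  nonCliqueDegree : Fin n → ℕ
  nonCliqueDegree v = (# (λ e → (v ∈ᵉ? e) ×-dec nonClique? e)) H

  deficit≤ : ∀ v → v ∈ vs → T₁ * (s * deficit v) ≤ D * nonCliqueDegree v
  deficit≤ v v∈ with length (neighbours v) ≤? D
  ... | no ¬le = ≤-trans (≤-reflexive (trans (cong (λ z → T₁ * (s * z)) (m≤n⇒m∸n≡0 (<⇒≤ (≰⇒> ¬le))))
                   (trans (cong (T₁ *_) (*-zeroʳ s)) (*-zeroʳ T₁)))) z≤n
  ... | yes le = cert D (turán (1 + ρ) k′ (length (neighbours v))) (deficit v) s T₁ (nonCliqueDegree v)
      (≤-trans (min-degree v v∈) (degree≤ v v∈)) (turán-deficit ρ k′ le)
    where
    cert : ∀ D X d s T c → s * T ≤ c + s * X → D * X + d * T ≤ D * T → T * (s * d) ≤ D * c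
    cert D X d s T c p q = +-cancelˡ-≤ (s * (D * X)) _ _ (≤-trans (≤-reflexive (e₁ s D X T d))
      (≤-trans (*-monoʳ-≤ s q) (≤-trans (≤-reflexive (e₂ s D T)) (≤-trans (*-monoʳ-≤ D p) (≤-reflexive (e₃ D c s X))))))
      where
      e₁ : ∀ s D X T d → s * (D * X) + T * (s * d) ≡ s * (D * X + d * T)
      e₁ = solve-∀
      e₂ : ∀ s D T → s * (D * T) ≡ D * (s * T)
      e₂ = solve-∀
      e₃ : ∀ D c s X → D * (c + s * X) ≡ s * (D * X) + D * c
      e₃ = solve-∀

  D≤N : D ≤ N
  D≤N = ≤-trans (m∸n≤m m₁ μ) (≤-trans (n≤1+n m₁) (≤-trans (≤-reflexive (sym m≡)) m≤N))

  -- The same comparison at each vertex outside `ws`, with the minimum degree in place of density.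
  -- The right side has no factor `s`, so a large `s` makes the total deficit at most `g * g`.
  ∑-deficit : s * ∑ vs deficit ≤ (3 + ρ) * (suc L * B) * (N * N)
  ∑-deficit = *-cancelˡ-≤ T₁ (begin
    T₁ * (s * ∑ vs deficit)
      ≡⟨ trans (cong (T₁ *_) (sym (∑-*ˡ s vs deficit))) (sym (∑-*ˡ T₁ vs _)) ⟩
    ∑ vs (λ v → T₁ * (s * deficit v))
      ≤⟨ ∑-mono vs deficit≤ ⟩
    ∑ vs (λ v → D * nonCliqueDegree v)
      ≡⟨ ∑-*ˡ D vs nonCliqueDegree ⟩
    D * ∑ vs nonCliqueDegree
      ≤⟨ *-mono-≤ D≤N (≤-trans ∑-nonClique-degree (*-monoʳ-≤ (3 + ρ)
           (≤-trans #nonClique′ (*-monoʳ-≤ (suc L) (*-monoʳ-≤ N N₁))))) ⟩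
    N * ((3 + ρ) * (suc L * (N * (B * T₁))))
      ≡⟨ rot N (3 + ρ) (suc L) B T₁ ⟩
    T₁ * ((3 + ρ) * (suc L * B) * (N * N)) ∎)
    where
    open ≤-Reasoning
    rot : ∀ N r l B T → N * (r * (l * (N * (B * T)))) ≡ T * (r * (l * B) * (N * N))
    rot = solve-∀

  TypW TypV : Fin n → Set
  TypW w = nonAdj w ≤ g
  TypV v = D ≤ length (neighbours v) + g

  typW? : ∀ w → Dec (TypW w)
  typW? w = nonAdj w ≤? g

  typV? : ∀ v → Dec (TypV v)
  typV? v = D ≤? length (neighbours v) + g

  #atypical-w : (# (λ w → ¬? (typW? w))) ws ≤ cw
  #atypical-w = *-cancelˡ-≤ g (≤-trans
    (*-monoʳ-≤ g (#-mono (λ w → ¬? (typW? w)) (λ w → suc g ≤? nonAdj w) ws (λ _ _ → ≰⇒>)))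
    (≤-trans (markov ws nonAdj g) (≤-trans ∑-nonAdj h-w)))

  #atypical-v : (# (λ v → ¬? (typV? v))) vs ≤ g
  #atypical-v = *-cancelˡ-≤ g (≤-trans
    (*-monoʳ-≤ g (#-mono (λ v → ¬? (typV? v)) (λ v → suc g ≤? deficit v) vs
      (λ v _ ¬t → m+n≤o⇒m≤o∸n (suc g) (≤-trans (≤-reflexive (cong suc (+-comm g (length (neighbours v))))) (≰⇒> ¬t)))))
    (≤-trans (markov vs deficit g) (*-cancelˡ-≤ s (≤-trans ∑-deficit h-v))))

  -- One `g` is the permitted deficit; the other absorbs the unit by which `m` exceeds `D + μ`.
  nonAdj-typical : ∀ v → TypV v → nonAdj v ≤ μ + 2 * g
  nonAdj-typical v t = cert (length (neighbours v)) (nonAdj v) D μ g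
    (trans (neighbours+nonAdj v) (trans m≡ (cong suc (sym D+μ)))) t
    where
    cert : ∀ d x D μ g .{{_ : NonZero g}} → d + x ≡ suc (D + μ) → D ≤ d + g → x ≤ μ + 2 * g
    cert d x D μ (suc g) eq p = +-cancelˡ-≤ d _ _ (≤-trans (≤-reflexive eq)
      (≤-cert D (d + suc g) g p (e d D μ g)))
      where
      e : ∀ d D μ g → suc (D + μ) + (d + suc g) + g ≡ d + (μ + 2 * suc g) + D
      e = solve-∀

  -- There are `r` of them so that an edge with a vertex outside `ws` cannot contain them all.
  typical-ws : ∃ λ tws → length tws ≡ r × Unique tws × (∀ w → w ∈ tws → w ∈ ws × TypW w)
  typical-ws = take r good , len , UniqueP.take⁺ r (UniqueP.filter⁺ typW? ws-unique)
             , (λ w → All.lookup (AllP.take⁺ r (All.tabulate (Mem.∈-filter⁻ typW? {xs = ws}))))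
    where
    good = filter typW? ws
    r≤ : r ≤ length good
    r≤ = +-cancelˡ-≤ cw _ _ (begin
      cw + r                                              ≤⟨ m≤m+n (cw + r) _ ⟩
      2 * (cw + r)                                        ≤⟨ m≤n+m _ (2 * B * cw) ⟩
      2 * B * cw + 2 * (cw + r)                           ≤⟨ ≤-trans (m≤m+n _ 1) h-s ⟩
      s                                                   ≡⟨ sym (#-complement typW? ws) ⟩
      (# typW?) ws + (# (λ w → ¬? (typW? w))) ws          ≤⟨ +-monoʳ-≤ _ #atypical-w ⟩
      (# typW?) ws + cw                                   ≡⟨ trans (+-comm _ cw) (cong (cw +_) (sym (length-filter≡# typW? ws))) ⟩
      cw + length good                                    ∎)
      where open ≤-Reasoning
    len : length (take r good) ≡ r
    len = trans (ListP.length-take r good) (m≤n⇒m⊓n≡m r≤)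

  tws : List (Fin n)
  tws = proj₁ typical-ws

  length-tws : length tws ≡ r
  length-tws = proj₁ (proj₂ typical-ws)

  tws-unique : Unique tws
  tws-unique = proj₁ (proj₂ (proj₂ typical-ws))

  tws⁻ : ∀ w → w ∈ tws → w ∈ ws × TypW w
  tws⁻ = proj₂ (proj₂ (proj₂ typical-ws))

  some-tw : ∃ λ w → w ∈ tws
  some-tw = nonempty tws length-tws

  InV₀ : Fin n → Set
  InV₀ v = TypV v × All (λ w → Adj w v) tws

  inV₀? : ∀ v → Dec (InV₀ v)
  inV₀? v = typV? v ×-dec all? (λ w → adj? w v) tws

  #¬V₀ : (# (λ v → ¬? (inV₀? v))) vs ≤ suc r * g
  #¬V₀ = ≤-trans (#-¬× typV? (λ v → all? (λ w → adj? w v) tws) vs)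
    (+-mono-≤ #atypical-v (≤-trans (#-¬all adj? tws vs)
      (≤-trans (∑-bound tws g (λ w w∈ → proj₂ (tws⁻ w w∈))) (≤-reflexive (cong (_* g) length-tws)))))

  kμ<m : k * μ < m
  kμ<m = ≤-trans (s≤s kμ≤m₁) (≤-reflexive (sym m≡))

  -- Each chosen vertex excludes at most `μ + 2 * g` others. Before the last choice this excludes,
  -- together with the complement of `V₀`, about `k′ * μ` vertices; the spare `μ` pays for all
  -- multiples of `g`.
  clique-in-V₀ : ∀ j → j ≤ k → ∃ λ ys → length ys ≡ j × AllPairs Adj ys × (∀ y → y ∈ ys → y ∈ vs × InV₀ y)
  clique-in-V₀ zero    _   = [] , refl , [] , λ _ ()
  clique-in-V₀ (suc j) j<k = extend (clique-in-V₀ j (<⇒≤ j<k))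
    where
    extend : (∃ λ ys → length ys ≡ j × AllPairs Adj ys × (∀ y → y ∈ ys → y ∈ vs × InV₀ y)) →
             ∃ λ ys → length ys ≡ suc j × AllPairs Adj ys × (∀ y → y ∈ ys → y ∈ vs × InV₀ y)
    extend (ys , len , ap , ys⊆) = y ∷ ys , cong suc len , All.map adj-sym ay ∷ ap
                                 , λ { _ (here refl) → y∈ , y∈V₀ ; z (there z∈) → ys⊆ z z∈ }
     where
      few : (# (λ x → ¬? (inV₀? x ×-dec all? (λ y → adj? y x) ys))) vs < m
      few = ≤-trans (s≤s (≤-trans (#-¬× inV₀? (λ x → all? (λ y → adj? y x) ys) vs)
        (+-mono-≤ #¬V₀ (≤-trans (#-¬all adj? ys vs)
          (≤-trans (∑-bound ys (μ + 2 * g) (λ y y∈ → nonAdj-typical y (proj₁ (proj₂ (ys⊆ y y∈)))))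
                   (*-monoˡ-≤ (μ + 2 * g) (≤-trans (≤-reflexive len) (s≤s⁻¹ j<k))))))))
        (≤-trans (s≤s (cert r k′ μ g b₂ h₃ b Λ Λ≡ Λg≤μ)) kμ<m)
        where
        cert : ∀ r k′ μ g b₂ h₃ b Λ → Λ ≡ r + 2 * b₂ + 2 * h₃ + 4 + suc k′ * b₂ + b + 2 * suc k′ → Λ * g ≤ μ →
               suc r * g + k′ * (μ + 2 * g) ≤ suc k′ * μ
        cert r k′ μ g b₂ h₃ b _ refl p = ≤-cert ((r + 2 * b₂ + 2 * h₃ + 4 + suc k′ * b₂ + b + 2 * suc k′) * g) μ
          ((2 * b₂ + 2 * h₃ + 5 + suc k′ * b₂ + b) * g) p (e r k′ μ g b₂ h₃ b)
          where
          e : ∀ r k′ μ g b₂ h₃ b → suc r * g + k′ * (μ + 2 * g) + μ + (2 * b₂ + 2 * h₃ + 5 + suc k′ * b₂ + b) * g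
              ≡ suc k′ * μ + (r + 2 * b₂ + 2 * h₃ + 4 + suc k′ * b₂ + b + 2 * suc k′) * g
          e = solve-∀
      next = #-exists (λ x → inV₀? x ×-dec all? (λ y → adj? y x) ys) vs few
      y = proj₁ next
      y∈ = proj₁ (proj₂ next)
      y∈V₀ = proj₁ (proj₂ (proj₂ next))
      ay = proj₂ (proj₂ (proj₂ next))

-- Parts of the typical vertices

module Parts {n ρ k′ : ℕ} (S : Setup n ρ k′) (R : Regime S) where

  open Stability S R public

  private
    centres : ∃ λ ys → length ys ≡ k × AllPairs Adj ys × (∀ y → y ∈ ys → y ∈ vs × InV₀ y)
    centres = clique-in-V₀ k ≤-refl

    ys : List (Fin n)
    ys = proj₁ centres

    ys-adj : AllPairs Adj ys
    ys-adj = proj₁ (proj₂ (proj₂ centres))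

    enum : ∃ λ (f : Fin k → Fin n) → (∀ i j → f i ≡ f j → i ≡ j) × (∀ i → f i ∈ ys) × (∀ x → x ∈ ys → ∃ λ i → f i ≡ x)
    enum = enumerate ys (AllPairs.map proj₁ ys-adj) (proj₁ (proj₂ centres))

  abstract
    y : Fin k → Fin n
    y = proj₁ enum

    y-inV₀ : ∀ i → InV₀ (y i)
    y-inV₀ i = proj₂ (proj₂ (proj₂ (proj₂ centres)) (y i) (proj₁ (proj₂ (proj₂ enum)) i))

    y-adj : ∀ i j → i ≢ j → Adj (y i) (y j)
    y-adj i j i≢j = AllPairs-lookup adj-sym ys-adj (proj₁ (proj₂ (proj₂ enum)) i) (proj₁ (proj₂ (proj₂ enum)) j)
      (λ eq → i≢j (proj₁ (proj₂ enum) i j eq))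

    w₀ : Fin n
    w₀ = proj₁ some-tw

    w₀∈ : w₀ ∈ tws
    w₀∈ = proj₂ some-tw

  V₀-adj : ∀ {v w} → InV₀ v → w ∈ tws → Adj w v
  V₀-adj (_ , aw) w∈ = All.lookup aw w∈

  -- The vertices of `V₀` that could replace the centre `y i` in the clique of centres.
  InP : Fin k → Fin n → Set
  InP i v = InV₀ v × (∀ j → j ≢ i → Adj (y j) v)

  inP? : ∀ i v → Dec (InP i v)
  inP? i v = inV₀? v ×-dec Fin.all? (λ j → ¬? (j Fin.≟ i) →-dec adj? (y j) v)

  NotP : Fin n → Set
  NotP v = ¬ ∃ λ i → InP i v

  notP? : ∀ v → Dec (NotP v)
  notP? v = ¬? (Fin.any? (λ i → inP? i v))

  |P| : Fin k → ℕ
  |P| i = (# (inP? i)) vs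

  ys-pairs : ∀ is → Unique is → AllPairs Adj (map y is)
  ys-pairs is u = AllPairsP.map⁺ (AllPairs.map (λ {i} {j} → y-adj i j) u)

  V₀-missing : ∀ v → InV₀ v → ¬ (∀ j → Adj (y j) v)
  V₀-missing v v∈V₀ all = no-adj-clique w₀ v (map y (allFin k)) (V₀-adj v∈V₀ w₀∈) (ys-pairs _ (UniqueP.allFin⁺ k))
    (λ z z∈ → let (i , _ , eq) = Mem.∈-map⁻ y z∈ in subst (Adj w₀) (sym eq) (V₀-adj (y-inV₀ i) w₀∈))
    (λ z z∈ → let (i , _ , eq) = Mem.∈-map⁻ y z∈ in subst (Adj v) (sym eq) (adj-sym (all i)))
    (trans (ListP.length-map y (allFin k)) (ListP.length-tabulate {n = k} id))

  P-missing : ∀ i v → InP i v → ¬ Adj (y i) v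
  P-missing i v (v∈V₀ , h) a = V₀-missing v v∈V₀ λ j → cases j (j Fin.≟ i)
    where
    cases : ∀ j → Dec (j ≡ i) → Adj (y j) v
    cases j (yes refl) = a
    cases j (no j≢i)   = h j j≢i

  P-disjoint : ∀ i j v → i ≢ j → InP i v → InP j v → ⊥
  P-disjoint i j v i≢j p q = P-missing i v p (proj₂ q i i≢j)

  -- `u`, `v`, `w₀` and the centres of the other parts would be `k + 2` pairwise adjacent vertices.
  P-independent : ∀ i u v → InP i u → InP i v → Adj u v → ⊥
  P-independent i u v (u∈ , hu) (v∈ , hv) a = no-adj-clique u v (w₀ ∷ map y (others i)) a
    (All.tabulate (λ z∈ → let (j , _ , eq) = Mem.∈-map⁻ y z∈ in subst (Adj w₀) (sym eq) (V₀-adj (y-inV₀ j) w₀∈))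
      ∷ ys-pairs _ (others-unique i))
    (to-all u u∈ hu) (to-all v v∈ hv) (cong suc (trans (ListP.length-map y (others i)) (length-others i)))
    where
    to-all : ∀ u → InV₀ u → (∀ j → j ≢ i → Adj (y j) u) → ∀ z → z ∈ w₀ ∷ map y (others i) → Adj u z
    to-all u u∈ hu z (here refl) = adj-sym (V₀-adj u∈ w₀∈)
    to-all u u∈ hu z (there z∈)  =
      let (j , j∈ , eq) = Mem.∈-map⁻ y z∈ in subst (Adj u) (sym eq) (adj-sym (hu j (∈-others⁻ i j∈)))

  |P|≤ : ∀ i → |P| i ≤ μ + 2 * g
  |P|≤ i = ≤-trans (#-mono (inP? i) (λ v → ¬? (adj? (y i) v)) vs (λ v _ → P-missing i v))
                   (nonAdj-typical (y i) (proj₁ (y-inV₀ i)))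

  two-missing : ∀ v → InV₀ v → NotP v → ∃₂ λ i j → i ≢ j × ¬ Adj (y i) v × ¬ Adj (y j) v
  two-missing v v∈V₀ notP = first (Fin.any? (λ i → ¬? (adj? (y i) v)))
    where
    first : Dec (∃ λ i → ¬ Adj (y i) v) → ∃₂ λ i j → i ≢ j × ¬ Adj (y i) v × ¬ Adj (y j) v
    first (no ¬p) = ⊥-elim (V₀-missing v v∈V₀ λ j → decidable-stable (adj? (y j) v) (λ ¬a → ¬p (j , ¬a)))
    first (yes (i , ¬ai)) = second (Fin.any? (λ j → ¬? (j Fin.≟ i) ×-dec ¬? (adj? (y j) v)))
      where
      second : Dec (∃ λ j → j ≢ i × ¬ Adj (y j) v) → ∃₂ λ i j → i ≢ j × ¬ Adj (y i) v × ¬ Adj (y j) v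
      second (yes (j , j≢i , ¬aj)) = i , j , (λ eq → j≢i (sym eq)) , ¬ai , ¬aj
      second (no ¬p) = ⊥-elim (notP (i , v∈V₀ , λ j j≢i →
        decidable-stable (adj? (y j) v) (λ ¬a → ¬p (j , j≢i , ¬a))))

  -- Missing pairs between the centres and `V₀` are counted twice: every vertex of `V₀` misses a
  -- centre, and one that lies in no part misses two of them.
  #V₀+#outside : (# inV₀?) vs + (# (λ v → inV₀? v ×-dec notP? v)) vs ≤ k * (μ + 2 * g)
  #V₀+#outside = begin
    (# inV₀?) vs + (# (λ v → inV₀? v ×-dec notP? v)) vs
      ≡⟨ sym (∑-+ vs _ _) ⟩
    ∑ vs (λ v → 𝟙 (inV₀? v) + 𝟙 (inV₀? v ×-dec notP? v))
      ≤⟨ ∑-mono vs (λ v _ → pt v (inV₀? v) (notP? v)) ⟩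
    ∑ vs (λ v → ∑ (allFin k) (λ i → 𝟙 (¬? (adj? (y i) v))))
      ≡⟨ ∑-swap vs (allFin k) _ ⟩
    ∑ (allFin k) (λ i → nonAdj (y i))
      ≤⟨ ∑-bound (allFin k) (μ + 2 * g) (λ i _ → nonAdj-typical (y i) (proj₁ (y-inV₀ i))) ⟩
    length (allFin k) * (μ + 2 * g)
      ≡⟨ cong (_* (μ + 2 * g)) (ListP.length-tabulate {n = k} id) ⟩
    k * (μ + 2 * g) ∎
    where
    open ≤-Reasoning
    pt : ∀ v (d : Dec (InV₀ v)) (d′ : Dec (NotP v)) → 𝟙 d + 𝟙 (d ×-dec d′) ≤ (# (λ i → ¬? (adj? (y i) v))) (allFin k)
    pt v (no _)  d′      = z≤n
    pt v (yes p) (yes q) = let (i , j , i≢j , ai , aj) = two-missing v p q in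
      #-two (λ i → ¬? (adj? (y i) v)) (Mem.∈-allFin i) (Mem.∈-allFin j) i≢j ai aj
    pt v (yes p) (no _)  = one (Fin.any? (λ i → ¬? (adj? (y i) v)))
      where
      one : Dec (∃ λ i → ¬ Adj (y i) v) → 1 ≤ (# (λ i → ¬? (adj? (y i) v))) (allFin k)
      one (yes (i , ¬a)) = ≤-trans (≤-reflexive (sym (𝟙-yes (¬? (adj? (y i) v)) ¬a)))
                                   (∑-member (allFin k) (λ i → 𝟙 (¬? (adj? (y i) v))) (Mem.∈-allFin i))
      one (no ¬p) = ⊥-elim (V₀-missing v p λ j → decidable-stable (adj? (y j) v) (λ ¬a → ¬p (j , ¬a)))

  -- `V₀` has at least `m ∸ suc r * g` vertices with `m ≥ k * μ`, and the preceding count allows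
  -- only `k * (μ + 2 * g)`. What remains for vertices without a part, added to the complement of
  -- `V₀`, fixes `b`.
  #notP : (# notP?) vs ≤ b * g
  #notP = ≤-trans
    (#-⊎ notP? (λ v → ¬? (inV₀? v)) (λ v → inV₀? v ×-dec notP? v) vs (λ v _ q → split q (inV₀? v)))
    (cert k μ g r ((# (λ v → ¬? (inV₀? v))) vs) ((# inV₀?) vs) ((# (λ v → inV₀? v ×-dec notP? v)) vs) m b b≡
      #¬V₀ #V₀+#outside (<⇒≤ kμ<m) (#-complement inV₀? vs))
    where
    split : ∀ {v} → NotP v → Dec (InV₀ v) → ¬ InV₀ v ⊎ (InV₀ v × NotP v)
    split q (yes p) = inj₂ (p , q)
    split q (no ¬p) = inj₁ ¬p
    cert : ∀ k μ g r x v z m b → b ≡ 2 * k + 2 * r + 2 → x ≤ suc r * g → v + z ≤ k * (μ + 2 * g) → k * μ ≤ m →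
           v + x ≡ m → x + z ≤ b * g
    cert k μ g r x v z _ _ refl p q u refl =
      ≤-cert (x + x + (v + z) + k * μ) (suc r * g + suc r * g + k * (μ + 2 * g) + (v + x)) 0
        (+-mono-≤ (+-mono-≤ (+-mono-≤ p p) q) u) (e k μ g r x v z)
      where
      e : ∀ k μ g r x v z → x + z + (suc r * g + suc r * g + k * (μ + 2 * g) + (v + x)) + 0
                          ≡ (2 * k + 2 * r + 2) * g + (x + x + (v + z) + k * μ)
      e = solve-∀

  #vs≤parts : m ≤ (# notP?) vs + total k |P|
  #vs≤parts = begin
    m ≡⟨ sym (#-all (λ _ → yes tt) vs (λ _ _ → tt)) ⟩
    (# (λ _ → yes tt)) vs ≤⟨ #-⊎ (λ _ → yes tt) notP? (λ v → Fin.any? (λ i → inP? i v)) vs (λ v _ _ → split v) ⟩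
    (# notP?) vs + (# (λ v → Fin.any? (λ i → inP? i v))) vs
      ≤⟨ +-monoʳ-≤ _ (#-hit (λ v → Fin.any? (λ i → inP? i v)) inP? vs (allFin k) (λ { v _ (i , p) → i , Mem.∈-allFin i , p })) ⟩
    (# notP?) vs + ∑ (allFin k) |P| ≡⟨ cong ((# notP?) vs +_) (∑-allFin k |P|) ⟩
    (# notP?) vs + total k |P| ∎
    where
    open ≤-Reasoning
    split : ∀ v → NotP v ⊎ ∃ λ i → InP i v
    split v = cases (Fin.any? (λ i → inP? i v))
      where
      cases : Dec (∃ λ i → InP i v) → NotP v ⊎ ∃ λ i → InP i v
      cases (yes p) = inj₂ p
      cases (no ¬p) = inj₁ ¬p

  |P|≥ : ∀ i → μ ≤ |P| i + (b + 2 * k) * g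
  |P|≥ i = cert k′ μ g (|P| i) b (≤-trans (<⇒≤ kμ<m) (≤-trans #vs≤parts (+-mono-≤ #notP (≤-trans
      (≤-reflexive (total-punchIn k′ |P| i)) (+-monoʳ-≤ (|P| i) (total-upper k′ _ (μ + 2 * g) (λ j → |P|≤ (punchIn i j))))))))
    where
    cert : ∀ k′ μ g p b → suc k′ * μ ≤ b * g + (p + k′ * (μ + 2 * g)) → μ ≤ p + (b + 2 * suc k′) * g
    cert k′ μ g p b q = ≤-cert (suc k′ * μ) (b * g + (p + k′ * (μ + 2 * g))) (2 * g) q (e k′ μ g p b)
      where
      e : ∀ k′ μ g p b → μ + (b * g + (p + k′ * (μ + 2 * g))) + 2 * g ≡ p + (b + 2 * suc k′) * g + suc k′ * μ
      e = solve-∀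

  -- `p` misses all of its own part, which has nearly `μ` vertices, and at most `μ + 2 * g` vertices
  -- altogether.
  P-nonAdj : ∀ i j p → i ≢ j → InP i p → (# (λ v → inP? j v ×-dec ¬? (adj? p v))) vs ≤ b₂ * g
  P-nonAdj i j p i≢j p∈ = cert k μ g (|P| i) b b₂ ((# (λ v → inP? j v ×-dec ¬? (adj? p v))) vs) b₂≡ (|P|≥ i)
    (≤-trans (#-disjoint (inP? i) (λ v → inP? j v ×-dec ¬? (adj? p v)) (λ v → ¬? (adj? p v)) vs
      (λ v _ v∈ a → P-independent i p v p∈ v∈ a) (λ _ _ → proj₂) (λ { v _ v∈i (v∈j , _) → P-disjoint i j v i≢j v∈i v∈j }))
      (nonAdj-typical p (proj₁ (proj₁ p∈))))
    where
    cert : ∀ k μ g P b b₂ x → b₂ ≡ b + 2 * k + 2 → μ ≤ P + (b + 2 * k) * g → P + x ≤ μ + 2 * g → x ≤ b₂ * g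
    cert k μ g P b _ x refl p q = ≤-cert (μ + (P + x)) (P + (b + 2 * k) * g + (μ + 2 * g)) 0 (+-mono-≤ p q) (e k μ g P b x)
      where
      e : ∀ k μ g P b x → x + (P + (b + 2 * k) * g + (μ + 2 * g)) + 0 ≡ (b + 2 * k + 2) * g + (μ + (P + x))
      e = solve-∀

  -- The factor of `g` bounds the vertices excluded in each application of `transversal-clique`:
  -- those of an edge, the non-neighbours of two vertices, and those of a typical vertex of `ws`.
  -- `Λ` is chosen to leave room for this and for `k` greedy steps.
  part-large : ∀ i a → a ≤ (r + 2 * b₂ + 2 * h₃ + 3) * g → a + k * (b₂ * g) < |P| i
  part-large i a le = cert k g (|P| i) b b₂ h₃ Λ r a μ Λ≡ 1≤g Λg≤μ (|P|≥ i) le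
    where
    cert : ∀ k g P b b₂ h₃ Λ r a μ → Λ ≡ r + 2 * b₂ + 2 * h₃ + 4 + k * b₂ + b + 2 * k → 1 ≤ g → Λ * g ≤ μ →
           μ ≤ P + (b + 2 * k) * g → a ≤ (r + 2 * b₂ + 2 * h₃ + 3) * g → a + k * (b₂ * g) < P
    cert k g P b b₂ h₃ _ r a μ refl p₁ p₂ p₃ p₄ = ≤-cert
      (1 + (r + 2 * b₂ + 2 * h₃ + 4 + k * b₂ + b + 2 * k) * g + μ + a)
      (g + μ + (P + (b + 2 * k) * g) + (r + 2 * b₂ + 2 * h₃ + 3) * g) 0
      (+-mono-≤ (+-mono-≤ (+-mono-≤ p₁ p₂) p₃) p₄) (e k g P b b₂ h₃ r a μ)
      where
      e : ∀ k g P b b₂ h₃ r a μ →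
          1 + (a + k * (b₂ * g)) + (g + μ + (P + (b + 2 * k) * g) + (r + 2 * b₂ + 2 * h₃ + 3) * g) + 0
          ≡ P + (1 + (r + 2 * b₂ + 2 * h₃ + 4 + k * b₂ + b + 2 * k) * g + μ + a)
      e = solve-∀

  -- After each choice `Q` is strengthened by adjacency to the chosen vertex, which costs `b₂ * g`
  -- in every later part. The hypothesis reserves that amount for each part in the list.
  greedy : {Q : Fin n → Set} (Q? : ∀ x → Dec (Q x)) → ∀ is → Unique is →
    (∀ i → i ∈ is → (# (λ x → inP? i x ×-dec ¬? (Q? x))) vs + length is * (b₂ * g) < |P| i) →
    ∃ λ zs → length zs ≡ length is × AllPairs Adj zs × (∀ z → z ∈ zs → Q z × z ∈ vs × InV₀ z)
  greedy Q? [] _ _ = [] , refl , [] , λ _ ()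
  greedy {Q} Q? (i ∷ is) (i∉ ∷ u) h = x ∷ proj₁ rest , cong suc (proj₁ (proj₂ rest))
      , All.tabulate (λ z∈ → proj₂ (proj₁ (proj₂ (proj₂ (proj₂ rest)) _ z∈))) ∷ proj₁ (proj₂ (proj₂ rest))
      , λ { _ (here refl) → proj₂ (proj₂ (proj₂ next)) , proj₁ (proj₂ next) , proj₁ x∈P
          ; z (there z∈) → let (q , z∈vs , z∈V₀) = proj₂ (proj₂ (proj₂ rest)) z z∈ in proj₁ q , z∈vs , z∈V₀ }
    where
    next = #-exists-within (inP? i) Q? vs (≤-trans (s≤s (m≤m+n _ _)) (h i (here refl)))
    x = proj₁ next
    x∈P : InP i x
    x∈P = proj₁ (proj₂ (proj₂ next))
    Q′? : ∀ z → Dec (Q z × Adj x z)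
    Q′? z = Q? z ×-dec adj? x z
    few : ∀ j → j ∈ is → (# (λ z → inP? j z ×-dec ¬? (Q′? z))) vs + length is * (b₂ * g) < |P| j
    few j j∈ = ≤-trans (s≤s (≤-trans (+-monoˡ-≤ (length is * (b₂ * g)) (≤-trans
        (#-⊎ (λ z → inP? j z ×-dec ¬? (Q′? z)) (λ z → inP? j z ×-dec ¬? (Q? z)) (λ z → inP? j z ×-dec ¬? (adj? x z)) vs
          (λ { z _ (p , ¬q) → split p ¬q (Q? z) }))
        (+-monoʳ-≤ _ (P-nonAdj i j x (All.lookup i∉ j∈) x∈P))))
      (≤-reflexive (+-assoc ((# (λ z → inP? j z ×-dec ¬? (Q? z))) vs) (b₂ * g) (length is * (b₂ * g))))))
      (h j (there j∈))
      where
      split : ∀ {z} → InP j z → ¬ (Q z × Adj x z) → Dec (Q z) → (InP j z × ¬ Q z) ⊎ (InP j z × ¬ Adj x z)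
      split p ¬q (yes q) = inj₂ (p , λ a → ¬q (q , a))
      split p ¬q (no q)  = inj₁ (p , q)
    rest = greedy Q′? is u few

  transversal-clique : {Q : Fin n → Set} (Q? : ∀ x → Dec (Q x)) → ∀ is → Unique is → length is ≤ k →
    (∀ i → i ∈ is → (# (λ x → inP? i x ×-dec ¬? (Q? x))) vs ≤ (r + 2 * b₂ + 2 * h₃ + 3) * g) →
    ∃ λ zs → length zs ≡ length is × AllPairs Adj zs × (∀ z → z ∈ zs → Q z × z ∈ vs × InV₀ z)
  transversal-clique Q? is u len≤ h = greedy Q? is u λ i i∈ →
    ≤-trans (s≤s (+-monoʳ-≤ _ (*-monoˡ-≤ (b₂ * g) len≤))) (part-large i _ (h i i∈))

  #inP∧ : ∀ i {Q : Fin n → Set} (Q? : ∀ x → Dec (Q x)) → (# (λ x → inP? i x ×-dec Q? x)) vs ≤ (# Q?) vs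
  #inP∧ i Q? = #-mono (λ x → inP? i x ×-dec Q? x) Q? vs (λ _ _ → proj₂)

  #in-edge : ∀ e → e ∈ H → (# (λ x → ¬? (¬? (x ∈ᵉ? e)))) vs ≤ r
  #in-edge e e∈ = ≤-trans (#-mono (λ x → ¬? (¬? (x ∈ᵉ? e))) (_∈ᵉ? e) vs (λ x _ → decidable-stable (x ∈ᵉ? e)))
    (≤-trans (#-edge-≤ e vs vs-unique) (≤-reflexive (sizes e e∈)))

  r≤rg : r ≤ r * g
  r≤rg = ≤-trans (≤-reflexive (sym (*-identityʳ r))) (*-monoʳ-≤ r 1≤g)

  tw-outside : ∀ e u → e ∈ H → u ∈ vs → u ∈ˢ e → ∃ λ w → w ∈ tws × w ∉ˢ e
  tw-outside e u e∈ u∈vs u∈e = cases (any? (λ w → ¬? (w ∈ᵉ? e)) tws)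
    where
    cases : Dec (Any (λ w → w ∉ˢ e) tws) → ∃ λ w → w ∈ tws × w ∉ˢ e
    cases (yes a) = find a
    cases (no ¬a) = ⊥-elim (<-irrefl refl (≤-trans (s≤s (≤-reflexive (sym length-tws))) (≤-trans
      (Unique-⊆-length {xs = u ∷ tws} {ys = elems e}
        (All.tabulate (λ w∈ eq → w≢v _ _ (proj₁ (tws⁻ _ w∈)) u∈vs (sym eq)) ∷ tws-unique)
        (λ { _ (here refl) → ∈-elems⁺ e u∈e
           ; w (there w∈) → ∈-elems⁺ e (decidable-stable (w ∈ᵉ? e) (λ w∉ → ¬a (lose w∈ w∉))) }))
      (≤-reflexive (trans (length-elems e) (sizes e e∈))))))

  -- The forbidden core consists of `u`, `v`, a typical vertex of `ws` outside `e`, and a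
  -- transversal clique of the other parts; `e` itself joins `u` and `v`.
  edge-meets-part-once : ∀ e i u v → e ∈ H → u ∈ vs → v ∈ vs → u ≢ v → u ∈ˢ e → v ∈ˢ e → InP i u → InP i v → ⊥
  edge-meets-part-once e i u v e∈ u∈ v∈ u≢v u∈e v∈e pu pv = contra (tw-outside e u e∈ u∈ u∈e)
    (transversal-clique Q? (others i) (others-unique i) (≤-trans (≤-reflexive (length-others i)) (n≤1+n k′)) few)
    where
    Q : Fin n → Set
    Q x = x ∉ˢ e × Adj u x × Adj v x
    Q? : ∀ x → Dec (Q x)
    Q? x = ¬? (x ∈ᵉ? e) ×-dec (adj? u x ×-dec adj? v x)
    few : ∀ j → j ∈ others i → (# (λ x → inP? j x ×-dec ¬? (Q? x))) vs ≤ (r + 2 * b₂ + 2 * h₃ + 3) * g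
    few j j∈ = ≤-trans
      (#-⊎ (λ x → inP? j x ×-dec ¬? (Q? x)) (λ x → ¬? (¬? (x ∈ᵉ? e))) (λ x → (inP? j x ×-dec ¬? (adj? u x)) ⊎-dec (inP? j x ×-dec ¬? (adj? v x))) vs
        (λ { x _ (p , ¬q) → split p ¬q (x ∈ᵉ? e) (adj? u x) }))
      (≤-trans (+-mono-≤ (≤-trans (#in-edge e e∈) r≤rg) (≤-trans
        (#-⊎ (λ x → (inP? j x ×-dec ¬? (adj? u x)) ⊎-dec (inP? j x ×-dec ¬? (adj? v x)))
             (λ x → inP? j x ×-dec ¬? (adj? u x)) (λ x → inP? j x ×-dec ¬? (adj? v x)) vs (λ _ _ → id))
        (+-mono-≤ (P-nonAdj i j u (λ eq → ∈-others⁻ i j∈ (sym eq)) pu) (P-nonAdj i j v (λ eq → ∈-others⁻ i j∈ (sym eq)) pv))))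
        (≤-trans (m≤m+n _ ((2 * h₃ + 3) * g)) (≤-reflexive (e₁ r g b₂ h₃))))
      where
      e₁ : ∀ r g b₂ h₃ → r * g + (b₂ * g + b₂ * g) + (2 * h₃ + 3) * g ≡ (r + 2 * b₂ + 2 * h₃ + 3) * g
      e₁ = solve-∀
      split : ∀ {x} → InP j x → ¬ Q x → Dec (x ∈ˢ e) → Dec (Adj u x) →
              ¬ ¬ x ∈ˢ e ⊎ ((InP j x × ¬ Adj u x) ⊎ (InP j x × ¬ Adj v x))
      split p ¬q (yes x∈) _       = inj₁ (λ x∉ → x∉ x∈)
      split p ¬q (no x∉)  (yes a) = inj₂ (inj₂ (p , λ a′ → ¬q (x∉ , a , a′)))
      split p ¬q (no x∉)  (no ¬a) = inj₂ (inj₁ (p , ¬a))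
    contra : (∃ λ w → w ∈ tws × w ∉ˢ e) →
      (∃ λ zs → length zs ≡ length (others i) × AllPairs Adj zs × (∀ z → z ∈ zs → Q z × z ∈ vs × InV₀ z)) → ⊥
    contra (w , w∈ , w∉e) (zs , len , ap , q) = no-clique u v (w ∷ zs) e e∈ u∈e v∈e u≢v
      (λ { z (here refl) → w∉e ; z (there z∈) → proj₁ (proj₁ (q z z∈)) })
      (All.tabulate (λ z∈ → V₀-adj (proj₂ (proj₂ (q _ z∈))) w∈) ∷ ap)
      (λ { z (here refl) → adj-sym (V₀-adj (proj₁ pu) w∈) ; z (there z∈) → proj₁ (proj₂ (proj₁ (q z z∈))) })
      (λ { z (here refl) → adj-sym (V₀-adj (proj₁ pv) w∈) ; z (there z∈) → proj₂ (proj₂ (proj₁ (q z z∈))) })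
      (cong suc (trans len (length-others i)))

-- Colour classes for all vertices outside W

AllPairs-< : {A : Set} {R : A → A → Set} {xs : List A} → AllPairs R xs → ∀ i j → toℕ i < toℕ j → R (lookup xs i) (lookup xs j)
AllPairs-< (h ∷ _)  zero    (suc j) _       = All.lookup h (Mem.∈-lookup j)
AllPairs-< (_ ∷ ap) (suc i) (suc j) (s≤s p) = AllPairs-< ap i j p

-- Adjacency in the complete multipartite graph on the classes, so that Zykov's bound counts
-- transversals. `C` is a cover and may have overlaps.
Apart : ∀ {n k} → (Fin k → Fin n → Set) → Fin n → Fin n → Set
Apart C x z = ¬ ∃ λ i → C i x × C i z

apart? : ∀ {n k} {C : Fin k → Fin n → Set} → (∀ i x → Dec (C i x)) → ∀ x z → Dec (Apart C x z)
apart? C? x z = ¬? (Fin.any? (λ i → C? i x ×-dec C? i z))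

apart-sym : ∀ {n k} {C : Fin k → Fin n → Set} {x z} → Apart C x z → Apart C z x
apart-sym h (i , a , b) = h (i , b , a)

-- By pigeonhole two of `l + 1` vertices share one of the `l` classes listed by `c`. The map `c`
-- allows one part to be left out.
apart-cliqueFree : ∀ {n k l} {C : Fin k → Fin n → Set} (c : Fin l → Fin k) xs →
  (∀ x → x ∈ xs → ∃ λ i → C (c i) x) → CliqueFree (Apart C) l xs
apart-cliqueFree {n} {k} {l} {C} c xs h zs len sub ap =
  let (i , j , i<j , eq) = Fin.pigeonhole (≤-reflexive (sym len)) (λ i → proj₁ (h _ (sub _ (Mem.∈-lookup i))))
  in AllPairs-< ap i j i<j (c (proj₁ (h _ (sub _ (Mem.∈-lookup i))))
       , proj₂ (h _ (sub _ (Mem.∈-lookup i)))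
       , subst (λ z → C (c z) (lookup zs j)) (sym eq) (proj₂ (h _ (sub _ (Mem.∈-lookup j)))))

module Classes {n ρ k′ : ℕ} (S : Setup n ρ k′) (R : Regime S) where

  open Parts S R public

  InSome : Fin n → Set
  InSome x = ∃ λ i → InP i x

  inSome? : ∀ x → Dec (InSome x)
  inSome? x = Fin.any? (λ i → inP? i x)

  P-¬× : ∀ i {A C : Fin n → Set} (A? : ∀ x → Dec (A x)) (C? : ∀ x → Dec (C x)) →
    (# (λ x → inP? i x ×-dec ¬? (A? x ×-dec C? x))) vs ≤
    (# (λ x → inP? i x ×-dec ¬? (A? x))) vs + (# (λ x → inP? i x ×-dec ¬? (C? x))) vs
  P-¬× i {A} {C} A? C? = #-⊎ (λ x → inP? i x ×-dec ¬? (A? x ×-dec C? x)) (λ x → inP? i x ×-dec ¬? (A? x))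
    (λ x → inP? i x ×-dec ¬? (C? x)) vs (λ { x _ (p , h) → split p h (A? x) })
    where
    split : ∀ {x} → InP i x → ¬ (A x × C x) → Dec (A x) → (InP i x × ¬ A x) ⊎ (InP i x × ¬ C x)
    split p h (yes a) = inj₂ (p , λ c → h (a , c))
    split p h (no ¬a) = inj₁ (p , ¬a)

  #P∉edge : ∀ i e → e ∈ H → (# (λ x → inP? i x ×-dec ¬? (¬? (x ∈ᵉ? e)))) vs ≤ r * g
  #P∉edge i e e∈ = ≤-trans (#inP∧ i (λ x → ¬? (¬? (x ∈ᵉ? e)))) (≤-trans (#in-edge e e∈) r≤rg)

  module AtVertex (v : Fin n) (v∈ : v ∈ vs) where

    E : ℕ
    E = g * N ^ ρ

    sv : ℕ
    sv = (# (λ w → adj? w v)) ws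

    xs : List (Fin n)
    xs = filter (λ x → adj? v x ×-dec inSome? x) vs

    xs⁻ : ∀ {x} → x ∈ xs → x ∈ vs × Adj v x × InSome x
    xs⁻ = Mem.∈-filter⁻ (λ x → adj? v x ×-dec inSome? x) {xs = vs}

    xs-unique : Unique xs
    xs-unique = UniqueP.filter⁺ (λ x → adj? v x ×-dec inSome? x) vs-unique

    length-xs≤N : length xs ≤ N
    length-xs≤N = ≤-trans (ListP.length-filter (λ x → adj? v x ×-dec inSome? x) vs) m≤N

    strays : List (Fin n)
    strays = filter notP? vs

    length-strays : length strays ≤ b * g
    length-strays = ≤-trans (≤-reflexive (length-filter≡# notP? vs)) #notP

    -- At a single vertex the edges with a bad pair away from `v` may be too many, so they are
    -- tolerated here. For the remaining edges it is `edge-meets-part-once`, not adjacency, that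
    -- makes the traces cliques; this requires all other vertices to lie in parts, hence `Stray`.
    BadV BadW Stray Exceptional : Subset n → Set
    BadV = PairIn (λ x y → x ≢ y × Bad x y) (v ∷ []) vs
    BadW = PairIn Bad ws (v ∷ [])
    Stray = PairIn (λ _ u → u ≢ v) ws strays
    Exceptional e = TwoW e ⊎ BadV e ⊎ BadW e ⊎ Stray e

    badV? : ∀ e → Dec (BadV e)
    badV? = pairIn? (λ x y → ≢? x y ×-dec bad? x y) (v ∷ []) vs
    badW? : ∀ e → Dec (BadW e)
    badW? = pairIn? bad? ws (v ∷ [])
    stray? : ∀ e → Dec (Stray e)
    stray? = pairIn? (λ _ u → ≢? u v) ws strays
    exceptional? : ∀ e → Dec (Exceptional e)
    exceptional? e = twoW? e ⊎-dec (badV? e ⊎-dec (badW? e ⊎-dec stray? e))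

    codegree-rooted : ∀ x z → v ≢ x → v ≢ z → x ≢ z →
      (# (λ e → (v ∈ᵉ? e) ×-dec ((x ∈ᵉ? e) ×-dec (z ∈ᵉ? e)))) H ≤ N ^ ρ
    codegree-rooted x z v≢x v≢z x≢z = ≤-trans
      (#-mono (λ e → (v ∈ᵉ? e) ×-dec ((x ∈ᵉ? e) ×-dec (z ∈ᵉ? e))) (λ e → all? (_∈ᵉ? e) (v ∷ x ∷ z ∷ [])) H
        (λ { _ _ (a , b , c) → a ∷ b ∷ c ∷ [] }))
      (codegree₃ v x z v≢x v≢z x≢z)

    #exceptional : (# (λ e → (v ∈ᵉ? e) ×-dec exceptional? e)) H ≤ s * ((b + 1) * E)
    #exceptional = begin
      (# (λ e → (v ∈ᵉ? e) ×-dec exceptional? e)) H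
        ≤⟨ ≤-trans (#-⊎ (λ e → (v ∈ᵉ? e) ×-dec exceptional? e) A? (λ e → badV? e ⊎-dec (badW? e ⊎-dec D? e)) H
                     (λ { _ _ (p , inj₁ a) → inj₁ (p , a) ; _ _ (p , inj₂ (inj₁ a)) → inj₂ (inj₁ a)
                        ; _ _ (p , inj₂ (inj₂ (inj₁ a))) → inj₂ (inj₂ (inj₁ a))
                        ; _ _ (p , inj₂ (inj₂ (inj₂ a))) → inj₂ (inj₂ (inj₂ (p , a))) }))
             (+-monoʳ-≤ _ (≤-trans (#-⊎ (λ e → badV? e ⊎-dec (badW? e ⊎-dec D? e)) badV? (λ e → badW? e ⊎-dec D? e) H (λ _ _ → id))
               (+-monoʳ-≤ _ (#-⊎ (λ e → badW? e ⊎-dec D? e) badW? D? H (λ _ _ → id))))) ⟩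
      (# A?) H + ((# badV?) H + ((# badW?) H + (# D?) H))
        ≤⟨ +-mono-≤
             (#-pairIn ≢? (v ∈ᵉ?_) H ws ws (N ^ ρ) (λ w w′ w∈ w′∈ w≢w′ →
               codegree-rooted w w′ (λ eq → w≢v w v w∈ v∈ (sym eq)) (λ eq → w≢v w′ v w′∈ v∈ (sym eq)) w≢w′))
             (+-mono-≤
               (#-pairs (λ x y → ≢? x y ×-dec bad? x y) (v ∷ []) vs (L * N ^ ρ)
                 (λ { x y _ _ (x≢y , bad) → codegree-bad x y x≢y bad }))
               (+-mono-≤
                 (#-pairs bad? ws (v ∷ []) (L * N ^ ρ) (λ { x y x∈ (here refl) bad → codegree-bad x y (w≢v x y x∈ v∈) bad }))
                 (≤-trans (#-pairIn (λ _ u → ≢? u v) (v ∈ᵉ?_) H ws strays (N ^ ρ) (λ w u w∈ u∈ u≢v →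
                             codegree-rooted w u (λ eq → w≢v w v w∈ v∈ (sym eq)) (λ eq → u≢v (sym eq))
                               (w≢v w u w∈ (proj₁ (Mem.∈-filter⁻ notP? {xs = vs} u∈)))))
                          (*-monoʳ-≤ s (*-monoˡ-≤ (N ^ ρ) length-strays))))) ⟩
      s * (s * P) + (1 * (m * (L * P)) + (s * (1 * (L * P)) + s * (b * g * P)))
        ≤⟨ cert s m L P b g h-deg ⟩
      s * ((b + 1) * (g * P)) ∎
      where
      open ≤-Reasoning
      P = N ^ ρ
      A? : ∀ e → Dec (v ∈ˢ e × TwoW e)
      A? e = (v ∈ᵉ? e) ×-dec twoW? e
      D? : ∀ e → Dec (v ∈ˢ e × Stray e)
      D? e = (v ∈ᵉ? e) ×-dec stray? e
      cert : ∀ s m L P b g → s * s + m * L + s * L ≤ s * g →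
        s * (s * P) + (1 * (m * (L * P)) + (s * (1 * (L * P)) + s * (b * g * P))) ≤ s * ((b + 1) * (g * P))
      cert s m L P b g p = ≤-cert ((s * s + m * L + s * L) * P) (s * g * P) 0 (*-monoˡ-≤ P p) (e s m L P b g)
        where
        e : ∀ s m L P b g → s * (s * P) + (1 * (m * (L * P)) + (s * (1 * (L * P)) + s * (b * g * P))) + s * g * P + 0
            ≡ s * ((b + 1) * (g * P)) + (s * s + m * L + s * L) * P
        e = solve-∀

    Z : ℕ
    Z = cliques (apart? inP?) (1 + ρ) xs

    ordinary-at-w : ∀ w → w ∈ ws →
      (# (λ e → (w ∈ᵉ? e) ×-dec ((v ∈ᵉ? e) ×-dec ¬? (exceptional? e)))) H ≤ Z * 𝟙 (adj? w v)
    ordinary-at-w w w∈ = cases (adj? w v)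
      where
      P? : ∀ e → Dec (w ∈ˢ e × v ∈ˢ e × ¬ Exceptional e)
      P? e = (w ∈ᵉ? e) ×-dec ((v ∈ᵉ? e) ×-dec ¬? (exceptional? e))
      in-xs : ∀ e → e ∈ H → w ∈ˢ e → v ∈ˢ e → ¬ Exceptional e → ∀ x → x ∈ˢ e → x ∈ vs → Dec (x ≡ v) → Dec (NotP x) →
              x ∈ w ∷ v ∷ xs
      in-xs e e∈ w∈e v∈e ¬ex x x∈e x∈vs (yes refl) _        = there (here refl)
      in-xs e e∈ w∈e v∈e ¬ex x x∈e x∈vs (no x≢v)   (yes np) = ⊥-elim (¬ex (inj₂ (inj₂ (inj₂
        (pairIn w∈ (Mem.∈-filter⁺ notP? x∈vs np) x≢v w∈e x∈e)))))
      in-xs e e∈ w∈e v∈e ¬ex x x∈e x∈vs (no x≢v)   (no ¬np) = there (there (Mem.∈-filter⁺ _ x∈vs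
        (((λ eq → x≢v (sym eq)) , λ bad → ¬ex (inj₂ (inj₁ (pairIn (here refl) x∈vs ((λ eq → x≢v (sym eq)) , bad) v∈e x∈e))))
        , decidable-stable (inSome? x) ¬np)))
      cases : (d : Dec (Adj w v)) → (# P?) H ≤ Z * 𝟙 d
      cases (no ¬a) = ≤-trans (≤-reflexive (#-none P? H (λ { e e∈ (w∈e , v∈e , ¬ex) →
        ¬a (w≢v w v w∈ v∈ , λ bad → ¬ex (inj₂ (inj₂ (inj₁ (pairIn w∈ (here refl) bad w∈e v∈e))))) }))) z≤n
      cases (yes a) = ≤-trans
        (#link≤cliques (apart? inP?) uniqH (1 + ρ) P? (w ∷ v ∷ []) xs
          ((proj₁ a ∷ All.tabulate (λ x∈ → w≢v _ _ w∈ (proj₁ (xs⁻ x∈))))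
            ∷ All.tabulate (λ x∈ → proj₁ (proj₁ (proj₂ (xs⁻ x∈)))) ∷ xs-unique)
          (λ { e e∈ (w∈e , v∈e , ¬ex) → (λ { x (here refl) → w∈e ; x (there (here refl)) → v∈e })
             , (λ x x∈e → [ (λ { refl → here refl })
                          , (λ x∈vs → in-xs e e∈ w∈e v∈e ¬ex x x∈e x∈vs (x Fin.≟ v) (notP? x)) ]′
                          (clique-link e∈ (λ t → ¬ex (inj₁ t)) w∈ w∈e x∈e))
             , sizes e e∈ })
          (λ { e e∈ _ x z x∈ z∈ x≢z x∈e z∈e (i , px , pz) →
             edge-meets-part-once e i x z e∈ (proj₁ (xs⁻ x∈)) (proj₁ (xs⁻ z∈)) x≢z x∈e z∈e px pz }))
        (≤-reflexive (sym (*-identityʳ Z)))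

    -- An ordinary edge at `v` is a neighbour of `v` in `ws` together with a transversal of the
    -- parts among the neighbours of `v`. The two choices are bounded separately, by `sv` and by
    -- `Z`.
    degree-bound : s * T₁ ≤ s * ((b + 1) * E) + Z * sv
    degree-bound = begin
      s * T₁ ≤⟨ min-degree v v∈ ⟩
      (# (v ∈ᵉ?_)) H
        ≤⟨ #-⊎ (v ∈ᵉ?_) (λ e → (v ∈ᵉ? e) ×-dec exceptional? e) Ord? H (λ e _ v∈e → em v∈e (exceptional? e)) ⟩
      (# (λ e → (v ∈ᵉ? e) ×-dec exceptional? e)) H + (# Ord?) H
        ≤⟨ +-mono-≤ #exceptional (≤-trans
             (#-hit Ord? (λ w e → (w ∈ᵉ? e) ×-dec Ord? e) H ws
               (λ { e e∈ q → let (w , w∈ , w∈e) = meets e e∈ in w , w∈ , w∈e , q }))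
             (≤-trans (∑-mono ws ordinary-at-w) (≤-reflexive (∑-*ˡ Z ws _)))) ⟩
      s * ((b + 1) * E) + Z * sv ∎
      where
      open ≤-Reasoning
      Ord? : ∀ e → Dec (v ∈ˢ e × ¬ Exceptional e)
      Ord? e = (v ∈ᵉ? e) ×-dec ¬? (exceptional? e)
      em : ∀ {e} → v ∈ˢ e → Dec (Exceptional e) → (v ∈ˢ e × Exceptional e) ⊎ (v ∈ˢ e × ¬ Exceptional e)
      em p (yes q) = inj₁ (p , q)
      em p (no ¬q) = inj₂ (p , ¬q)

    sv≤s : sv ≤ s
    sv≤s = #≤length (λ w → adj? w v) ws

    -- Already with the trivial bound `Z ≤ B * T₁`, the minimum degree gives `v` at least
    -- `s / (2 * B)` neighbours in `ws`, more than there are atypical vertices.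
    cw<sv : cw < sv
    cw<sv = ≰⇒> λ sv≤cw → <⇒≱ (≤-trans (s≤s (m≤m+n (2 * B * cw) (2 * (cw + r)))) (≤-trans (≤-reflexive (+-comm 1 _)) h-s))
      (≤-trans s≤2Bsv (*-monoʳ-≤ (2 * B) sv≤cw))
      where
      cert : ∀ s T b E B sv κ k h Z → κ ≡ 2 * k + h + b + 1 → s * T ≤ s * ((b + 1) * E) + Z * sv →
             8 * κ * E ≤ T → Z ≤ B * T → T * s ≤ T * (2 * B * sv)
      cert s T b E B sv _ k h Z refl p q z = ≤-cert
        (2 * (s * T) + s * (8 * (2 * k + h + b + 1) * E) + 2 * (Z * sv))
        (2 * (s * ((b + 1) * E) + Z * sv) + s * T + 2 * (B * T * sv))
        (s * ((16 * k + 8 * h + 6 * (b + 1)) * E))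
        (+-mono-≤ (+-mono-≤ (*-monoʳ-≤ 2 p) (*-monoʳ-≤ s q)) (*-monoʳ-≤ 2 (*-monoˡ-≤ sv z)))
        (e s T b E B sv k h Z)
        where
        e : ∀ s T b E B sv k h Z →
          T * s + (2 * (s * ((b + 1) * E) + Z * sv) + s * T + 2 * (B * T * sv)) + s * ((16 * k + 8 * h + 6 * (b + 1)) * E)
          ≡ T * (2 * B * sv) + (2 * (s * T) + s * (8 * (2 * k + h + b + 1) * E) + 2 * (Z * sv))
        e = solve-∀
      Z≤ : Z ≤ B * T₁
      Z≤ = ≤-trans (cliques-upper (apart? inP?) (1 + ρ) xs) (≤-trans (^-monoˡ-≤ (1 + ρ) length-xs≤N) N₁)
      s≤2Bsv : s ≤ 2 * B * sv
      s≤2Bsv = *-cancelˡ-≤ T₁ (cert s T₁ b E B sv κ k h Z κ≡ degree-bound N₀ Z≤)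

    inN : Fin k → ℕ
    inN i = (# (λ x → inP? i x ×-dec adj? v x)) vs

    -- Otherwise the common neighbourhood of `v` and a typical `w` adjacent to it would contain a
    -- transversal clique. In `h`, the term `k * b₂` pays for the greedy steps and 1 for the
    -- vertices not adjacent to `w`.
    not-all-large : ¬ (∀ i → h * g < inN i)
    not-all-large large = contra (greedy Q? (allFin k) (UniqueP.allFin⁺ k) few)
      where
      next = #-exists-within (λ w → adj? w v) typW? ws
        (≤-trans (s≤s (≤-trans (#-mono (λ w → adj? w v ×-dec ¬? (typW? w)) (λ w → ¬? (typW? w)) ws (λ _ _ → proj₂)) #atypical-w)) cw<sv)
      w = proj₁ next
      w∈ = proj₁ (proj₂ next)
      wv = proj₁ (proj₂ (proj₂ next))
      wt = proj₂ (proj₂ (proj₂ next))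
      Q : Fin n → Set
      Q x = Adj v x × Adj w x
      Q? : ∀ x → Dec (Q x)
      Q? x = adj? v x ×-dec adj? w x
      few : ∀ i → i ∈ allFin k → (# (λ x → inP? i x ×-dec ¬? (Q? x))) vs + length (allFin k) * (b₂ * g) < |P| i
      few i _ = cert k b₂ g h ((# (λ x → inP? i x ×-dec ¬? (adj? v x))) vs)
                  ((# (λ x → inP? i x ×-dec ¬? (Q? x))) vs) (inN i) (|P| i) (length (allFin k)) h≡ (ListP.length-tabulate {n = k} id)
        (≤-trans (P-¬× i (adj? v) (adj? w)) (+-monoʳ-≤ _ (≤-trans (#inP∧ i (λ x → ¬? (adj? w x))) wt)))
        (large i)
        (#-disjoint (λ x → inP? i x ×-dec adj? v x) (λ x → inP? i x ×-dec ¬? (adj? v x)) (inP? i) vs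
          (λ _ _ → proj₁) (λ _ _ → proj₁) (λ { _ _ (_ , a) (_ , ¬a) → ¬a a }))
        where
        cert : ∀ k b₂ g h x q N P l → h ≡ k * b₂ + 1 → l ≡ k → q ≤ x + g → h * g < N → N + x ≤ P → q + l * (b₂ * g) < P
        cert k b₂ g _ x q N P _ refl refl p₁ p₂ p₃ = ≤-cert (q + suc ((k * b₂ + 1) * g) + (N + x)) (x + g + N + P) 0
          (+-mono-≤ (+-mono-≤ p₁ p₂) p₃) (e k b₂ g x q N P)
          where
          e : ∀ k b₂ g x q N P → suc (q + k * (b₂ * g)) + (x + g + N + P) + 0 ≡ P + (q + suc ((k * b₂ + 1) * g) + (N + x))
          e = solve-∀
      contra : (∃ λ zs → length zs ≡ length (allFin k) × AllPairs Adj zs × (∀ z → z ∈ zs → Q z × z ∈ vs × InV₀ z)) → ⊥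
      contra (zs , len , ap , q) = no-adj-clique w v zs wv ap (λ z z∈ → proj₂ (proj₁ (q z z∈))) (λ z z∈ → proj₁ (proj₁ (q z z∈)))
        (trans len (ListP.length-tabulate {n = k} id))

    sparse-part : ∃ λ i → inN i ≤ h * g
    sparse-part = cases (Fin.any? (λ i → inN i ≤? h * g))
      where
      cases : Dec (∃ λ i → inN i ≤ h * g) → ∃ λ i → inN i ≤ h * g
      cases (yes p) = p
      cases (no ¬p) = ⊥-elim (not-all-large λ i → ≰⇒> λ le → ¬p (i , le))

    module WithPart (i : Fin k) (sparse : inN i ≤ h * g) where

      xs′ : List (Fin n)
      xs′ = filter (λ x → ¬? (inP? i x)) xs

      x : ℕ
      x = length xs′

      xs′⁻ : ∀ {z} → z ∈ xs′ → z ∈ xs × ¬ InP i z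
      xs′⁻ = Mem.∈-filter⁻ (λ x → ¬? (inP? i x)) {xs = xs}

      xs′-free : CliqueFree (Apart InP) k′ xs′
      xs′-free = apart-cliqueFree (punchIn i) xs′ λ z z∈ → index z (proj₂ (proj₂ (xs⁻ (proj₁ (xs′⁻ z∈))))) (proj₂ (xs′⁻ z∈))
        where
        index : ∀ z → InSome z → ¬ InP i z → ∃ λ j → InP (punchIn i j) z
        index z (j , p) ¬pi = punchOut i≢j , subst (λ l → InP l z) (sym (Fin.punchIn-punchOut i≢j)) p
          where
          i≢j : i ≢ j
          i≢j eq = ¬pi (subst (λ l → InP l z) (sym eq) p)

      -- Without the sparse part only `k′` parts remain, which gives the Turán term. Transversals
      -- through the sparse part are few because `v` has few neighbours there.
      Z≤ : Z ≤ turán (1 + ρ) k′ x + h * E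
      Z≤ = ≤-trans (cliques-cover (apart? inP?) (apart-sym {C = InP}) (λ x → ¬? (inP? i x)) ρ xs) (+-mono-≤
        (cliques≤turán (apart? inP?) (apart-sym {C = InP}) (1 + ρ) k′ xs′ xs′-free)
        (≤-trans (∑-bound us (N ^ ρ) (λ u _ → ≤-trans (cliques-upper (apart? inP?) ρ _)
            (^-monoˡ-≤ ρ (≤-trans (ListP.length-filter (apart? inP? u) xs) length-xs≤N))))
          (≤-trans (*-monoˡ-≤ (N ^ ρ) (≤-trans length-us sparse)) (≤-reflexive (*-assoc h g (N ^ ρ))))))
        where
        us = filter (λ x → ¬? (¬? (inP? i x))) xs
        length-us : length us ≤ inN i
        length-us = ≤-trans (≤-reflexive (trans (length-filter≡# (λ x → ¬? (¬? (inP? i x))) xs)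
            (#-filter (λ x → ¬? (¬? (inP? i x))) (λ x → adj? v x ×-dec inSome? x) vs)))
          (#-mono (λ x → (adj? v x ×-dec inSome? x) ×-dec ¬? (¬? (inP? i x))) (λ x → inP? i x ×-dec adj? v x) vs
            (λ { x _ ((a , _) , ¬¬p) → decidable-stable (inP? i x) ¬¬p , a }))

      T₁≤ : T₁ ≤ turán (1 + ρ) k′ x + (h + b + 1) * E
      T₁≤ = *-cancelˡ-≤ s (cert s T₁ b E h sv Z (turán (1 + ρ) k′ x) degree-bound Z≤ sv≤s)
        where
        cert : ∀ s T b E h sv Z X → s * T ≤ s * ((b + 1) * E) + Z * sv → Z ≤ X + h * E → sv ≤ s →
               s * T ≤ s * (X + (h + b + 1) * E)
        cert s T b E h sv Z X p q u = ≤-trans p (≤-trans (+-monoʳ-≤ _ (*-mono-≤ q u)) (≤-reflexive (e s b E h X)))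
          where
          e : ∀ s b E h X → s * ((b + 1) * E) + (X + h * E) * s ≡ s * (X + (h + b + 1) * E)
          e = solve-∀

      -- `turán-deficit` converts a nearly maximal number of transversals back into a nearly maximal
      -- number of neighbours.
      D≤ : D ≤ x + h₂ * g
      D≤ = cases (x ≤? D)
        where
        cert : ∀ D d T X c g M B h₂ → h₂ ≡ c * B → D * X + d * T ≤ D * T → T ≤ X + c * (g * M) → D * M ≤ B * T →
               T * d ≤ T * (h₂ * g)
        cert D d T X c g M B _ refl p q u = ≤-cert (D * X + d * T + D * T + c * g * (D * M))
          (D * T + D * (X + c * (g * M)) + c * g * (B * T)) 0
          (+-mono-≤ (+-mono-≤ p (*-monoʳ-≤ D q)) (*-monoʳ-≤ (c * g) u)) (e D d T X c g M B)
          where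
          e : ∀ D d T X c g M B → T * d + (D * T + D * (X + c * (g * M)) + c * g * (B * T)) + 0
                                ≡ T * (c * B * g) + (D * X + d * T + D * T + c * g * (D * M))
          e = solve-∀
        cases : Dec (x ≤ D) → D ≤ x + h₂ * g
        cases (no ¬p) = ≤-trans (<⇒≤ (≰⇒> ¬p)) (m≤m+n x _)
        cases (yes p) = ≤-trans (m≤n+m∸n D x) (+-monoʳ-≤ x (*-cancelˡ-≤ T₁
          (cert D (D ∸ x) T₁ (turán (1 + ρ) k′ x) (h + b + 1) g (N ^ ρ) B h₂ h₂≡
            (turán-deficit ρ k′ p) T₁≤ (≤-trans (*-monoˡ-≤ (N ^ ρ) D≤N) N₁))))

      #other-parts : (# (λ z → inSome? z ×-dec ¬? (inP? i z))) vs ≤ k′ * (μ + 2 * g)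
      #other-parts = ≤-trans
        (#-hit (λ z → inSome? z ×-dec ¬? (inP? i z)) inP? vs (others i)
          (λ { z _ ((j , p) , ¬pi) → j , other j (λ eq → ¬pi (subst (λ l → InP l z) eq p)) , p }))
        (≤-trans (∑-bound (others i) (μ + 2 * g) (λ j _ → |P|≤ j)) (≤-reflexive (cong (_* (μ + 2 * g)) (length-others i))))
        where
        other : ∀ j → j ≢ i → j ∈ others i
        other j j≢i = subst (_∈ others i) (Fin.punchIn-punchOut (λ eq → j≢i (sym eq)))
                            (Mem.∈-map⁺ (punchIn i) (Mem.∈-allFin (punchOut (λ eq → j≢i (sym eq)))))

      x≡# : x ≡ (# (λ z → (adj? v z ×-dec inSome? z) ×-dec ¬? (inP? i z))) vs
      x≡# = trans (length-filter≡# (λ x → ¬? (inP? i x)) xs) (#-filter (λ x → ¬? (inP? i x)) (λ x → adj? v x ×-dec inSome? x) vs)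

      -- `v` has nearly `D ≥ k′ * μ` neighbours in the parts other than `i`, and those parts hold
      -- hardly more vertices.
      missing≤ : ∀ j → j ≢ i → (# (λ z → inP? j z ×-dec ¬? (adj? v z))) vs ≤ h₃ * g
      missing≤ j j≢i = cert k′ μ D x h₂ h₃ g ((# (λ z → inP? j z ×-dec ¬? (adj? v z))) vs) m₁ h₃≡ D≤ D+μ kμ≤m₁
        (≤-trans (+-monoˡ-≤ _ (≤-reflexive x≡#)) (≤-trans
          (#-disjoint (λ z → (adj? v z ×-dec inSome? z) ×-dec ¬? (inP? i z)) (λ z → inP? j z ×-dec ¬? (adj? v z))
            (λ z → inSome? z ×-dec ¬? (inP? i z)) vs
            (λ { _ _ ((_ , p) , q) → p , q }) (λ { z _ (p , _) → (j , p) , λ q → P-disjoint j i z j≢i p q })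
            (λ { _ _ ((a , _) , _) (_ , ¬a) → ¬a a }))
          #other-parts))
        where
        cert : ∀ k′ μ D x h₂ h₃ g y m₁ → h₃ ≡ 2 * suc k′ + h₂ → D ≤ x + h₂ * g → D + μ ≡ m₁ → suc k′ * μ ≤ m₁ →
               x + y ≤ k′ * (μ + 2 * g) → y ≤ h₃ * g
        cert k′ μ D x h₂ _ g y _ refl p refl q u = ≤-cert (D + suc k′ * μ + (x + y)) (x + h₂ * g + (D + μ) + k′ * (μ + 2 * g)) (2 * g)
          (+-mono-≤ (+-mono-≤ p q) u) (e k′ μ D x h₂ g y)
          where
          e : ∀ k′ μ D x h₂ g y → y + (x + h₂ * g + (D + μ) + k′ * (μ + 2 * g)) + 2 * g
                                ≡ (2 * suc k′ + h₂) * g + (D + suc k′ * μ + (x + y))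
          e = solve-∀

      2k′g≤μ : 2 * k′ * g ≤ μ
      2k′g≤μ = ≤-trans (cert k′ g r b b₂ h₃ Λ Λ≡) Λg≤μ
        where
        cert : ∀ k′ g r b b₂ h₃ Λ → Λ ≡ r + 2 * b₂ + 2 * h₃ + 4 + suc k′ * b₂ + b + 2 * suc k′ → 2 * k′ * g ≤ Λ * g
        cert k′ g r b b₂ h₃ _ refl = ≤-trans (m≤m+n _ ((r + 2 * b₂ + 2 * h₃ + 6 + suc k′ * b₂ + b) * g))
          (≤-reflexive (e k′ g r b b₂ h₃))
          where
          e : ∀ k′ g r b b₂ h₃ → 2 * k′ * g + (r + 2 * b₂ + 2 * h₃ + 6 + suc k′ * b₂ + b) * g
            ≡ (r + 2 * b₂ + 2 * h₃ + 4 + suc k′ * b₂ + b + 2 * suc k′) * g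
          e = solve-∀

      x≤ : x ≤ 2 * k′ * g + D
      x≤ = cert k′ μ g D m₁ x D+μ kμ≤m₁
        (≤-trans (≤-reflexive x≡#) (≤-trans (#-mono (λ z → (adj? v z ×-dec inSome? z) ×-dec ¬? (inP? i z))
          (λ z → inSome? z ×-dec ¬? (inP? i z)) vs (λ { _ _ ((_ , p) , q) → p , q })) #other-parts))
        where
        cert : ∀ k′ μ g D m₁ x → D + μ ≡ m₁ → suc k′ * μ ≤ m₁ → x ≤ k′ * (μ + 2 * g) → x ≤ 2 * k′ * g + D
        cert k′ μ g D _ x refl p q = ≤-cert (suc k′ * μ + x) (D + μ + k′ * (μ + 2 * g)) 0 (+-mono-≤ p q) (e k′ μ g D x)
          where
          e : ∀ k′ μ g D x → x + (D + μ + k′ * (μ + 2 * g)) + 0 ≡ 2 * k′ * g + D + (suc k′ * μ + x)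
          e = solve-∀

      turán-x≤ : turán (1 + ρ) k′ x ≤ T₁ + 2 * k * E
      turán-x≤ = ≤-trans (turán-mono (1 + ρ) k′ x≤) (≤-trans (turán-lipschitz ρ k′ D (2 * k′ * g)) (+-monoʳ-≤ T₁
        (≤-trans (*-monoʳ-≤ (2 * k′ * g) (^-monoˡ-≤ ρ in-range)) (cert k′ g (N ^ ρ)))))
        where
        in-range : 2 * k′ * g + D ≤ N
        in-range = ≤-trans (+-monoˡ-≤ D 2k′g≤μ) (≤-trans (≤-reflexive (trans (+-comm μ D) D+μ))
          (≤-trans (n≤1+n m₁) (≤-trans (≤-reflexive (sym m≡)) m≤N)))
        cert : ∀ k′ g M → 2 * k′ * g * M ≤ 2 * suc k′ * (g * M)
        cert k′ g M = ≤-trans (m≤m+n _ (2 * (g * M))) (≤-reflexive (e k′ g M))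
          where
          e : ∀ k′ g M → 2 * k′ * g * M + 2 * (g * M) ≡ 2 * suc k′ * (g * M)
          e = solve-∀

      -- By `N₀` the errors are at most an eighth of `T₁`: the exceptional edges cost at most
      -- `s * T₁ / 8`, and `Z` is at most nine eighths of `T₁`. Hence `sv` is at least `7 / 9` of
      -- `s`.
      nonAdj-w≤ : 9 * (# (λ w → ¬? (adj? w v))) ws ≤ 2 * s
      nonAdj-w≤ = cert₂ s sv ((# (λ w → ¬? (adj? w v))) ws) (#-complement (λ w → adj? w v) ws)
        (*-cancelˡ-≤ T₁ (cert₁ s T₁ b E h sv Z (turán (1 + ρ) k′ x) k κ κ≡ degree-bound Z≤ turán-x≤ N₀))
        where
        cert₁ : ∀ s T b E h sv Z X k κ → κ ≡ 2 * k + h + b + 1 → s * T ≤ s * ((b + 1) * E) + Z * sv → Z ≤ X + h * E →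
                X ≤ T + 2 * k * E → 8 * κ * E ≤ T → T * (7 * s) ≤ T * (9 * sv)
        cert₁ s T b E h sv Z X k _ refl p q u c = ≤-cert
          (8 * (s * T) + 8 * (Z * sv) + 8 * (X * sv) + s * (8 * (2 * k + h + b + 1) * E) + sv * (8 * (2 * k + h + b + 1) * E))
          (8 * (s * ((b + 1) * E) + Z * sv) + 8 * ((X + h * E) * sv) + 8 * ((T + 2 * k * E) * sv) + s * T + sv * T)
          (s * (8 * (2 * k + h) * E) + sv * (8 * (b + 1) * E))
          (+-mono-≤ (+-mono-≤ (+-mono-≤ (+-mono-≤ (*-monoʳ-≤ 8 p) (*-monoʳ-≤ 8 (*-monoˡ-≤ sv q)))
            (*-monoʳ-≤ 8 (*-monoˡ-≤ sv u))) (*-monoʳ-≤ s c)) (*-monoʳ-≤ sv c))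
          (e s T b E h sv Z X k)
          where
          e : ∀ s T b E h sv Z X k →
            T * (7 * s) + (8 * (s * ((b + 1) * E) + Z * sv) + 8 * ((X + h * E) * sv) + 8 * ((T + 2 * k * E) * sv) + s * T + sv * T)
              + (s * (8 * (2 * k + h) * E) + sv * (8 * (b + 1) * E))
            ≡ T * (9 * sv) + (8 * (s * T) + 8 * (Z * sv) + 8 * (X * sv) + s * (8 * (2 * k + h + b + 1) * E) + sv * (8 * (2 * k + h + b + 1) * E))
          e = solve-∀
        cert₂ : ∀ s sv y → sv + y ≡ s → 7 * s ≤ 9 * sv → 9 * y ≤ 2 * s
        cert₂ _ sv y refl p = ≤-cert (7 * (sv + y)) (9 * sv) 0 p (e sv y)
          where
          e : ∀ sv y → 9 * y + 9 * sv + 0 ≡ 2 * (sv + y) + 7 * (sv + y)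
          e = solve-∀

  -- What is needed for `v` to act like a vertex of part `i` in an embedding, with `v` possibly
  -- atypical. The fraction `2 / 9` is below one half, so that two such vertices have common
  -- neighbours in `ws`.
  Class : Fin k → Fin n → Set
  Class i v = (∀ j → j ≢ i → (# (λ z → inP? j z ×-dec ¬? (adj? v z))) vs ≤ h₃ * g)
            × 9 * (# (λ w → ¬? (adj? w v))) ws ≤ 2 * s

  class? : ∀ i v → Dec (Class i v)
  class? i v = Fin.all? (λ j → ¬? (j Fin.≟ i) →-dec ((# (λ z → inP? j z ×-dec ¬? (adj? v z))) vs ≤? h₃ * g))
               ×-dec (9 * (# (λ w → ¬? (adj? w v))) ws ≤? 2 * s)

  classify : ∀ v → v ∈ vs → ∃ λ i → Class i v
  classify v v∈ = i , WithPart.missing≤ i sparse , WithPart.nonAdj-w≤ i sparse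
    where
    open AtVertex v v∈
    i = proj₁ sparse-part
    sparse = proj₂ sparse-part

-- The exact bound under a minimum degree condition

module Conclusion {n ρ k′ : ℕ} (S : Setup n ρ k′) (R : Regime S) where

  open Classes S R

  -- `u` and `v` together miss at most `4 / 9` of `ws`, and the atypical vertices and those in `e`
  -- are fewer than the rest. So there is a typical `w` outside `e` adjacent to both; a transversal
  -- clique of the other parts completes the core.
  same-class-apart : ∀ e i u v → e ∈ H → u ∈ vs → v ∈ vs → u ≢ v → u ∈ˢ e → v ∈ˢ e → Class i u → Class i v → ⊥
  same-class-apart e i u v e∈ u∈ v∈ u≢v u∈e v∈e cu cv = contra
    (transversal-clique Q? (others i) (others-unique i) (≤-trans (≤-reflexive (length-others i)) (n≤1+n k′)) few)
    where
    W? : ∀ w → Dec (TypW w × (w ∉ˢ e × (Adj w u × Adj w v)))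
    W? w = typW? w ×-dec (¬? (w ∈ᵉ? e) ×-dec (adj? w u ×-dec adj? w v))
    next : ∃ λ w → w ∈ ws × (TypW w × (w ∉ˢ e × (Adj w u × Adj w v)))
    next = #-exists W? ws (cert s cw r ((# (λ w → ¬? (W? w))) ws) B a c₁ c₂ c₃
        (≤-trans (#-¬× typW? (λ w → ¬? (w ∈ᵉ? e) ×-dec (adj? w u ×-dec adj? w v)) ws)
          (+-monoʳ-≤ a (≤-trans (#-¬× (λ w → ¬? (w ∈ᵉ? e)) (λ w → adj? w u ×-dec adj? w v) ws)
            (+-monoʳ-≤ c₁ (#-¬× (λ w → adj? w u) (λ w → adj? w v) ws)))))
        #atypical-w in-e (proj₂ cu) (proj₂ cv) h-s)
      where
      a = (# (λ w → ¬? (typW? w))) ws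
      c₁ = (# (λ w → ¬? (¬? (w ∈ᵉ? e)))) ws
      c₂ = (# (λ w → ¬? (adj? w u))) ws
      c₃ = (# (λ w → ¬? (adj? w v))) ws
      in-e : c₁ ≤ r
      in-e = ≤-trans (#-mono (λ w → ¬? (¬? (w ∈ᵉ? e))) (_∈ᵉ? e) ws (λ w _ → decidable-stable (w ∈ᵉ? e)))
        (≤-trans (#-edge-≤ e ws ws-unique) (≤-reflexive (sizes e e∈)))
      cert : ∀ s cw r q B a c₁ c₂ c₃ → q ≤ a + (c₁ + (c₂ + c₃)) → a ≤ cw → c₁ ≤ r → 9 * c₂ ≤ 2 * s → 9 * c₃ ≤ 2 * s →
             2 * B * cw + 2 * (cw + r) + 1 ≤ s → q < s
      cert s cw r q B a c₁ c₂ c₃ p₁ p₂ p₃ p₄ p₅ p₆ = *-cancelˡ-< 9 q s (≤-cert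
        (9 * q + 9 * a + 9 * c₁ + 9 * c₂ + 9 * c₃ + 5 * (2 * B * cw + 2 * (cw + r) + 1))
        (9 * (a + (c₁ + (c₂ + c₃))) + 9 * cw + 9 * r + 2 * s + 2 * s + 5 * s)
        (10 * B * cw + cw + r + 4)
        (+-mono-≤ (+-mono-≤ (+-mono-≤ (+-mono-≤ (+-mono-≤ (*-monoʳ-≤ 9 p₁) (*-monoʳ-≤ 9 p₂)) (*-monoʳ-≤ 9 p₃)) p₄) p₅) (*-monoʳ-≤ 5 p₆))
        (ee s cw r q B a c₁ c₂ c₃))
        where
        ee : ∀ s cw r q B a c₁ c₂ c₃ →
          suc (9 * q) + (9 * (a + (c₁ + (c₂ + c₃))) + 9 * cw + 9 * r + 2 * s + 2 * s + 5 * s) + (10 * B * cw + cw + r + 4)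
          ≡ 9 * s + (9 * q + 9 * a + 9 * c₁ + 9 * c₂ + 9 * c₃ + 5 * (2 * B * cw + 2 * (cw + r) + 1))
        ee = solve-∀
    w = proj₁ next
    w∈ = proj₁ (proj₂ next)
    w-typ = proj₁ (proj₂ (proj₂ next))
    w∉e = proj₁ (proj₂ (proj₂ (proj₂ next)))
    wu = proj₁ (proj₂ (proj₂ (proj₂ (proj₂ next))))
    wv = proj₂ (proj₂ (proj₂ (proj₂ (proj₂ next))))
    Q : Fin n → Set
    Q x = x ∉ˢ e × (Adj u x × (Adj v x × Adj w x))
    Q? : ∀ x → Dec (Q x)
    Q? x = ¬? (x ∈ᵉ? e) ×-dec (adj? u x ×-dec (adj? v x ×-dec adj? w x))
    few : ∀ j → j ∈ others i → (# (λ x → inP? j x ×-dec ¬? (Q? x))) vs ≤ (r + 2 * b₂ + 2 * h₃ + 3) * g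
    few j j∈ = ≤-trans
      (≤-trans (P-¬× j (λ x → ¬? (x ∈ᵉ? e)) (λ x → adj? u x ×-dec (adj? v x ×-dec adj? w x)))
        (+-mono-≤ (#P∉edge j e e∈) (≤-trans (P-¬× j (adj? u) (λ x → adj? v x ×-dec adj? w x))
          (+-mono-≤ (proj₁ cu j (∈-others⁻ i j∈)) (≤-trans (P-¬× j (adj? v) (adj? w))
            (+-mono-≤ (proj₁ cv j (∈-others⁻ i j∈)) (≤-trans (#inP∧ j (λ x → ¬? (adj? w x))) w-typ)))))))
      (≤-trans (m≤m+n _ ((2 * b₂ + 2) * g)) (≤-reflexive (ee r g h₃ b₂)))
      where
      ee : ∀ r g h₃ b₂ → r * g + (h₃ * g + (h₃ * g + g)) + (2 * b₂ + 2) * g ≡ (r + 2 * b₂ + 2 * h₃ + 3) * g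
      ee = solve-∀
    contra : (∃ λ zs → length zs ≡ length (others i) × AllPairs Adj zs × (∀ z → z ∈ zs → Q z × z ∈ vs × InV₀ z)) → ⊥
    contra (zs , len , ap , q) = no-clique u v (w ∷ zs) e e∈ u∈e v∈e u≢v
      (λ { z (here refl) → w∉e ; z (there z∈) → proj₁ (proj₁ (q z z∈)) })
      (All.tabulate (λ z∈ → proj₂ (proj₂ (proj₂ (proj₁ (q _ z∈))))) ∷ ap)
      (λ { z (here refl) → adj-sym wu ; z (there z∈) → proj₁ (proj₂ (proj₁ (q z z∈))) })
      (λ { z (here refl) → adj-sym wv ; z (there z∈) → proj₁ (proj₂ (proj₂ (proj₁ (q z z∈)))) })
      (cong suc (trans len (length-others i)))

  link≤turán : ∀ w → w ∈ ws → ∀ {P : Subset n → Set} (P? : ∀ e → Dec (P e)) xs → Unique xs → (∀ x → x ∈ xs → x ∈ vs) →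
    (∀ e → e ∈ H → P e → w ∈ˢ e × (∀ x → x ∈ˢ e → x ≡ w ⊎ x ∈ xs)) →
    (# P?) H ≤ turán (2 + ρ) k (length xs)
  link≤turán w w∈ P? xs uxs xs⊆ h = ≤-trans
    (#link≤cliques (apart? class?) uniqH (2 + ρ) P? (w ∷ []) xs
      (All.tabulate (λ x∈ → w≢v _ _ w∈ (xs⊆ _ x∈)) ∷ uxs)
      (λ e e∈ p → (λ { x (here refl) → proj₁ (h e e∈ p) })
        , (λ x x∈e → [ (λ { refl → here refl }) , there ]′ (proj₂ (h e e∈ p) x x∈e)) , sizes e e∈)
      (λ { e e∈ p x z x∈ z∈ x≢z x∈e z∈e (i , cx , cz) → same-class-apart e i x z e∈ (xs⊆ x x∈) (xs⊆ z z∈) x≢z x∈e z∈e cx cz }))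
    (cliques≤turán (apart? class?) (apart-sym {C = Class}) (2 + ρ) k xs
      (apart-cliqueFree id xs (λ x x∈ → classify x (xs⊆ x x∈))))

  instance
    nonZero-m : NonZero m
    nonZero-m = >-nonZero (≤-trans (s≤s z≤n) (≤-reflexive (sym m≡)))

  -- Missing more than `g` neighbours costs about `g * T₂ / m` edges. This exceeds all edges with
  -- two vertices in `ws` or a bad pair at `ws`, which have order `N ^ (1 + ρ)`; the remaining links
  -- are bounded through the classes.
  some-atypical : ∀ w → w ∈ ws → ¬ TypW w → length H ≤ s * T₂
  some-atypical w w∈ ¬typ = *-cancelˡ-≤ m (cert m s T₂ (∑ ws nonAdj) X L N P g (length H) bound ∑-turán-neighbours
      (<⇒≤ (≤-trans (≰⇒> ¬typ) (∑-member ws nonAdj w∈))) m≤N h-end)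
    where
    P = N ^ ρ
    X = ∑ ws (λ w → turán (2 + ρ) k (length (neighbours w)))
    Rest? : ∀ e → Dec (¬ TwoW e × ¬ BadWV e)
    Rest? e = ¬? (twoW? e) ×-dec ¬? (badWV? e)
    em : ∀ e → Dec (TwoW e) → Dec (BadWV e) → TwoW e ⊎ (BadWV e ⊎ (¬ TwoW e × ¬ BadWV e))
    em e (yes p) _       = inj₁ p
    em e (no _)  (yes q) = inj₂ (inj₁ q)
    em e (no p)  (no q)  = inj₂ (inj₂ (p , q))
    at : ∀ w → w ∈ ws → (# (λ e → (w ∈ᵉ? e) ×-dec Rest? e)) H ≤ turán (2 + ρ) k (length (neighbours w))
    at w w∈ = link≤turán w w∈ (λ e → (w ∈ᵉ? e) ×-dec Rest? e) (neighbours w) (neighbours-unique w)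
      (λ x x∈ → proj₁ (∈-neighbours⁻ x∈))
      (λ { e e∈ (w∈e , ¬two , ¬bad) → w∈e , λ x x∈e → [ inj₁
         , (λ x∈vs → inj₂ (Mem.∈-filter⁺ (adj? w) x∈vs (adj-WV ¬bad w∈ x∈vs w∈e x∈e))) ]′ (clique-link e∈ ¬two w∈ w∈e x∈e) })
    bound : length H ≤ s * (s * (N * P)) + (s * (m * (L * P)) + X)
    bound = ≤-trans (≤-reflexive (sym (#-all (λ _ → yes tt) H (λ _ _ → tt))))
      (≤-trans (#-⊎ (λ _ → yes tt) twoW? (λ e → badWV? e ⊎-dec Rest? e) H (λ e _ _ → em e (twoW? e) (badWV? e)))
        (+-mono-≤ #twoW (≤-trans (#-⊎ (λ e → badWV? e ⊎-dec Rest? e) badWV? Rest? H (λ _ _ → id))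
          (+-mono-≤ #badWV (≤-trans
            (#-hit Rest? (λ w e → (w ∈ᵉ? e) ×-dec Rest? e) H ws
              (λ e e∈ q → let (w , w∈ , w∈e) = meets e e∈ in w , w∈ , w∈e , q))
            (∑-mono ws at))))))
    cert : ∀ m s T Y X L N P g l → l ≤ s * (s * (N * P)) + (s * (m * (L * P)) + X) → m * X + T * Y ≤ s * (m * T) → g ≤ Y →
           m ≤ N → m * ((s * s + s * L) * (N * P)) ≤ g * T → m * l ≤ m * (s * T)
    cert m s T Y X L N P g l p q u v x = ≤-cert
      (m * l + (m * X + T * Y) + T * g + m * (s * L * P) * m + m * ((s * s + s * L) * (N * P)))
      (m * (s * (s * (N * P)) + (s * (m * (L * P)) + X)) + s * (m * T) + T * Y + m * (s * L * P) * N + g * T)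
      0
      (+-mono-≤ (+-mono-≤ (+-mono-≤ (+-mono-≤ (*-monoʳ-≤ m p) q) (*-monoʳ-≤ T u)) (*-monoʳ-≤ (m * (s * L * P)) v)) x)
      (e m s T Y X L N P g l)
      where
      e : ∀ m s T Y X L N P g l →
        m * l + (m * (s * (s * (N * P)) + (s * (m * (L * P)) + X)) + s * (m * T) + T * Y + m * (s * L * P) * N + g * T) + 0
        ≡ m * (s * T) + (m * l + (m * X + T * Y) + T * g + m * (s * L * P) * m + m * ((s * s + s * L) * (N * P)))
      e = solve-∀

  -- Typical vertices of `ws` miss at most `g` vertices, so any two have a transversal clique of all
  -- `k` parts in their common neighbourhood. An edge through both would complete the core, which
  -- leaves one vertex of `ws` per edge.
  all-typical : (∀ w → w ∈ ws → TypW w) → length H ≤ s * T₂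
  all-typical typ = ≤-trans (≤-reflexive (sym (#-all (λ _ → yes tt) H (λ _ _ → tt))))
    (≤-trans (#-hit (λ _ → yes tt) (λ w e → w ∈ᵉ? e) H ws (λ e e∈ _ → meets e e∈))
      (∑-bound ws T₂ (λ w w∈ → link≤turán w w∈ (w ∈ᵉ?_) vs vs-unique (λ _ → id)
        (λ e e∈ w∈e → w∈e , λ x x∈e → clique-link e∈ (one-w e e∈) w∈ w∈e x∈e))))
    where
    one-w : ∀ e → e ∈ H → ¬ TwoW e
    one-w e e∈ two = contra (transversal-clique Q? (allFin k) (UniqueP.allFin⁺ k) (≤-reflexive (ListP.length-tabulate {n = k} id)) few)
      where
      w = proj₁ (find two)
      w∈ = proj₁ (proj₂ (find two))
      w′ = proj₁ (find (proj₂ (proj₂ (find two))))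
      w′∈ = proj₁ (proj₂ (find (proj₂ (proj₂ (find two)))))
      w≢w′ = proj₁ (proj₂ (proj₂ (find (proj₂ (proj₂ (find two))))))
      w∈e = proj₁ (proj₂ (proj₂ (proj₂ (find (proj₂ (proj₂ (find two)))))))
      w′∈e = proj₂ (proj₂ (proj₂ (proj₂ (find (proj₂ (proj₂ (find two)))))))
      Q : Fin n → Set
      Q x = x ∉ˢ e × (Adj w x × Adj w′ x)
      Q? : ∀ x → Dec (Q x)
      Q? x = ¬? (x ∈ᵉ? e) ×-dec (adj? w x ×-dec adj? w′ x)
      few : ∀ i → i ∈ allFin k → (# (λ x → inP? i x ×-dec ¬? (Q? x))) vs ≤ (r + 2 * b₂ + 2 * h₃ + 3) * g
      few i _ = ≤-trans
        (≤-trans (P-¬× i (λ x → ¬? (x ∈ᵉ? e)) (λ x → adj? w x ×-dec adj? w′ x))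
          (+-mono-≤ (#P∉edge i e e∈) (≤-trans (P-¬× i (adj? w) (adj? w′))
            (+-mono-≤ (≤-trans (#inP∧ i (λ x → ¬? (adj? w x))) (typ w w∈)) (≤-trans (#inP∧ i (λ x → ¬? (adj? w′ x))) (typ w′ w′∈))))))
        (≤-trans (m≤m+n _ ((2 * b₂ + 2 * h₃ + 1) * g)) (≤-reflexive (ee r g h₃ b₂)))
        where
        ee : ∀ r g h₃ b₂ → r * g + (g + g) + (2 * b₂ + 2 * h₃ + 1) * g ≡ (r + 2 * b₂ + 2 * h₃ + 3) * g
        ee = solve-∀
      contra : (∃ λ zs → length zs ≡ length (allFin k) × AllPairs Adj zs × (∀ z → z ∈ zs → Q z × z ∈ vs × InV₀ z)) → ⊥
      contra (zs , len , ap , q) = no-clique w w′ zs e e∈ w∈e w′∈e w≢w′ (λ z z∈ → proj₁ (proj₁ (q z z∈))) ap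
        (λ z z∈ → proj₁ (proj₂ (proj₁ (q z z∈)))) (λ z z∈ → proj₂ (proj₂ (proj₁ (q z z∈))))
        (trans len (ListP.length-tabulate {n = k} id))

  length-H≤ : length H ≤ s * T₂
  length-H≤ = cases (any? (λ w → ¬? (typW? w)) ws)
    where
    cases : Dec (Any (λ w → ¬ TypW w) ws) → length H ≤ s * T₂
    cases (yes a) = let (w , w∈ , ¬t) = find a in some-atypical w w∈ ¬t
    cases (no ¬a) = all-typical λ w w∈ → decidable-stable (typW? w) (λ ¬t → ¬a (lose w∈ ¬t))

-- Progressive induction

^-distribʳ-* : ∀ a b n → (a * b) ^ n ≡ a ^ n * b ^ n
^-distribʳ-* a b zero    = refl
^-distribʳ-* a b (suc n) = trans (cong (a * b *_) (^-distribʳ-* a b n)) (e a b (a ^ n) (b ^ n))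
  where
  e : ∀ a b x y → a * b * (x * y) ≡ a * x * (b * y)
  e = solve-∀

-- Choice of the constants

module Constants (ρ k L : ℕ) where
  abstract
    -- None of these involves `s` or `n`. `B` comes from `N ≤ 4 * k * μ` raised to a power, `suc M`
    -- is the ratio of `μ` to `g` up to rounding, and `c` gives `N ≤ c * g`. The summands of `s₁`
    -- are the lower bounds on `s` required by `h-s`, `h-v` and `h-deg`.
    B b b₂ h κ h₂ h₃ Λ M c cw s₁ : ℕ
    B  = (4 * k) ^ (2 + ρ)
    b  = 2 * k + 2 * (3 + ρ) + 2
    b₂ = b + 2 * k + 2
    h  = k * b₂ + 1
    κ  = 2 * k + h + b + 1
    h₂ = (h + b + 1) * B
    h₃ = 2 * k + h₂
    Λ  = 3 + ρ + 2 * b₂ + 2 * h₃ + 4 + k * b₂ + b + 2 * k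
    M  = Λ + 8 * κ * B
    c  = 8 * k * suc M
    cw = suc L * B * c
    s₁ = 2 * B * cw + 2 * (cw + (3 + ρ)) + 1 + (3 + ρ) * (suc L * B) * (c * c) + (1 + c * L)
    B≡  : B ≡ (4 * k) ^ (2 + ρ)
    B≡  = refl
    b≡  : b ≡ 2 * k + 2 * (3 + ρ) + 2
    b≡  = refl
    b₂≡ : b₂ ≡ b + 2 * k + 2
    b₂≡ = refl
    h≡  : h ≡ k * b₂ + 1
    h≡  = refl
    κ≡  : κ ≡ 2 * k + h + b + 1
    κ≡  = refl
    h₂≡ : h₂ ≡ (h + b + 1) * B
    h₂≡ = refl
    h₃≡ : h₃ ≡ 2 * k + h₂
    h₃≡ = refl
    Λ≡  : Λ ≡ 3 + ρ + 2 * b₂ + 2 * h₃ + 4 + k * b₂ + b + 2 * k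
    Λ≡  = refl
    M≡  : M ≡ Λ + 8 * κ * B
    M≡  = refl
    c≡  : c ≡ 8 * k * suc M
    c≡  = refl
    cw≡ : cw ≡ suc L * B * c
    cw≡ = refl
    s₁≡ : s₁ ≡ 2 * B * cw + 2 * (cw + (3 + ρ)) + 1 + (3 + ρ) * (suc L * B) * (c * c) + (1 + c * L)
    s₁≡ = refl

module Numerics {n ρ k′ : ℕ} (S : Setup n ρ k′) (q≤k : 2 + ρ ≤ suc k′) where

  open Setting S using (k; s; m; N; N≡s+m; m≤N; H; vs; L)
  open Constants ρ k L

  -- The lower bound on `g` pays for every term that grows with `s`. It is stated with `Smax`, so it
  -- is a condition on the number of vertices alone.
  regime : ∀ m₁ Smax → m ≡ suc m₁ → s₁ ≤ s → s ≤ Smax →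
    1 + Smax + (1 + B) * (Smax * Smax + Smax * L) ≤ m₁ / suc k′ / suc M →
    (∀ v → v ∈ vs → s * turán (1 + ρ) k′ (m₁ ∸ m₁ / suc k′) ≤ (# (v ∈ᵉ?_)) H) →
    s * turán (2 + ρ) k m ≤ length H → Regime S
  regime m₁ Smax m≡ s₁≤s s≤Smax G≤g min-degree dense = record
    { m₁ = m₁ ; μ = μ ; g = g ; cw = cw ; B = B ; b = b ; b₂ = b₂ ; h = h ; h₂ = h₂ ; h₃ = h₃ ; Λ = Λ ; κ = κ
    ; b≡ = b≡ ; b₂≡ = b₂≡ ; h≡ = h≡ ; κ≡ = κ≡ ; h₂≡ = h₂≡ ; h₃≡ = h₃≡ ; Λ≡ = Λ≡ ; m≡ = m≡
    ; kμ≤m₁ = kμ≤m₁ ; 1≤g = 1≤g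
    ; Λg≤μ = ≤-trans (*-monoˡ-≤ g (≤-trans (m≤m+n Λ _) (≤-trans (≤-reflexive (sym M≡)) (n≤1+n M)))) Mg≤μ
    ; 1≤T₁ = ≤-trans (m^n>0 μ (1 + ρ)) T₁≥ ; 1≤T₂ = ≤-trans (m^n>0 μ (2 + ρ)) T₂≥
    ; N₁ = ≤-trans (N^≤ (1 + ρ) (n≤1+n _)) (*-monoʳ-≤ B T₁≥)
    ; N₂ = ≤-trans (N^≤ (2 + ρ) ≤-refl) (*-monoʳ-≤ B T₂≥)
    ; N₀ = N₀
    ; small = ≤-trans ss≤g (≤-trans g≤μ (≤-trans μ≤m₁ (≤-trans (≤-trans (n≤1+n m₁) (≤-reflexive (sym m≡))) m≤N)))
    ; h-w = ≤-trans (*-monoˡ-≤ (suc L * B) (≤-trans m≤N N≤cg)) (≤-reflexive (trans (e₁ c g (suc L * B)) (cong (g *_) (sym cw≡))))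
    ; h-v = ≤-trans (*-monoʳ-≤ ((3 + ρ) * (suc L * B)) (*-mono-≤ N≤cg N≤cg))
        (≤-trans (≤-reflexive (e₂ ((3 + ρ) * (suc L * B)) c g)) (*-monoˡ-≤ (g * g) (≤-trans (≤-trans (m≤n+m ((3 + ρ) * (suc L * B) * (c * c)) (2 * B * cw + 2 * (cw + (3 + ρ)) + 1)) (m≤m+n _ (1 + c * L)))
          (≤-trans (≤-reflexive (sym s₁≡)) s₁≤s))))
    ; h-s = ≤-trans (≤-trans (m≤m+n _ ((3 + ρ) * (suc L * B) * (c * c))) (m≤m+n _ (1 + c * L))) (≤-trans (≤-reflexive (sym s₁≡)) s₁≤s)
    ; h-deg = h-deg
    ; h-end = h-end
    ; min-degree = min-degree ; dense = dense }
    where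
    μ = m₁ / suc k′
    g = μ / suc M
    instance
      nonZero-g : NonZero g
      nonZero-g = >-nonZero (≤-trans (s≤s z≤n) G≤g)
    1≤g : 1 ≤ g
    1≤g = ≤-trans (s≤s z≤n) G≤g
    Mg≤μ : suc M * g ≤ μ
    Mg≤μ = ≤-trans (≤-reflexive (*-comm (suc M) g)) (m/n*n≤m μ (suc M))
    g≤μ : g ≤ μ
    g≤μ = ≤-trans (m≤m+n g (M * g)) Mg≤μ
    instance
      nonZero-μ : NonZero μ
      nonZero-μ = >-nonZero (≤-trans 1≤g g≤μ)
    kμ≤m₁ : k * μ ≤ m₁
    kμ≤m₁ = ≤-trans (≤-reflexive (*-comm k μ)) (m/n*n≤m m₁ (suc k′))
    μ≤m₁ : μ ≤ m₁
    μ≤m₁ = ≤-trans (m≤m+n μ (k′ * μ)) kμ≤m₁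
    T₁≥ : μ ^ (1 + ρ) ≤ turán (1 + ρ) k′ (m₁ ∸ μ)
    T₁≥ = turán-lower (1 + ρ) k′ μ (m₁ ∸ μ) (s≤s⁻¹ q≤k)
      (≤-trans (≤-reflexive (sym (m+n∸m≡n μ (k′ * μ)))) (∸-monoˡ-≤ μ kμ≤m₁))
    T₂≥ : μ ^ (2 + ρ) ≤ turán (2 + ρ) k m
    T₂≥ = turán-lower (2 + ρ) k μ m q≤k (≤-trans kμ≤m₁ (≤-trans (n≤1+n m₁) (≤-reflexive (sym m≡))))
    ss≤SS : s * s + s * L ≤ Smax * Smax + Smax * L
    ss≤SS = +-mono-≤ (*-mono-≤ s≤Smax s≤Smax) (*-monoˡ-≤ L s≤Smax)
    ss≤g : s * s + s * L ≤ g
    ss≤g = ≤-trans ss≤SS (≤-trans (≤-trans (m≤m+n _ (B * (Smax * Smax + Smax * L))) (m≤n+m _ (1 + Smax))) G≤g)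
    s≤μ : s ≤ μ
    s≤μ = ≤-trans s≤Smax (≤-trans (≤-trans (n≤1+n Smax) (≤-trans (m≤m+n (1 + Smax) _) G≤g)) g≤μ)
    N≤4kμ : N ≤ 4 * k * μ
    N≤4kμ = cert k′ μ m₁ (m₁ % suc k′) s m N N≡s+m m≡ (m≡m%n+[m/n]*n m₁ (suc k′)) (s≤s⁻¹ (m%n<n m₁ (suc k′))) s≤μ (≤-trans 1≤g g≤μ)
      where
      cert : ∀ k′ μ m₁ x s m N → N ≡ s + m → m ≡ suc m₁ → m₁ ≡ x + μ * suc k′ → x ≤ k′ → s ≤ μ → 1 ≤ μ → N ≤ 4 * suc k′ * μ
      cert k′ μ _ x s _ _ refl refl refl p q u = ≤-cert (x + s + suc k′ * 1) (k′ + μ + suc k′ * μ) ((k′ * 2 + 1) * μ)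
        (+-mono-≤ (+-mono-≤ p q) (*-monoʳ-≤ (suc k′) u)) (e k′ μ x s)
        where
        e : ∀ k′ μ x s → s + suc (x + μ * suc k′) + (k′ + μ + suc k′ * μ) + ((k′ * 2 + 1) * μ)
                       ≡ 4 * suc k′ * μ + (x + s + suc k′ * 1)
        e = solve-∀
    N≤cg : N ≤ c * g
    N≤cg = ≤-trans N≤4kμ (≤-trans (*-monoʳ-≤ (4 * k) μ≤) (≤-reflexive (trans (e k (suc M) g) (cong (_* g) (sym c≡)))))
      where
      e : ∀ k M g → 4 * k * (2 * (M * g)) ≡ 8 * k * M * g
      e = solve-∀
      μ≤ : μ ≤ 2 * (suc M * g)
      μ≤ = cert M g μ (μ % suc M) (m≡m%n+[m/n]*n μ (suc M)) (s≤s⁻¹ (m%n<n μ (suc M))) 1≤g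
        where
        cert : ∀ M g μ x → μ ≡ x + g * suc M → x ≤ M → 1 ≤ g → μ ≤ 2 * (suc M * g)
        cert M g _ x refl p q = ≤-cert (x + M * 1) (M + M * g) g (+-mono-≤ p (*-monoʳ-≤ M q)) (e′ M g x)
          where
          e′ : ∀ M g x → x + g * suc M + (M + M * g) + g ≡ 2 * (suc M * g) + (x + M * 1)
          e′ = solve-∀
    N^≤ : ∀ j → j ≤ 2 + ρ → N ^ j ≤ B * μ ^ j
    N^≤ j j≤ = ≤-trans (^-monoˡ-≤ j N≤4kμ) (≤-trans (≤-reflexive (^-distribʳ-* (4 * k) μ j))
      (*-monoˡ-≤ (μ ^ j) (≤-trans (^-monoʳ-≤ (4 * k) j≤) (≤-reflexive (sym B≡)))))
    N₀ : 8 * κ * (g * N ^ ρ) ≤ turán (1 + ρ) k′ (m₁ ∸ μ)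
    N₀ = ≤-trans (*-monoʳ-≤ (8 * κ) (*-monoʳ-≤ g (N^≤ ρ (m≤n+m ρ 2)))) (≤-trans (≤-reflexive (e κ g B (μ ^ ρ)))
      (≤-trans (*-monoˡ-≤ (μ ^ ρ) (≤-trans (*-monoˡ-≤ g (≤-trans (m≤n+m _ Λ) (≤-trans (≤-reflexive (sym M≡)) (n≤1+n M)))) Mg≤μ)) T₁≥))
      where
      e : ∀ κ g B x → 8 * κ * (g * (B * x)) ≡ 8 * κ * B * g * x
      e = solve-∀
    e₁ : ∀ c g l → c * g * l ≡ g * (l * c)
    e₁ = solve-∀
    e₂ : ∀ r c g → r * (c * g * (c * g)) ≡ r * (c * c) * (g * g)
    e₂ = solve-∀
    h-deg : s * s + m * L + s * L ≤ s * g
    h-deg = cert s m L g c ss≤g (≤-trans m≤N N≤cg) (≤-trans (m≤n+m (1 + c * L) _) (≤-trans (≤-reflexive (sym s₁≡)) s₁≤s))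
      where
      cert : ∀ s m L g c → s * s + s * L ≤ g → m ≤ c * g → 1 + c * L ≤ s → s * s + m * L + s * L ≤ s * g
      cert s m L g c p q u = ≤-cert (s * s + s * L + m * L + (1 + c * L) * g) (g + c * g * L + s * g) 0
        (+-mono-≤ (+-mono-≤ p (*-monoˡ-≤ L q)) (*-monoˡ-≤ g u)) (e s m L g c)
        where
        e : ∀ s m L g c → s * s + m * L + s * L + (g + c * g * L + s * g) + 0 ≡ s * g + (s * s + s * L + m * L + (1 + c * L) * g)
        e = solve-∀
    h-end : m * ((s * s + s * L) * N ^ (1 + ρ)) ≤ g * turán (2 + ρ) k m
    h-end = ≤-trans (≤-reflexive (e m (s * s + s * L) (N ^ (1 + ρ)))) (≤-trans
      (*-monoʳ-≤ (s * s + s * L) (≤-trans (*-monoˡ-≤ (N ^ (1 + ρ)) m≤N) (≤-trans (N^≤ (2 + ρ) ≤-refl) (*-monoʳ-≤ B T₂≥))))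
      (≤-trans (≤-reflexive (e′ (s * s + s * L) B (turán (2 + ρ) k m))) (*-monoˡ-≤ (turán (2 + ρ) k m)
        (≤-trans (*-monoʳ-≤ B ss≤SS) (≤-trans (≤-trans (m≤n+m _ (Smax * Smax + Smax * L)) (m≤n+m _ (1 + Smax))) G≤g)))))
      where
      e : ∀ m x y → m * (x * y) ≡ x * (m * y)
      e = solve-∀
      e′ : ∀ x B t → x * (B * t) ≡ B * x * t
      e′ = solve-∀

containsExp-mono : ∀ {r n F} {H H′ : List (Subset n)} → (∀ e → e ∈ H → e ∈ H′) → ContainsExp r n F H → ContainsExp r n F H′
containsExp-mono h (φ , inj , e∈) = φ , inj , λ i → h _ (e∈ i)

-- `ws` and `L` stay fixed, hence so do the target's factor `s` and all constants; adjacency is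
-- taken anew from the remaining edges.
deleteVertex : ∀ {n ρ k′} → Setup n ρ k′ → Fin n → Setup n ρ k′
deleteVertex {n} {ρ} {k′} S v = record
  { H = filter keep? H ; ws = ws ; vs = filter other? vs ; L = L
  ; uniqH = UniqueP.filter⁺ keep? uniqH
  ; uact = UniqueP.++⁺ (proj₁ (Unique-++⁻ ws uact)) (UniqueP.filter⁺ other? (proj₁ (proj₂ (Unique-++⁻ ws uact))))
      (λ { (x∈ws , x∈) → proj₂ (proj₂ (Unique-++⁻ ws uact)) _ _ x∈ws (proj₁ (Mem.∈-filter⁻ other? {xs = vs} x∈)) refl })
  ; sizes = λ e e∈ → sizes e (proj₁ (old e∈))
  ; H⊆ = λ e e∈ x x∈e → [ Mem.∈-++⁺ˡ , (λ x∈vs → Mem.∈-++⁺ʳ ws (Mem.∈-filter⁺ other? x∈vs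
      (λ eq → proj₂ (old e∈) (subst (_∈ˢ e) eq x∈e)))) ]′ (Mem.∈-++⁻ ws (H⊆ e (proj₁ (old e∈)) x x∈e))
  ; meets = λ e e∈ → meets e (proj₁ (old e∈))
  ; L≥ = L≥
  ; free = λ c → free (containsExp-mono {3 + ρ} {n} {Kgraph (3 + k′)} (λ e e∈ → proj₁ (old e∈)) c) }
  where
  open Setup S
  keep? : ∀ e → Dec (v ∉ˢ e)
  keep? e = ¬? (v ∈ᵉ? e)
  other? : ∀ x → Dec (x ≢ v)
  other? x = ¬? (x Fin.≟ v)
  old : ∀ {e} → e ∈ filter keep? H → e ∈ H × v ∉ˢ e
  old = Mem.∈-filter⁻ keep? {xs = H}

length-filter-≢ : ∀ {n} (xs : List (Fin n)) {v} → Unique xs → v ∈ xs → length xs ≡ suc (length (filter (λ x → ¬? (x Fin.≟ v)) xs))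
length-filter-≢ xs {v} u v∈ = trans (sym (#-complement (Fin._≟ v) xs))
  (cong₂ _+_ one (sym (length-filter≡# (λ x → ¬? (x Fin.≟ v)) xs)))
  where
  one : (# (Fin._≟ v)) xs ≡ 1
  one = ≤-antisym (#≤1 (Fin._≟ v) xs u (λ { x y _ _ refl refl → refl }))
    (≤-trans (≤-reflexive (sym (𝟙-yes (v Fin.≟ v) refl))) (∑-member xs (λ x → 𝟙 (x Fin.≟ v)) v∈))

module Progressive (ρ k′ L : ℕ) (q≤k : 2 + ρ ≤ suc k′) (Smax : ℕ) where

  open Constants ρ (suc k′) L

  -- `m₀` is large enough that `g ≥ G` holds for every `m₁ ≥ m₀`. `K` bounds all edges trivially
  -- when `m₀` vertices remain outside W, so fewer than `K + 1` deletions can each raise the excess.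
  k G m₀ K : ℕ
  k = suc k′
  G = 1 + Smax + (1 + B) * (Smax * Smax + Smax * L)
  m₀ = G * suc M * suc k′
  K = (Smax + m₀) ^ (3 + ρ)

  -- Simonovits' progressive induction: as long as the excess over the target
  -- is positive, deleting a vertex of small degree increases it.
  excess : ∀ d {n} (S : Setup n ρ k′) → Setup.L S ≡ L → s₁ ≤ length (Setup.ws S) → length (Setup.ws S) ≤ Smax →
    length (Setup.vs S) ≡ d + m₀ → length (Setup.H S) ≤ length (Setup.ws S) * turán (2 + ρ) k (d + m₀) + (K ∸ d)
  excess zero S refl s₁≤ ≤S m≡ = ≤-trans
    (≤-trans (≤-reflexive (sym (#-all (λ e → all? (_∈ᵉ? e) []) H (λ _ _ → []))))
      (≤-trans (codegree [] (3 + ρ) [] refl) (^-monoˡ-≤ (3 + ρ) (≤-trans (≤-reflexive N≡s+m) (+-mono-≤ ≤S (≤-reflexive m≡))))))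
    (m≤n+m K _)
    where
    open Setting S hiding (k)
  excess (suc d) {n} S refl s₁≤ ≤S m≡ = cases (any? (λ v → suc ((# (v ∈ᵉ?_)) H) ≤? s * T₁) vs)
    where
    open Setting S hiding (k)
    m₁ = d + m₀
    -- By definition the increment of `turán (2 + ρ) k` from `m₁` to `suc m₁`, so removing a vertex
    -- of degree below `s * T₁` raises the excess by at least one.
    T₁ = turán (1 + ρ) k′ (m₁ ∸ m₁ / suc k′)
    G≤g : G ≤ m₁ / suc k′ / suc M
    G≤g = ≤-trans (≤-reflexive (sym (m*n/n≡m G (suc M)))) (/-monoˡ-≤ (suc M)
      (≤-trans (≤-reflexive (sym (m*n/n≡m (G * suc M) (suc k′)))) (/-monoˡ-≤ (suc k′) (m≤n+m m₀ d))))
    target : s * turán (2 + ρ) k m ≡ s * turán (2 + ρ) k (suc m₁)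
    target = cong (λ z → s * turán (2 + ρ) k z) m≡
    structured : (∀ v → v ∈ vs → s * T₁ ≤ (# (v ∈ᵉ?_)) H) → length H ≤ s * turán (2 + ρ) k m
    structured h = split (s * turán (2 + ρ) k m ≤? length H)
      where
      split : Dec (s * turán (2 + ρ) k m ≤ length H) → length H ≤ s * turán (2 + ρ) k m
      split (yes dense) = Conclusion.length-H≤ S (Numerics.regime S q≤k m₁ Smax m≡ s₁≤ ≤S G≤g h dense)
      split (no ¬dense) = <⇒≤ (≰⇒> ¬dense)
    cases : Dec (Any (λ v → (# (v ∈ᵉ?_)) H < s * T₁) vs) → length H ≤ s * turán (2 + ρ) k (suc m₁) + (K ∸ suc d)
    cases (no ¬a) = ≤-trans (structured (λ v v∈ → ≮⇒≥ (λ lt → ¬a (lose v∈ lt)))) (≤-trans (≤-reflexive target) (m≤m+n _ _))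
    cases (yes a) = ≤-trans (≤-reflexive (sym (trans (cong ((# (v ∈ᵉ?_)) H +_) (length-filter≡# (λ e → ¬? (v ∈ᵉ? e)) H))
                                                     (#-complement (v ∈ᵉ?_) H))))
      (cert ((# (v ∈ᵉ?_)) H) (length (Setup.H (deleteVertex S v))) s T₁ (turán (2 + ρ) k m₁) K d low
        (excess d (deleteVertex S v) refl s₁≤ ≤S (suc-injective (trans (sym (length-filter-≢ vs vs-unique v∈)) m≡))))
      where
      v = proj₁ (find a)
      v∈ = proj₁ (proj₂ (find a))
      low = proj₂ (proj₂ (find a))
      cert : ∀ x l s T X K d → x < s * T → l ≤ s * X + (K ∸ d) → x + l ≤ s * (X + T) + (K ∸ suc d)
      cert x l s T X K d p q = s≤s⁻¹ (≤-trans (+-mono-≤ p (≤-trans q (+-monoʳ-≤ (s * X) step)))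
        (≤-reflexive (e s T X (K ∸ suc d))))
        where
        step : K ∸ d ≤ suc (K ∸ suc d)
        step = m∸n≤1+[m∸1+n] K d
          where
          m∸n≤1+[m∸1+n] : ∀ m n → m ∸ n ≤ suc (m ∸ suc n)
          m∸n≤1+[m∸1+n] zero    n       = ≤-trans (m∸n≤m 0 n) z≤n
          m∸n≤1+[m∸1+n] (suc m) zero    = ≤-refl
          m∸n≤1+[m∸1+n] (suc m) (suc n) = m∸n≤1+[m∸1+n] m n
        e : ∀ s T X y → s * T + (s * X + suc y) ≡ suc (s * (X + T) + y)
        e = solve-∀

  edges-bound : ∀ {n} (S : Setup n ρ k′) → Setup.L S ≡ L → s₁ ≤ length (Setup.ws S) → length (Setup.ws S) ≤ Smax →
    K + m₀ ≤ length (Setup.vs S) → length (Setup.H S) ≤ length (Setup.ws S) * turán (2 + ρ) k (length (Setup.vs S))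
  edges-bound S L≡ s₁≤ ≤S large = ≤-trans (excess d S L≡ s₁≤ ≤S m≡) (≤-reflexive (trans
      (cong₂ (λ z y → length (Setup.ws S) * turán (2 + ρ) k z + y) (sym m≡) (m≤n⇒m∸n≡0 K≤d)) (+-identityʳ _)))
    where
    d = length (Setup.vs S) ∸ m₀
    m≡ : length (Setup.vs S) ≡ d + m₀
    m≡ = sym (m∸n+n≡m (≤-trans (m≤n+m m₀ K) large))
    K≤d : K ≤ d
    K≤d = ≤-trans (≤-reflexive (sym (m+n∸n≡m K m₀))) (∸-monoˡ-≤ m₀ large)

-- The upper bound

Disjointᵉ : ∀ {n} → Subset n → Subset n → Set
Disjointᵉ e e′ = ∀ x → x ∈ˢ e → x ∉ˢ e′

module MatchingFree {n ρ : ℕ} (H : List (Subset n)) (uniqH : Unique H) (sizes : ∀ e → e ∈ H → ∣ e ∣ ≡ 3 + ρ)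
  (s : ℕ) (free : ¬ ContainsExp (3 + ρ) n (Mgraph (suc s)) H) where

  -- Room for all vertices of a matching under construction and for the vertices of W still waiting
  -- for an edge. This threshold depends on `s`, in contrast to the one used for adjacency.
  r bound : ℕ
  r = 3 + ρ
  bound = suc s * suc r

  open Pairs H bound

  Matching : List (Subset n) → Set
  Matching Es = (∀ e → e ∈ Es → e ∈ H) × AllPairs Disjointᵉ Es

  no-matching : ∀ Es → Matching Es → length Es ≢ suc s
  no-matching Es (Es⊆ , ap) len = free (subst (λ l → ContainsExp (3 + ρ) n (Mgraph l) H) len
    (containsMatching (length Es) (lookup Es) (λ i → Es⊆ _ (Mem.∈-lookup i)) (λ i → sizes _ (Es⊆ _ (Mem.∈-lookup i))) disj))
    where
    disj : ∀ i j x → x ∈ˢ lookup Es i → x ∈ˢ lookup Es j → i ≡ j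
    disj i j x x∈ x∈′ with Fin.<-cmp i j
    ... | tri< i<j _ _ = contradiction x∈′ (AllPairs-< ap i j i<j x x∈)
    ... | tri≈ _ eq _  = eq
    ... | tri> _ _ j<i = contradiction x∈ (AllPairs-< ap j i j<i x x∈′)

  support : List (Subset n) → List (Fin n)
  support = concatMap elems

  length-support : ∀ Es → (∀ e → e ∈ Es → e ∈ H) → length (support Es) ≡ length Es * r
  length-support []       _ = refl
  length-support (e ∷ Es) h = trans (ListP.length-++ (elems e))
    (cong₂ _+_ (trans (length-elems e) (sizes e (h e (here refl)))) (length-support Es (λ e′ e′∈ → h e′ (there e′∈))))

  ∈-support : ∀ {x e} Es → e ∈ Es → x ∈ˢ e → x ∈ support Es
  ∈-support Es e∈ x∈ = Mem.∈-concatMap⁺ elems {xs = Es} (lose e∈ (∈-elems⁺ _ x∈))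

  Big : Fin n → Set
  Big w = ¬ Bad w w

  -- Each `w` receives an edge that avoids the matching built so far and the vertices of `ws` still
  -- to be treated, until the matching has `suc s` edges.
  extend : ∀ ws Es → Unique ws → (∀ w → w ∈ ws → Big w) → Matching Es → (∀ w e → w ∈ ws → e ∈ Es → w ∉ˢ e) →
           length ws + length Es ≢ suc s
  extend []       Es _        _   M _  len = no-matching Es M len
  extend (w ∷ ws) Es (w∉ ∷ u) big M@(Es⊆ , ap) av len with avoiding-edge (big w (here refl)) (support Es ++ ws) short
    where
    short : length (support Es ++ ws) ≤ bound
    short = ≤-trans (≤-reflexive (trans (ListP.length-++ (support Es)) (cong (_+ length ws) (length-support Es Es⊆))))
      (≤-trans (+-mono-≤ (*-monoˡ-≤ r (≤-trans (m≤n+m (length Es) (suc (length ws))) (≤-reflexive len)))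
                         (≤-trans (n≤1+n _) (≤-trans (m≤m+n (suc (length ws)) (length Es)) (≤-reflexive len))))
        (≤-reflexive (trans (+-comm (suc s * r) (suc s)) (sym (*-suc (suc s) r)))))
  ... | e , e∈ , w∈e , _ , avoid = extend ws (e ∷ Es) u (λ x x∈ → big x (there x∈))
      ((λ { _ (here refl) → e∈ ; e′ (there e′∈) → Es⊆ e′ e′∈ }) , All.tabulate disj ∷ ap)
      (λ { x _ x∈ (here refl) x∈e → All.lookup w∉ x∈ (sym (only x (Mem.∈-++⁺ʳ (support Es) x∈) x∈e))
         ; x e′ x∈ (there e′∈) → av x e′ (there x∈) e′∈ })
      (trans (+-suc (length ws) (length Es)) len)
    where
    only : ∀ x → x ∈ support Es ++ ws → x ∈ˢ e → x ≡ w
    only x x∈ x∈e = [ id , id ]′ (avoid x x∈ x∈e)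
    disj : ∀ {e′} → e′ ∈ Es → Disjointᵉ e e′
    disj {e′} e′∈ x x∈e x∈e′ = av w e′ (here refl) e′∈ (subst (_∈ˢ e′) (only x (Mem.∈-++⁺ˡ (∈-support Es e′∈ x∈e′)) x∈e) x∈e′)

  W Wᶜ : List (Fin n)
  W = filter (λ w → ¬? (bad? w w)) (allFin n)
  Wᶜ = filter (λ v → bad? v v) (allFin n)

  W⁻ : ∀ {w} → w ∈ W → Big w
  W⁻ w∈ = proj₂ (Mem.∈-filter⁻ (λ w → ¬? (bad? w w)) {xs = allFin n} w∈)

  W-unique : Unique W
  W-unique = UniqueP.filter⁺ (λ w → ¬? (bad? w w)) (UniqueP.allFin⁺ n)

  W++Wᶜ-unique : Unique (W ++ Wᶜ)
  W++Wᶜ-unique = UniqueP.++⁺ W-unique (UniqueP.filter⁺ (λ v → bad? v v) (UniqueP.allFin⁺ n))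
    (λ { (x∈W , x∈Wᶜ) → W⁻ x∈W (proj₂ (Mem.∈-filter⁻ (λ v → bad? v v) {xs = allFin n} x∈Wᶜ)) })

  W++Wᶜ-all : ∀ x → x ∈ W ++ Wᶜ
  W++Wᶜ-all x with bad? x x
  ... | yes b = Mem.∈-++⁺ʳ W (Mem.∈-filter⁺ (λ v → bad? v v) (Mem.∈-allFin x) b)
  ... | no ¬b = Mem.∈-++⁺ˡ (Mem.∈-filter⁺ (λ w → ¬? (bad? w w)) (Mem.∈-allFin x) ¬b)

  |W|+|Wᶜ| : length W + length Wᶜ ≡ n
  |W|+|Wᶜ| = trans (cong₂ _+_ (length-filter≡# (λ w → ¬? (bad? w w)) (allFin n)) (length-filter≡# (λ v → bad? v v) (allFin n)))
    (trans (+-comm ((# (λ w → ¬? (bad? w w))) (allFin n)) _) (trans (#-complement (λ v → bad? v v) (allFin n)) (ListP.length-tabulate {n = n} id)))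

  |W|≤s : length W ≤ s
  |W|≤s = ≮⇒≥ λ s<|W| → extend (take (suc s) W) [] (UniqueP.take⁺ (suc s) W-unique)
    (λ w → All.lookup (AllP.take⁺ (suc s) (All.tabulate W⁻))) ((λ _ ()) , []) (λ _ _ _ ())
    (trans (+-identityʳ _) (trans (ListP.length-take (suc s) W) (m≤n⇒m⊓n≡m s<|W|)))

  meetsW? : ∀ e → Dec (Any (_∈ˢ e) W)
  meetsW? e = any? (_∈ᵉ? e) W

  H₁ H₀ : List (Subset n)
  H₁ = filter meetsW? H
  H₀ = filter (λ e → ¬? (meetsW? e)) H

  |H| : length H ≡ length H₁ + length H₀
  |H| = trans (sym (#-complement meetsW? H))
    (sym (cong₂ _+_ (length-filter≡# meetsW? H) (length-filter≡# (λ e → ¬? (meetsW? e)) H)))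

  H₀⁻ : ∀ {e} → e ∈ H₀ → e ∈ H × ¬ Any (_∈ˢ e) W
  H₀⁻ = Mem.∈-filter⁻ (λ e → ¬? (meetsW? e)) {xs = H}

  Matching₀ : ℕ → Set
  Matching₀ t = ∃ λ Es → length Es ≡ t × (∀ e → e ∈ Es → e ∈ H₀) × AllPairs Disjointᵉ Es

  Cover : ℕ → Set
  Cover t = ∃ λ U → length U ≤ t * r × (∀ e → e ∈ H₀ → ∃ λ u → u ∈ U × u ∈ˢ e)

  grow : ∀ t → Matching₀ t → Matching₀ (suc t) ⊎ Cover t
  grow t (Es , len , Es⊆ , ap) = cases (any? (λ e → ¬? (any? (_∈ᵉ? e) (support Es))) H₀)
    where
    cases : Dec (Any (λ e → ¬ Any (_∈ˢ e) (support Es)) H₀) → Matching₀ (suc t) ⊎ Cover t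
    cases (yes a) = let (e , e∈ , ¬meet) = find a in inj₁
      (e ∷ Es , cong suc len , (λ { _ (here refl) → e∈ ; e′ (there e′∈) → Es⊆ e′ e′∈ })
      , All.tabulate (λ e′∈ x x∈e x∈e′ → ¬meet (lose (∈-support Es e′∈ x∈e′) x∈e)) ∷ ap)
    cases (no ¬a) = inj₂ (support Es
      , ≤-reflexive (trans (length-support Es (λ e e∈ → proj₁ (H₀⁻ (Es⊆ e e∈)))) (cong (_* r) len))
      , λ e e∈ → find (decidable-stable (any? (_∈ᵉ? e) (support Es)) (λ ¬m → ¬a (lose e∈ ¬m))))

  maximal-matching : ∀ t → Matching₀ (suc t) ⊎ Cover t
  maximal-matching zero    = grow 0 ([] , refl , (λ _ ()) , [])
  maximal-matching (suc t) with maximal-matching t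
  ... | inj₁ M              = grow (suc t) M
  ... | inj₂ (U , len , cov) = inj₂ (U , ≤-trans len (m≤n+m _ r) , cov)

  -- A matching of `suc (s ∸ length W)` edges that miss W would be completed to size `suc s` by one
  -- edge through each vertex of W.
  cover : Cover (s ∸ length W)
  cover with maximal-matching (s ∸ length W)
  ... | inj₂ c = c
  ... | inj₁ (Es , len , Es⊆ , ap) = ⊥-elim (extend W Es W-unique (λ w → W⁻) ((λ e e∈ → proj₁ (H₀⁻ (Es⊆ e e∈))) , ap)
      (λ w e w∈ e∈ w∈e → proj₂ (H₀⁻ (Es⊆ e e∈)) (lose w∈ w∈e))
      (trans (cong (length W +_) len) (trans (+-suc (length W) _) (cong suc (m+[n∸m]≡n |W|≤s)))))

  codegree-all : ∀ J p → Unique J → length J + p ≡ r → (# (λ e → all? (_∈ᵉ? e) J)) H ≤ n ^ p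
  codegree-all J p uJ eq = ≤-trans (#link≤power uniqH (allFin n) (UniqueP.allFin⁺ n) J p uJ (λ x _ → Mem.∈-allFin x)
    (λ _ _ x _ → Mem.∈-allFin x) (λ e e∈ → trans (sizes e e∈) (sym eq)))
    (≤-reflexive (cong (_^ p) (ListP.length-tabulate {n = n} id)))

  degree-bad : ∀ u → Bad u u → (# (u ∈ᵉ?_)) H ≤ bound * n ^ (1 + ρ)
  degree-bad u bad = ≤-trans (#-mono (u ∈ᵉ?_) (λ e → (u ∈ᵉ? e) ×-dec (u ∈ᵉ? e)) H (λ _ _ p → p , p))
    (#-bad bad (n ^ (1 + ρ)) (λ f f≢u _ → ≤-trans
      (#-mono (λ e → all? (_∈ᵉ? e) (u ∷ u ∷ f ∷ [])) (λ e → all? (_∈ᵉ? e) (u ∷ f ∷ [])) H (λ { _ _ (p ∷ _ ∷ q ∷ []) → p ∷ q ∷ [] }))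
      (codegree-all (u ∷ f ∷ []) (1 + ρ) (((λ eq → f≢u (sym eq)) ∷ []) ∷ [] ∷ []) refl)))

  |H₀|≤ : length H₀ ≤ (s ∸ length W) * r * (bound * n ^ (1 + ρ))
  |H₀|≤ = ≤-trans (≤-reflexive (length-filter≡# (λ e → ¬? (meetsW? e)) H)) (≤-trans
      (#-hit (λ e → ¬? (meetsW? e)) (λ u e → ¬? (meetsW? e) ×-dec (u ∈ᵉ? e)) H U
        (λ e e∈ ¬m → let (u , u∈ , u∈e) = cov e (Mem.∈-filter⁺ (λ e → ¬? (meetsW? e)) e∈ ¬m) in u , u∈ , ¬m , u∈e))
      (≤-trans (∑-bound U (bound * n ^ (1 + ρ)) (λ u _ → at u (bad? u u))) (*-monoˡ-≤ (bound * n ^ (1 + ρ)) |U|≤)))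
    where
    U = proj₁ cover
    |U|≤ = proj₁ (proj₂ cover)
    cov = proj₂ (proj₂ cover)
    at : ∀ u → Dec (Bad u u) → (# (λ e → ¬? (meetsW? e) ×-dec (u ∈ᵉ? e))) H ≤ bound * n ^ (1 + ρ)
    at u (yes b) = ≤-trans (#-mono (λ e → ¬? (meetsW? e) ×-dec (u ∈ᵉ? e)) (u ∈ᵉ?_) H (λ _ _ → proj₂)) (degree-bad u b)
    -- A cover vertex that lies in `W` is in no edge of `H₀`.
    at u (no ¬b) = ≤-trans (≤-reflexive (#-none (λ e → ¬? (meetsW? e) ×-dec (u ∈ᵉ? e)) H
      (λ { e _ (¬m , u∈e) → ¬m (lose (Mem.∈-filter⁺ (λ w → ¬? (bad? w w)) (Mem.∈-allFin u) ¬b) u∈e) }))) z≤n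

  |H₁|≤ : length H₁ ≤ length W * n ^ (2 + ρ)
  |H₁|≤ = ≤-trans (≤-reflexive (length-filter≡# meetsW? H)) (≤-trans
    (#-hit meetsW? (λ w e → all? (_∈ᵉ? e) (w ∷ [])) H W (λ e _ m → let (w , w∈ , w∈e) = find m in w , w∈ , w∈e ∷ []))
    (∑-bound W (n ^ (2 + ρ)) (λ w _ → codegree-all (w ∷ []) (2 + ρ) ([] ∷ []) refl)))

  setup : ∀ k′ → ¬ ContainsExp (3 + ρ) n (Kgraph (3 + k′)) H → Setup n ρ k′
  setup k′ K-free = record
    { H = H₁ ; ws = W ; vs = Wᶜ ; L = embedBound (3 + ρ) (suc k′)
    ; uniqH = UniqueP.filter⁺ meetsW? uniqH ; uact = W++Wᶜ-unique
    ; sizes = λ e e∈ → sizes e (proj₁ (H₁⁻ e∈)) ; H⊆ = λ _ _ x _ → W++Wᶜ-all x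
    ; meets = λ e e∈ → find (proj₂ (H₁⁻ e∈)) ; L≥ = ≤-refl
    ; free = λ c → K-free (containsExp-mono {3 + ρ} {n} {Kgraph (3 + k′)} (λ e e∈ → proj₁ (H₁⁻ e∈)) c) }
    where
    H₁⁻ : ∀ {e} → e ∈ H₁ → e ∈ H × Any (_∈ˢ e) W
    H₁⁻ = Mem.∈-filter⁻ meetsW? {xs = H}

module UpperBound (ρ k′ : ℕ) (q≤k : 2 + ρ ≤ suc k′) where

  L k r : ℕ
  L = embedBound (3 + ρ) (suc k′)
  k = suc k′
  r = 3 + ρ

  open Constants ρ k L

  -- The second summand covers the case `length W < s₁`: then all edges together number at most
  -- `suc s₁ * n ^ (2 + ρ)`, hence at most `suc s₁ * B * τ`.
  s₀ : ℕ
  s₀ = s₁ + suc s₁ * B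

  C : ℕ → ℕ
  C s = s * r * (suc s * suc r)

  -- The summands ensure, in turn, that `s ≤ n`, that enough vertices outside W remain for the
  -- progressive induction, and that terms of order `n ^ (1 + ρ)` with coefficients depending on `s`
  -- stay below `τ`.
  n₀ : ℕ → ℕ
  n₀ s = s + (Progressive.K ρ k′ L q≤k s + Progressive.m₀ ρ k′ L q≤k s) + (C s + (1 + s + (s * s + C s) * B) * k)

  module _ (s n : ℕ) (s₀≤s : s₀ ≤ s) (n₀≤n : n₀ s ≤ n) where

    τ : ℕ
    τ = turán (2 + ρ) k (n ∸ s)

    ν : ℕ
    ν = (n ∸ s) / k

    s≤n : s ≤ n
    s≤n = ≤-trans (≤-trans (m≤m+n s _) (m≤m+n _ _)) n₀≤n

    ν≥ : 1 + s + (s * s + C s) * B ≤ ν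
    ν≥ = ≤-trans (≤-reflexive (sym (m*n/n≡m (1 + s + (s * s + C s) * B) k))) (/-monoˡ-≤ k
      (≤-trans (≤-reflexive (sym (m+n∸m≡n s _))) (∸-monoˡ-≤ s
        (≤-trans (+-mono-≤ (m≤m+n s (Progressive.K ρ k′ L q≤k s + Progressive.m₀ ρ k′ L q≤k s)) (m≤n+m _ (C s))) n₀≤n))))

    instance
      nonZero-ν : NonZero ν
      nonZero-ν = >-nonZero (≤-trans (s≤s z≤n) ν≥)

    n≤4kν : n ≤ 4 * k * ν
    n≤4kν = cert k′ ν (n ∸ s) ((n ∸ s) % k) s n (sym (m+[n∸m]≡n s≤n)) (m≡m%n+[m/n]*n (n ∸ s) k) (s≤s⁻¹ (m%n<n (n ∸ s) k))
      (≤-trans (n≤1+n s) (≤-trans (m≤m+n (1 + s) _) ν≥)) (≤-trans (s≤s z≤n) ν≥)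
      where
      cert : ∀ k′ μ m x s n → n ≡ s + m → m ≡ x + μ * suc k′ → x ≤ k′ → s ≤ μ → 1 ≤ μ → n ≤ 4 * suc k′ * μ
      cert k′ μ _ x s _ refl refl p q u = ≤-cert (x + s + suc k′ * 1) (k′ + μ + suc k′ * μ) ((k′ * 2 + 1) * μ + 1)
        (+-mono-≤ (+-mono-≤ p q) (*-monoʳ-≤ (suc k′) u)) (e k′ μ x s)
        where
        e : ∀ k′ μ x s → s + (x + μ * suc k′) + (k′ + μ + suc k′ * μ) + ((k′ * 2 + 1) * μ + 1)
                       ≡ 4 * suc k′ * μ + (x + s + suc k′ * 1)
        e = solve-∀

    n^≤ : ∀ j → j ≤ 2 + ρ → n ^ j ≤ B * ν ^ j
    n^≤ j j≤ = ≤-trans (^-monoˡ-≤ j n≤4kν) (≤-trans (≤-reflexive (^-distribʳ-* (4 * k) ν j))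
      (*-monoˡ-≤ (ν ^ j) (≤-trans (^-monoʳ-≤ (4 * k) j≤) (≤-reflexive (sym B≡)))))

    τ≥ : ν ^ (2 + ρ) ≤ τ
    τ≥ = turán-lower (2 + ρ) k ν (n ∸ s) q≤k (≤-trans (≤-reflexive (*-comm k ν)) (m/n*n≤m (n ∸ s) k))

    lower-order : (s * s + C s) * n ^ (1 + ρ) ≤ τ
    lower-order = ≤-trans (*-monoʳ-≤ (s * s + C s) (n^≤ (1 + ρ) (n≤1+n _))) (≤-trans
      (≤-reflexive (sym (*-assoc (s * s + C s) B (ν ^ (1 + ρ)))))
      (≤-trans (*-monoˡ-≤ (ν ^ (1 + ρ)) (≤-trans (m≤n+m _ (1 + s)) ν≥)) τ≥))

    upper-bound : (H : List (Subset n)) → Unique H → (∀ e → e ∈ H → ∣ e ∣ ≡ 3 + ρ) →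
      ¬ ContainsExp (3 + ρ) n (Kgraph (3 + k′)) H → ¬ ContainsExp (3 + ρ) n (Mgraph (suc s)) H → length H ≤ s * τ
    upper-bound H uniqH sizes K-free M-free = ≤-trans (≤-reflexive |H|) (cases (s₁ ≤? length W) (length W ≟ s))
      where
      open MatchingFree {n} {ρ} H uniqH sizes s M-free hiding (r)
      P = n ^ (1 + ρ)
      |Wᶜ|≡ : length Wᶜ ≡ n ∸ length W
      |Wᶜ|≡ = trans (sym (m+n∸m≡n (length W) _)) (cong (_∸ length W) |W|+|Wᶜ|)
      |H₀|≤CP : length H₀ ≤ C s * P
      |H₀|≤CP = ≤-trans |H₀|≤ (≤-trans (*-monoˡ-≤ _ (*-monoˡ-≤ (3 + ρ) (m∸n≤m s (length W))))
        (≤-reflexive (sym (*-assoc (s * (3 + ρ)) (suc s * suc (3 + ρ)) P))))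
      coloured : s₁ ≤ length W → length H₁ ≤ length W * turán (2 + ρ) k (n ∸ length W)
      coloured le = ≤-trans (Progressive.edges-bound ρ k′ L q≤k s (setup k′ K-free) refl le |W|≤s large)
        (≤-reflexive (cong (λ z → length W * turán (2 + ρ) k z) |Wᶜ|≡))
        where
        large : Progressive.K ρ k′ L q≤k s + Progressive.m₀ ρ k′ L q≤k s ≤ length Wᶜ
        large = ≤-trans (≤-reflexive (sym (m+n∸m≡n s _))) (≤-trans
          (∸-monoˡ-≤ s (≤-trans (m≤m+n _ (C s + (1 + s + (s * s + C s) * B) * k)) n₀≤n))
          (≤-trans (∸-monoʳ-≤ n |W|≤s) (≤-reflexive (sym |Wᶜ|≡))))
      cases : Dec (s₁ ≤ length W) → Dec (length W ≡ s) → length H₁ + length H₀ ≤ s * τ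
      -- The cover has size 0, so no edge misses `W` and the bound is exact.
      cases (yes le) (yes eq) = ≤-trans (+-mono-≤ (coloured le) |H₀|≤) (≤-reflexive (trans
        (cong (λ z → z * turán (2 + ρ) k (n ∸ z) + (s ∸ z) * (3 + ρ) * (bound * P)) eq)
        (trans (cong (λ z → s * τ + z * (3 + ρ) * (bound * P)) (n∸n≡0 s)) (+-identityʳ _))))
      -- At least one vertex is lacking in `W`, which saves a full `τ`. This outweighs both `H₀` and
      -- the growth of the Turán number when fewer than `s` vertices are removed.
      cases (yes le) (no ≢s) = ≤-trans (+-mono-≤ (coloured le) |H₀|≤CP)
        (cert s (length W) τ (turán (2 + ρ) k (n ∸ length W)) P (C s)
          (≤∧≢⇒< |W|≤s ≢s) τ-step lower-order)
        where
        τ-step : turán (2 + ρ) k (n ∸ length W) ≤ τ + s * P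
        τ-step = ≤-trans (≤-reflexive (cong (turán (2 + ρ) k) shift)) (≤-trans (turán-lipschitz (1 + ρ) k (n ∸ s) (s ∸ length W))
          (+-monoʳ-≤ τ (*-mono-≤ (m∸n≤m s (length W)) (^-monoˡ-≤ (1 + ρ) (≤-trans (≤-reflexive (sym shift)) (m∸n≤m n (length W)))))))
          where
          shift : n ∸ length W ≡ s ∸ length W + (n ∸ s)
          shift = trans (cong (_∸ length W) (sym (m+[n∸m]≡n s≤n))) (+-∸-comm (n ∸ s) |W|≤s)
        cert : ∀ s w τ Y P C → w < s → Y ≤ τ + s * P → (s * s + C) * P ≤ τ → w * Y + C * P ≤ s * τ
        cert s w τ Y P C p q u = ≤-trans (+-monoˡ-≤ (C * P) (*-monoʳ-≤ w q)) (≤-cert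
          (suc w * τ + w * (s * P) + (s * s + C) * P) (s * τ + s * (s * P) + τ) 0
          (+-mono-≤ (+-mono-≤ (*-monoˡ-≤ τ p) (*-monoˡ-≤ (s * P) (<⇒≤ p))) u) (e s w τ P C))
          where
          e : ∀ s w τ P C → w * (τ + s * P) + C * P + (s * τ + s * (s * P) + τ) + 0
                          ≡ s * τ + (suc w * τ + w * (s * P) + (s * s + C) * P)
          e = solve-∀
      cases (no ¬le) _ = ≤-trans (+-mono-≤ (≤-trans |H₁|≤ (*-monoˡ-≤ (n ^ (2 + ρ)) (<⇒≤ (≰⇒> ¬le))))
          (≤-trans |H₀|≤CP (*-monoˡ-≤ P C≤n)))
        (≤-trans (≤-reflexive (+-comm (s₁ * n ^ (2 + ρ)) _)) (≤-trans (*-monoʳ-≤ (suc s₁) (≤-trans (n^≤ (2 + ρ) ≤-refl) (*-monoʳ-≤ B τ≥)))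
          (≤-trans (≤-reflexive (sym (*-assoc (suc s₁) B τ))) (*-monoˡ-≤ τ (≤-trans (m≤n+m _ s₁) s₀≤s)))))
        where
        C≤n : C s ≤ n
        C≤n = ≤-trans (≤-trans (m≤m+n (C s) _) (m≤n+m _ (s + (Progressive.K ρ k′ L q≤k s + Progressive.m₀ ρ k′ L q≤k s)))) n₀≤n

-- The extremal construction

and-map⁻ : {A : Set} (h : A → Bool) → ∀ xs → and (map h xs) ≡ true → ∀ x → x ∈ xs → h x ≡ true
and-map⁻ h (x ∷ xs) eq y y∈ with h x in hx
and-map⁻ h (x ∷ xs) eq y (here refl) | true = hx
and-map⁻ h (x ∷ xs) eq y (there y∈)  | true = and-map⁻ h xs eq y y∈

allSubsets-unique : ∀ m → Unique (allSubsets m)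
allSubsets-unique zero    = [] ∷ []
allSubsets-unique (suc m) = UniqueP.++⁺ (UniqueP.map⁺ Vec.∷-injectiveʳ (allSubsets-unique m))
  (UniqueP.map⁺ Vec.∷-injectiveʳ (allSubsets-unique m))
  (λ { (p , q) → let (_ , _ , eq) = Mem.∈-map⁻ (true ∷ᵛ_) p ; (_ , _ , eq′) = Mem.∈-map⁻ (false ∷ᵛ_) q in
       contradiction (Vec.∷-injectiveˡ (trans (sym eq) eq′)) λ () })

∣++∣ : ∀ {m n} (p : Subset m) (q : Subset n) → ∣ p ++ᵛ q ∣ ≡ ∣ p ∣ + ∣ q ∣
∣++∣ []ᵛ          q = refl
∣++∣ (true ∷ᵛ p)  q = cong suc (∣++∣ p q)
∣++∣ (false ∷ᵛ p) q = ∣++∣ p q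

∈-++ᵛ : ∀ {m n} (p : Subset m) (q : Subset n) {x} → x ∈ˢ (p ++ᵛ q) →
        (∃ λ i → x ≡ i ↑ˡ n × i ∈ˢ p) ⊎ (∃ λ j → x ≡ m ↑ʳ j × j ∈ˢ q)
∈-++ᵛ []ᵛ      q x∈        = inj₂ (_ , refl , x∈)
∈-++ᵛ (_ ∷ᵛ p) q here      = inj₁ (zero , refl , here)
∈-++ᵛ (_ ∷ᵛ p) q (there x∈) with ∈-++ᵛ p q x∈
... | inj₁ (i , refl , i∈) = inj₁ (suc i , refl , there i∈)
... | inj₂ (j , refl , j∈) = inj₂ (j , refl , j∈)

∈-++ᵛˡ : ∀ {m n} (p : Subset m) (q : Subset n) {i} → i ∈ˢ p → (i ↑ˡ n) ∈ˢ (p ++ᵛ q)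
∈-++ᵛˡ (_ ∷ᵛ p) q here       = here
∈-++ᵛˡ (_ ∷ᵛ p) q (there i∈) = there (∈-++ᵛˡ p q i∈)

length-concatMap : {A B : Set} (f : A → List B) (xs : List A) {l : ℕ} → (∀ x → length (f x) ≡ l) →
                   length (concatMap f xs) ≡ length xs * l
length-concatMap f []       h = refl
length-concatMap f (x ∷ xs) h = trans (ListP.length-++ (f x)) (cong₂ _+_ (h x) (length-concatMap f xs h))

module Construction (q k′ s m : ℕ) where

  test : Subset m → Bool
  test S = (∣ S ∣ ≡ᵇ q) ∧ and (map (λ p → ∣ S ∩ part m k′ p ∣ ≤ᵇ 1) (allFin (suc k′)))

  transversals : List (Subset m)
  transversals = filterᵇ test (allSubsets m)

  row : Fin s → List (Subset (s + m))
  row w = map (⁅ w ⁆ ++ᵛ_) transversals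

  H : List (Subset (s + m))
  H = concatMap row (allFin s)

  length-H : length H ≡ s * t q m (suc k′)
  length-H = trans (length-concatMap row (allFin s) (λ w → ListP.length-map (⁅ w ⁆ ++ᵛ_) transversals))
                   (cong (_* t q m (suc k′)) (ListP.length-tabulate {n = s} id))

  row⁻ : ∀ {w e} → e ∈ row w → ∃ λ S → test S ≡ true × e ≡ ⁅ w ⁆ ++ᵛ S
  row⁻ {w} e∈ = let (S , S∈ , eq) = Mem.∈-map⁻ (⁅ w ⁆ ++ᵛ_) e∈ in
    S , T⇒≡ (proj₂ (Mem.∈-filter⁻ (λ S → T? (test S)) {xs = allSubsets m} S∈)) , eq

  H⁻ : ∀ {e} → e ∈ H → ∃₂ λ w S → test S ≡ true × e ≡ ⁅ w ⁆ ++ᵛ S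
  H⁻ e∈ = let (w , _ , e∈row) = find (Mem.∈-concatMap⁻ row {xs = allFin s} e∈) in w , row⁻ e∈row

  unique-H : Unique H
  unique-H = concatMap-unique row (UniqueP.allFin⁺ s)
    (λ w → UniqueP.map⁺ (λ {S} {S′} eq → Vec.++-injectiveʳ ⁅ w ⁆ ⁅ w ⁆ eq)
             (UniqueP.filter⁺ (λ S → T? (test S)) (allSubsets-unique m)))
    (λ w w′ w≢w′ e e∈ e∈′ → let (S , _ , eq) = row⁻ e∈ ; (S′ , _ , eq′) = row⁻ e∈′ in
      w≢w′ (Sub.x∈⁅y⁆⇒x≡y w′ (subst (w ∈ˢ_) (Vec.++-injectiveˡ ⁅ w ⁆ ⁅ w′ ⁆ (trans (sym eq) eq′)) (Sub.x∈⁅x⁆ w))))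

  test-size : ∀ S → test S ≡ true → ∣ S ∣ ≡ q
  test-size S eq with ∣ S ∣ ≡ᵇ q in eq₁
  ... | true = ≡ᵇ⇒≡ ∣ S ∣ q (≡⇒T eq₁)

  test-parts : ∀ S → test S ≡ true → ∀ p → ∣ S ∩ part m k′ p ∣ ≤ 1
  test-parts S eq p with ∣ S ∣ ≡ᵇ q
  ... | true = ≤ᵇ⇒≤ _ 1 (≡⇒T (and-map⁻ (λ p → ∣ S ∩ part m k′ p ∣ ≤ᵇ 1) (allFin (suc k′)) eq p (Mem.∈-allFin p)))

  sizes-H : ∀ e → e ∈ H → ∣ e ∣ ≡ suc q
  sizes-H e e∈ = let (w , S , ok , eq) = H⁻ e∈ in
    trans (cong ∣_∣ eq) (trans (∣++∣ ⁅ w ⁆ S) (cong₂ _+_ (Sub.∣⁅x⁆∣≡1 w) (test-size S ok)))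

  ∈-part : ∀ i → i ∈ˢ part m k′ (residue k′ i)
  ∈-part i = Vec.lookup⇒[]= i _ (trans (Vec.lookup∘tabulate (λ j → (toℕ j % suc k′) ≡ᵇ toℕ (residue k′ i)) i)
    (T⇒≡ (≡⇒≡ᵇ _ _ (sym (Fin.toℕ-fromℕ< (m%n<n (toℕ i) (suc k′)))))))

  ∣∣≤1⇒≡ : ∀ {l} (X : Subset l) → ∣ X ∣ ≤ 1 → ∀ i j → i ∈ˢ X → j ∈ˢ X → i ≡ j
  ∣∣≤1⇒≡ X le i j i∈ j∈ with i Fin.≟ j
  ... | yes eq = eq
  ... | no i≢j = contradiction (≤-trans (Unique-⊆-length {xs = i ∷ j ∷ []} {ys = elems X} ((i≢j ∷ []) ∷ [] ∷ [])
      (λ { _ (here refl) → ∈-elems⁺ X i∈ ; _ (there (here refl)) → ∈-elems⁺ X j∈ }))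
      (≤-trans (≤-reflexive (length-elems X)) le)) λ { (s≤s ()) }

  colour′ : Fin s ⊎ Fin m → Fin (2 + k′)
  colour′ (inj₁ _) = zero
  colour′ (inj₂ i) = suc (residue k′ i)

  colour : Fin (s + m) → Fin (2 + k′)
  colour x = colour′ (splitAt s x)

  rainbow : ∀ e → e ∈ H → ∀ x y → x ∈ˢ e → y ∈ˢ e → colour x ≡ colour y → x ≡ y
  rainbow e e∈ x y x∈ y∈ same with H⁻ e∈
  ... | w , S , ok , refl with ∈-++ᵛ ⁅ w ⁆ S x∈ | ∈-++ᵛ ⁅ w ⁆ S y∈
  ...   | inj₁ (i , refl , i∈) | inj₁ (j , refl , j∈) =
    cong (_↑ˡ m) (trans (Sub.x∈⁅y⁆⇒x≡y w i∈) (sym (Sub.x∈⁅y⁆⇒x≡y w j∈)))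
  ...   | inj₁ (i , refl , i∈) | inj₂ (j , refl , j∈) rewrite Fin.splitAt-↑ˡ s i m | Fin.splitAt-↑ʳ s m j = contradiction same λ ()
  ...   | inj₂ (i , refl , i∈) | inj₁ (j , refl , j∈) rewrite Fin.splitAt-↑ʳ s m i | Fin.splitAt-↑ˡ s j m = contradiction same λ ()
  ...   | inj₂ (i , refl , i∈) | inj₂ (j , refl , j∈) rewrite Fin.splitAt-↑ʳ s m i | Fin.splitAt-↑ʳ s m j =
    cong (s ↑ʳ_) (∣∣≤1⇒≡ (S ∩ part m k′ (residue k′ i)) (test-parts S ok (residue k′ i)) i j
      (Sub.x∈p∩q⁺ (i∈ , ∈-part i))
      (Sub.x∈p∩q⁺ (j∈ , subst (λ p → j ∈ˢ part m k′ p) (sym (Fin.suc-injective same)) (∈-part j))))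

  K-free : ¬ ContainsExp (suc q) (s + m) (Kgraph (3 + k′)) H
  K-free (φ , inj , edge∈) = contra (Fin.pigeonhole (n<1+n (2 + k′)) (λ i → colour (φ (inj₁ i))))
    where
    contra : (∃₂ λ i j → toℕ i < toℕ j × colour (φ (inj₁ i)) ≡ colour (φ (inj₁ j))) → ⊥
    contra (i , j , i<j , same) = <-irrefl (cong toℕ i≡j) i<j
      where
      ij∈ = Kgraph-edge⁺ (3 + k′) i j i<j
      x = Any.index ij∈
      pair : (i , j) ≡ lookup (edges (Kgraph (3 + k′))) x
      pair = AnyP.lookup-index ij∈
      i∈ = Sub.x∈p∪q⁺ (inj₁ (subst (λ z → φ (inj₁ i) ∈ˢ ⁅ φ (inj₁ z) ⁆) (cong proj₁ pair) (Sub.x∈⁅x⁆ (φ (inj₁ i)))))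
      j∈ = Sub.x∈p∪q⁺ (inj₂ (Sub.x∈p∪q⁺ (inj₁ (subst (λ z → φ (inj₁ j) ∈ˢ ⁅ φ (inj₁ z) ⁆) (cong proj₂ pair) (Sub.x∈⁅x⁆ (φ (inj₁ j)))))))
      i≡j : i ≡ j
      i≡j = [inj₁]-injective (inj (rainbow _ (edge∈ x) (φ (inj₁ i)) (φ (inj₁ j)) i∈ j∈ same))
        where
        [inj₁]-injective : ∀ {A B : Set} {a a′ : A} → inj₁ {B = B} a ≡ inj₁ a′ → a ≡ a′
        [inj₁]-injective refl = refl

  -- Two of the `suc s` edges have the same special vertex. `owner` recovers the matching edge from
  -- a vertex of the expansion, so injectivity of `φ` identifies the two edges.
  M-free : ¬ ContainsExp (suc q) (s + m) (Mgraph (suc s)) H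
  M-free (φ , inj , edge∈) = contra (Fin.pigeonhole (n<1+n s) (λ i → proj₁ (H⁻ (edge∈ (ix i)))))
    where
    Vertex : Set
    Vertex = ExpV (suc q) (Mgraph (suc s))
    es = edges (Mgraph (suc s))
    g : Fin (suc s) → (Fin (suc s) × Bool) × (Fin (suc s) × Bool)
    g i = (i , false) , (i , true)
    g∈ : ∀ i → g i ∈ es
    g∈ i = Mem.∈-map⁺ g (Mem.∈-allFin i)
    ix : Fin (suc s) → Fin (length es)
    ix i = Any.index (g∈ i)
    entry : ∀ i → g i ≡ lookup es (ix i)
    entry i = AnyP.lookup-index (g∈ i)
    owner : Vertex → Fin (suc s)
    owner (inj₁ (i , _)) = i
    owner (inj₂ (x , _)) = proj₁ (proj₁ (lookup es x))
    E : Fin (suc s) → Subset (s + m)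
    E i = ⁅ φ (inj₁ (proj₁ (lookup es (ix i)))) ⁆ ∪ ⁅ φ (inj₁ (proj₂ (lookup es (ix i)))) ⁆
            ∪ ⋃ (map (λ l → ⁅ φ (inj₂ (ix i , l)) ⁆) (allFin (suc q ∸ 2)))
    image : ∀ i x → x ∈ˢ E i → ∃ λ u → x ≡ φ u × owner u ≡ i
    image i x x∈ with Sub.x∈p∪q⁻ ⁅ φ (inj₁ (proj₁ (lookup es (ix i)))) ⁆ _ x∈
    ... | inj₁ p = _ , Sub.x∈⁅y⁆⇒x≡y _ p , sym (cong (λ z → proj₁ (proj₁ z)) (entry i))
    ... | inj₂ p with Sub.x∈p∪q⁻ ⁅ φ (inj₁ (proj₂ (lookup es (ix i)))) ⁆ _ p
    ...   | inj₁ p′ = _ , Sub.x∈⁅y⁆⇒x≡y _ p′ , sym (cong (λ z → proj₁ (proj₂ z)) (entry i))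
    ...   | inj₂ p′ with ∈-⋃⁻ (map (λ l → ⁅ φ (inj₂ (ix i , l)) ⁆) (allFin (suc q ∸ 2))) p′
    ...     | T , T∈ , x∈T with Mem.∈-map⁻ (λ l → ⁅ φ (inj₂ (ix i , l)) ⁆) T∈
    ...       | l , _ , refl = _ , Sub.x∈⁅y⁆⇒x≡y _ x∈T , sym (cong (λ z → proj₁ (proj₁ z)) (entry i))
    centre∈ : ∀ i → (proj₁ (H⁻ (edge∈ (ix i))) ↑ˡ m) ∈ˢ E i
    centre∈ i = let (w , S , _ , eq) = H⁻ (edge∈ (ix i)) in
      subst ((w ↑ˡ m) ∈ˢ_) (sym eq) (∈-++ᵛˡ ⁅ w ⁆ S (Sub.x∈⁅x⁆ w))
    contra : (∃₂ λ i j → toℕ i < toℕ j × proj₁ (H⁻ (edge∈ (ix i))) ≡ proj₁ (H⁻ (edge∈ (ix j)))) → ⊥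
    contra (i , j , i<j , same) with image i _ (centre∈ i) | image j _ (subst (λ w → (w ↑ˡ m) ∈ˢ E j) (sym same) (centre∈ j))
    ... | u , eq , ou | u′ , eq′ , ou′ = <-irrefl (cong toℕ (trans (sym ou) (trans (cong owner (inj (trans (sym eq) eq′))) ou′))) i<j

theorem1p10 : (r ℓ : ℕ) → 3 ≤ r → r ≤ ℓ →
    ∃ λ s₀ → (s : ℕ) → s₀ ≤ s →
    ∃ λ n₀ → (n : ℕ) → n₀ ≤ n →
    IsEx r n (λ H → ¬ ContainsExp r n (Kgraph (suc ℓ)) H × ¬ ContainsExp r n (Mgraph (suc s)) H)
    (s * t (r ∸ 1) (n ∸ s) (ℓ ∸ 1))
theorem1p10 (suc (suc (suc ρ))) (suc (suc k′)) (s≤s (s≤s (s≤s z≤n))) (s≤s q≤k) =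
  -- Here `r` is `3 + ρ` and `ℓ` is `2 + k′`, so the link of a special vertex has uniformity
  -- `2 + ρ`, there are `suc k′` parts, and `q≤k` is `r ≤ ℓ` lowered by one.
  s₀ , λ s s₀≤s → n₀ s , λ n n₀≤n → lower s n (s≤n s n s₀≤s n₀≤n) , λ { H (uniq , sizes) (K-free , M-free) →
    ≤-trans (upper-bound s n s₀≤s n₀≤n H uniq (λ e e∈ → All.lookup sizes e∈) K-free M-free)
            (*-monoʳ-≤ s (turán≤t (2 + ρ) (n ∸ s) k′)) }
  where
  open UpperBound ρ k′ q≤k
  Attained : ℕ → ℕ → Set
  Attained s n = ∃ λ H → IsRGraph (3 + ρ) n H
    × (¬ ContainsExp (3 + ρ) n (Kgraph (3 + k′)) H × ¬ ContainsExp (3 + ρ) n (Mgraph (suc s)) H)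
    × length H ≡ s * t (2 + ρ) (n ∸ s) (suc k′)
  lower : ∀ s n → s ≤ n → Attained s n
  lower s n s≤n′ = subst (Attained s) (m+[n∸m]≡n s≤n′)
    (H , (unique-H , All.tabulate (λ {e} → sizes-H e)) , (K-free , M-free)
       , trans length-H (cong (λ z → s * t (2 + ρ) z (suc k′)) (sym (m+n∸m≡n s (n ∸ s)))))
    where open Construction (2 + ρ) k′ s (n ∸ s)
theorem1p10 (suc (suc (suc ρ))) (suc zero) (s≤s (s≤s (s≤s z≤n))) (s≤s ())
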